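{- Let $c \geq 2$ be a fixed integer. Then there exist a constant $L = L(c) > 0$, depending only on $c$, and an integer $n_0 = n_0(c)$ such that for all $n \geq n_0$, $$X_{\leq (c-2)}^{(c)}(n) \geq L n^{\frac{4}{3}}.$$
   Context: A finite set of points in $\mathbb{R}^2$ is in general position if no three of its points lie on a line. A $c$-colored point set is a finite set $P \subset \mathbb{R}^2$ together with an arbitrary assignment of a color from $\{1,2,\ldots,c\}$ to each point of $P$. A triangle determined by $P$ is a triangle whose three vertices are points of $P$; it is monochromatic if its three vertices have the same color. For a finite $c$-colored point set $P \subset \mathbb{R}^2$ in general position and an integer $s \geq 0$, $X_{\leq s}^{(c)}(P)$ denotes the number of monochromatic triangles determined by $P$ that contain at most $s$ points of $P$ (of any color) in their interior. Define $$X_{\leq s}^{(c)}(n) := \min_{P} X_{\leq s}^{(c)}(P),$$ where the minimum is over all $c$-colored point sets $P \subset \mathbb{R}^2$ in general position with $|P| = n$. -}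

module Defs where

open import Data.Fin.Base as Fin using (Fin)
open import Data.Integer.Base as ℤ using (+_; +<+; +≤+)
import Data.Integer.Properties as ℤₚ
import Data.Integer.Solver as ℤSolver
open import Data.List.Base using (List; length)
open import Data.List.Membership.Propositional using (_∈_)
open import Data.List.Relation.Unary.Unique.Propositional using (Unique)
open import Data.Nat.Base as ℕ using (ℕ; zero; suc; _⊔_; z≤n; s≤s)
import Data.Nat.Properties as ℕₚ
import Data.Nat.Solver as ℕSolver
open import Data.Product.Base using (_×_; _,_; proj₁; proj₂; ∃)
open import Data.Rational.Base as ℚ using (ℚ; 0ℚ; 1ℚ; ½; _/_; ∣_∣)
import Data.Rational.Properties as ℚₚ
import Data.Rational.Solver as ℚSolver
open import Data.Rational.Unnormalised.Base as ℚᵘ using (mkℚᵘ; *≡*; *<*; *≤*)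
import Data.Rational.Unnormalised.Properties as ℚᵘₚ
open import Data.Sum.Base using (inj₁; inj₂)
open import Function.Bundles using (_⇔_)
open import Function.Definitions using (Injective)
open import Relation.Binary.PropositionalEquality
open import Relation.Nullary using (¬_; yes; no; contradiction)

infixl 7 _*_
infixl 6 _+_
infix  4 _≃_ _<_ _≤_ _≈_ _∈Interior_ _HasSize_

-- ℝ is the type of Cauchy sequences of rationals, with the setoid
-- equality _≃_ ("the difference tends to 0") in place of a quotient.

Eventually : (ℕ → Set) → Set
Eventually P = ∃ λ N → ∀ n → N ℕ.≤ n → P n

record ℝ : Set where
  constructor mkℝ
  field
    seq    : ℕ → ℚ
    cauchy : ∀ ε → 0ℚ ℚ.< ε →
             ∃ λ N → ∀ m n → N ℕ.≤ m → N ℕ.≤ n → ∣ seq m ℚ.- seq n ∣ ℚ.< ε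
open ℝ public

_≃_ : ℝ → ℝ → Set
x ≃ y = ∀ ε → 0ℚ ℚ.< ε → Eventually λ n → ∣ seq x n ℚ.- seq y n ∣ ℚ.< ε

_<_ : ℝ → ℝ → Set
x < y = ∃ λ ε → 0ℚ ℚ.< ε × Eventually λ n → seq x n ℚ.+ ε ℚ.≤ seq y n

_≤_ : ℝ → ℝ → Set
x ≤ y = ∀ ε → 0ℚ ℚ.< ε → Eventually λ n → seq x n ℚ.≤ seq y n ℚ.+ ε

fromℚ : ℚ → ℝ
fromℚ q = mkℝ (λ _ → q) λ ε 0<ε → 0 , λ _ _ _ _ →
  subst (ℚ._< ε) (sym (cong ∣_∣ (ℚₚ.+-inverseʳ q))) 0<ε

fromℕ : ℕ → ℝ
fromℕ n = fromℚ (+ n / 1)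

0ℝ 1ℝ : ℝ
0ℝ = fromℚ 0ℚ
1ℝ = fromℚ 1ℚ

_+_ : ℝ → ℝ → ℝ
x + y = mkℝ (λ n → seq x n ℚ.+ seq y n) λ ε 0<ε →
  let 0<½ε   = subst (ℚ._< ½ ℚ.* ε) (ℚₚ.*-zeroʳ ½) (ℚₚ.*-monoʳ-<-pos ½ 0<ε)
      M , hx = cauchy x (½ ℚ.* ε) 0<½ε
      N , hy = cauchy y (½ ℚ.* ε) 0<½ε
  in M ⊔ N , λ m n p q → begin-strict
    ∣ (seq x m ℚ.+ seq y m) ℚ.- (seq x n ℚ.+ seq y n) ∣
      ≡⟨ cong ∣_∣ (regroup (seq x m) (seq y m) (seq x n) (seq y n)) ⟩
    ∣ (seq x m ℚ.- seq x n) ℚ.+ (seq y m ℚ.- seq y n) ∣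
      ≤⟨ ℚₚ.∣p+q∣≤∣p∣+∣q∣ (seq x m ℚ.- seq x n) (seq y m ℚ.- seq y n) ⟩
    ∣ seq x m ℚ.- seq x n ∣ ℚ.+ ∣ seq y m ℚ.- seq y n ∣
      <⟨ ℚₚ.+-mono-< (hx m n (ℕₚ.m⊔n≤o⇒m≤o M N p) (ℕₚ.m⊔n≤o⇒m≤o M N q))
                     (hy m n (ℕₚ.m⊔n≤o⇒n≤o M N p) (ℕₚ.m⊔n≤o⇒n≤o M N q)) ⟩
    ½ ℚ.* ε ℚ.+ ½ ℚ.* ε ≡⟨ sym (ℚₚ.*-distribʳ-+ ε ½ ½) ⟩
    1ℚ ℚ.* ε            ≡⟨ ℚₚ.*-identityˡ ε ⟩
    ε                   ∎
  where
  open ℚₚ.≤-Reasoning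
  open ℚSolver.+-*-Solver
  regroup : ∀ a b c d → (a ℚ.+ b) ℚ.- (c ℚ.+ d) ≡ (a ℚ.- c) ℚ.+ (b ℚ.- d)
  regroup = solve 4 (λ a b c d →
    (a :+ b) :- (c :+ d) := (a :- c) :+ (b :- d)) refl

bounded : (x : ℝ) → ∃ λ B → 0ℚ ℚ.< B × Eventually λ n → ∣ seq x n ∣ ℚ.≤ B
bounded x =
  let N , h = cauchy x 1ℚ (ℚₚ.positive⁻¹ 1ℚ)
  in 1ℚ ℚ.+ ∣ seq x N ∣ , 0<1+ (seq x N) , N , λ n N≤n → begin
    ∣ seq x n ∣                               ≡⟨ cong ∣_∣ (split (seq x n) (seq x N)) ⟩
    ∣ (seq x n ℚ.- seq x N) ℚ.+ seq x N ∣
      ≤⟨ ℚₚ.∣p+q∣≤∣p∣+∣q∣ (seq x n ℚ.- seq x N) (seq x N) ⟩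
    ∣ seq x n ℚ.- seq x N ∣ ℚ.+ ∣ seq x N ∣
      ≤⟨ ℚₚ.+-monoˡ-≤ ∣ seq x N ∣ (ℚₚ.<⇒≤ (h n N N≤n ℕₚ.≤-refl)) ⟩
    1ℚ ℚ.+ ∣ seq x N ∣                        ∎
  where
  open ℚₚ.≤-Reasoning
  open ℚSolver.+-*-Solver
  split : ∀ a b → a ≡ (a ℚ.- b) ℚ.+ b
  split = solve 2 (λ a b → a := (a :- b) :+ b) refl
  0<1+ : ∀ q → 0ℚ ℚ.< 1ℚ ℚ.+ ∣ q ∣
  0<1+ q = ℚₚ.+-mono-<-≤ (ℚₚ.positive⁻¹ 1ℚ) (ℚₚ.0≤∣p∣ q)

-- A rational δ > 0 with C * δ = ε.
divide : ∀ C ε → 0ℚ ℚ.< C → 0ℚ ℚ.< ε → ∃ λ δ → 0ℚ ℚ.< δ × C ℚ.* δ ≡ ε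
divide C ε 0<C 0<ε = δ , 0<δ , eq
  where
  instance
    posC : ℚ.Positive C
    posC = ℚ.positive 0<C
    nzC : ℚ.NonZero C
    nzC = ℚₚ.pos⇒nonZero C
    posε : ℚ.Positive ε
    posε = ℚ.positive 0<ε
    pos1/C : ℚ.Positive (ℚ.1/ C)
    pos1/C = ℚₚ.1/pos⇒pos C
  δ = ε ℚ.* ℚ.1/ C
  0<δ : 0ℚ ℚ.< δ
  0<δ = ℚₚ.positive⁻¹ δ {{ℚₚ.pos*pos⇒pos ε (ℚ.1/ C)}}
  eq : C ℚ.* δ ≡ ε
  eq = begin
    C ℚ.* (ε ℚ.* ℚ.1/ C) ≡⟨ cong (C ℚ.*_) (ℚₚ.*-comm ε (ℚ.1/ C)) ⟩
    C ℚ.* (ℚ.1/ C ℚ.* ε) ≡⟨ sym (ℚₚ.*-assoc C (ℚ.1/ C) ε) ⟩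
    (C ℚ.* ℚ.1/ C) ℚ.* ε ≡⟨ cong (ℚ._* ε) (ℚₚ.*-inverseʳ C) ⟩
    1ℚ ℚ.* ε             ≡⟨ ℚₚ.*-identityˡ ε ⟩
    ε                    ∎
    where open ≡-Reasoning

∣*∣< : ∀ p q {B δ} → 0ℚ ℚ.< B → ∣ p ∣ ℚ.≤ B → ∣ q ∣ ℚ.< δ → ∣ p ℚ.* q ∣ ℚ.< B ℚ.* δ
∣*∣< p q {B} {δ} 0<B p≤B q<δ = begin-strict
  ∣ p ℚ.* q ∣     ≡⟨ ℚₚ.∣p*q∣≡∣p∣*∣q∣ p q ⟩
  ∣ p ∣ ℚ.* ∣ q ∣ ≤⟨ ℚₚ.*-monoʳ-≤-nonNeg ∣ q ∣ {{ℚₚ.∣-∣-nonNeg q}} p≤B ⟩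
  B ℚ.* ∣ q ∣     <⟨ ℚₚ.*-monoʳ-<-pos B {{ℚ.positive 0<B}} q<δ ⟩
  B ℚ.* δ         ∎
  where open ℚₚ.≤-Reasoning

_*_ : ℝ → ℝ → ℝ
x * y = mkℝ (λ n → seq x n ℚ.* seq y n) λ ε 0<ε →
  let A , 0<A , K , hA = bounded x
      B , 0<B , L , hB = bounded y
      δ , 0<δ , eq     = divide (A ℚ.+ B) ε (ℚₚ.+-mono-< 0<A 0<B) 0<ε
      M , hx           = cauchy x δ 0<δ
      N , hy           = cauchy y δ 0<δ
  in (K ⊔ L) ⊔ (M ⊔ N) , λ m n p q →
    let K≤m = ℕₚ.m⊔n≤o⇒m≤o K L (ℕₚ.m⊔n≤o⇒m≤o (K ⊔ L) (M ⊔ N) p)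
        L≤n = ℕₚ.m⊔n≤o⇒n≤o K L (ℕₚ.m⊔n≤o⇒m≤o (K ⊔ L) (M ⊔ N) q)
        p′  = ℕₚ.m⊔n≤o⇒n≤o (K ⊔ L) (M ⊔ N) p
        q′  = ℕₚ.m⊔n≤o⇒n≤o (K ⊔ L) (M ⊔ N) q
    in begin-strict
    ∣ seq x m ℚ.* seq y m ℚ.- seq x n ℚ.* seq y n ∣
      ≡⟨ cong ∣_∣ (regroup (seq x m) (seq y m) (seq x n) (seq y n)) ⟩
    ∣ seq x m ℚ.* (seq y m ℚ.- seq y n) ℚ.+ seq y n ℚ.* (seq x m ℚ.- seq x n) ∣
      ≤⟨ ℚₚ.∣p+q∣≤∣p∣+∣q∣ (seq x m ℚ.* (seq y m ℚ.- seq y n))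
                          (seq y n ℚ.* (seq x m ℚ.- seq x n)) ⟩
    ∣ seq x m ℚ.* (seq y m ℚ.- seq y n) ∣ ℚ.+ ∣ seq y n ℚ.* (seq x m ℚ.- seq x n) ∣
      <⟨ ℚₚ.+-mono-<
           (∣*∣< (seq x m) (seq y m ℚ.- seq y n) 0<A (hA m K≤m)
                 (hy m n (ℕₚ.m⊔n≤o⇒n≤o M N p′) (ℕₚ.m⊔n≤o⇒n≤o M N q′)))
           (∣*∣< (seq y n) (seq x m ℚ.- seq x n) 0<B (hB n L≤n)
                 (hx m n (ℕₚ.m⊔n≤o⇒m≤o M N p′) (ℕₚ.m⊔n≤o⇒m≤o M N q′))) ⟩
    A ℚ.* δ ℚ.+ B ℚ.* δ ≡⟨ sym (ℚₚ.*-distribʳ-+ δ A B) ⟩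
    (A ℚ.+ B) ℚ.* δ     ≡⟨ eq ⟩
    ε                   ∎
  where
  open ℚₚ.≤-Reasoning
  open ℚSolver.+-*-Solver
  regroup : ∀ a b c d → a ℚ.* b ℚ.- c ℚ.* d ≡ a ℚ.* (b ℚ.- d) ℚ.+ d ℚ.* (a ℚ.- c)
  regroup = solve 4 (λ a b c d →
    a :* b :- c :* d := a :* (b :- d) :+ d :* (a :- c)) refl

floor∛ : ℕ → ℕ
floor∛ zero    = 0
floor∛ (suc n) with suc (floor∛ n) ℕ.^ 3 ℕₚ.≤? suc n
... | yes _ = suc (floor∛ n)
... | no  _ = floor∛ n

floor∛-lower : ∀ n → floor∛ n ℕ.^ 3 ℕ.≤ n
floor∛-lower zero    = z≤n
floor∛-lower (suc n) with suc (floor∛ n) ℕ.^ 3 ℕₚ.≤? suc n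
... | yes p = p
... | no  _ = ℕₚ.m≤n⇒m≤1+n (floor∛-lower n)

floor∛-upper : ∀ n → n ℕ.< suc (floor∛ n) ℕ.^ 3
floor∛-upper zero    = s≤s z≤n
floor∛-upper (suc n) with suc (floor∛ n) ℕ.^ 3 ℕₚ.≤? suc n
... | yes _ = ℕₚ.≤-<-trans (floor∛-upper n) (ℕₚ.^-monoˡ-< 3 (ℕₚ.n<1+n (suc (floor∛ n))))
... | no ¬p = ℕₚ.≰⇒> ¬p

frac-< : ∀ a b j k → a ℕ.* suc k ℕ.< b ℕ.* suc j → + a / suc j ℚ.< + b / suc k
frac-< a b j k h = ℚₚ.toℚᵘ-cancel-<
  (ℚᵘₚ.<-respˡ-≃ (ℚᵘₚ.≃-sym (ℚₚ.toℚᵘ-fromℚᵘ (mkℚᵘ (+ a) j)))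
  (ℚᵘₚ.<-respʳ-≃ (ℚᵘₚ.≃-sym (ℚₚ.toℚᵘ-fromℚᵘ (mkℚᵘ (+ b) k)))
  (*<* (subst₂ ℤ._<_ (ℤₚ.pos-* a (suc k)) (ℤₚ.pos-* b (suc j)) (+<+ h)))))

frac-≤ : ∀ a b j k → a ℕ.* suc k ℕ.≤ b ℕ.* suc j → + a / suc j ℚ.≤ + b / suc k
frac-≤ a b j k h = ℚₚ.toℚᵘ-cancel-≤
  (ℚᵘₚ.≤-respˡ-≃ (ℚᵘₚ.≃-sym (ℚₚ.toℚᵘ-fromℚᵘ (mkℚᵘ (+ a) j)))
  (ℚᵘₚ.≤-respʳ-≃ (ℚᵘₚ.≃-sym (ℚₚ.toℚᵘ-fromℚᵘ (mkℚᵘ (+ b) k)))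
  (*≤* (subst₂ ℤ._≤_ (ℤₚ.pos-* a (suc k)) (ℤₚ.pos-* b (suc j)) (+≤+ h)))))

frac-* : ∀ a b j k → (+ a / suc j) ℚ.* (+ b / suc k) ≡ + (a ℕ.* b) / (suc j ℕ.* suc k)
frac-* a b j k = ℚₚ.toℚᵘ-injective (begin
  ℚ.toℚᵘ ((+ a / suc j) ℚ.* (+ b / suc k))
    ≈⟨ ℚₚ.toℚᵘ-homo-* (+ a / suc j) (+ b / suc k) ⟩
  ℚ.toℚᵘ (+ a / suc j) ℚᵘ.* ℚ.toℚᵘ (+ b / suc k)
    ≈⟨ ℚᵘₚ.*-cong (ℚₚ.toℚᵘ-fromℚᵘ (mkℚᵘ (+ a) j)) (ℚₚ.toℚᵘ-fromℚᵘ (mkℚᵘ (+ b) k)) ⟩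
  mkℚᵘ (+ a ℤ.* + b) (k ℕ.+ j ℕ.* suc k)
    ≡⟨ cong (λ z → mkℚᵘ z (k ℕ.+ j ℕ.* suc k)) (sym (ℤₚ.pos-* a b)) ⟩
  mkℚᵘ (+ (a ℕ.* b)) (k ℕ.+ j ℕ.* suc k)
    ≈⟨ ℚᵘₚ.≃-sym (ℚₚ.toℚᵘ-fromℚᵘ (mkℚᵘ (+ (a ℕ.* b)) (k ℕ.+ j ℕ.* suc k))) ⟩
  ℚ.toℚᵘ (+ (a ℕ.* b) / (suc j ℕ.* suc k)) ∎)
  where open import Relation.Binary.Reasoning.Setoid ℚᵘₚ.≃-setoid

frac-suc : ∀ a k → + suc a / suc k ≡ + a / suc k ℚ.+ + 1 / suc k
frac-suc a k = ℚₚ.toℚᵘ-injective (begin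
  ℚ.toℚᵘ (+ suc a / suc k)       ≈⟨ ℚₚ.toℚᵘ-fromℚᵘ (mkℚᵘ (+ suc a) k) ⟩
  mkℚᵘ (+ suc a) k               ≈⟨ *≡* (eq (+ a) (+ suc k)) ⟩
  mkℚᵘ (+ a) k ℚᵘ.+ mkℚᵘ (+ 1) k
    ≈⟨ ℚᵘₚ.≃-sym (ℚᵘₚ.+-cong (ℚₚ.toℚᵘ-fromℚᵘ (mkℚᵘ (+ a) k)) (ℚₚ.toℚᵘ-fromℚᵘ (mkℚᵘ (+ 1) k))) ⟩
  ℚ.toℚᵘ (+ a / suc k) ℚᵘ.+ ℚ.toℚᵘ (+ 1 / suc k)
    ≈⟨ ℚᵘₚ.≃-sym (ℚₚ.toℚᵘ-homo-+ (+ a / suc k) (+ 1 / suc k)) ⟩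
  ℚ.toℚᵘ (+ a / suc k ℚ.+ + 1 / suc k) ∎)
  where
  open import Relation.Binary.Reasoning.Setoid ℚᵘₚ.≃-setoid
  open ℤSolver.+-*-Solver
  eq : ∀ a k → (+ 1 ℤ.+ a) ℤ.* (k ℤ.* k) ≡ (a ℤ.* k ℤ.+ + 1 ℤ.* k) ℤ.* k
  eq = solve 2 (λ a k → (con (+ 1) :+ a) :* (k :* k)
                     := (a :* k :+ con (+ 1) :* k) :* k) refl

archimedean : ∀ ε → 0ℚ ℚ.< ε → Eventually λ k → + 1 / suc k ℚ.< ε
archimedean ε 0<ε = ℚ.↧ₙ ε , λ k d≤k →
  subst (+ 1 / suc k ℚ.<_) (ℚₚ.fromℚᵘ-toℚᵘ ε) (go ε 0<ε k d≤k)
  where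
  go : ∀ ε → 0ℚ ℚ.< ε → ∀ k → ℚ.↧ₙ ε ℕ.≤ k → + 1 / suc k ℚ.< ℚ.fromℚᵘ (ℚ.toℚᵘ ε)
  go (ℚ.mkℚ (+ suc p) d _) _ k d≤k = frac-< 1 (suc p) k d
    (ℕₚ.<-≤-trans (subst (ℕ._< suc k) (sym (ℕₚ.*-identityˡ (suc d))) (s≤s d≤k))
                  (ℕₚ.m≤m+n (suc k) (p ℕ.* suc k)))
  go (ℚ.mkℚ (+ 0) d _) (ℚ.*<* (+<+ ()))
  go (ℚ.mkℚ (ℤ.-[1+ p ]) d _) (ℚ.*<* ())

cube-* : ∀ m n → (m ℕ.* n) ℕ.^ 3 ≡ m ℕ.^ 3 ℕ.* n ℕ.^ 3
cube-* = solve 2 (λ a b →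
    (a :* b) :* ((a :* b) :* ((a :* b) :* con 1))
    := (a :* (a :* (a :* con 1))) :* (b :* (b :* (b :* con 1)))) refl
  where open ℕSolver.+-*-Solver

cube-cancel-< : ∀ {m n} → m ℕ.^ 3 ℕ.< n ℕ.^ 3 → m ℕ.< n
cube-cancel-< {m} {n} h with m ℕₚ.<? n
... | yes p = p
... | no ¬p = contradiction (ℕₚ.<-≤-trans h (ℕₚ.^-monoˡ-≤ 3 (ℕₚ.≮⇒≥ ¬p))) (ℕₚ.<-irrefl refl)

numer : ℕ → ℕ → ℕ
numer N k = floor∛ (N ℕ.* suc k ℕ.^ 3)

numer-close : ∀ N j k → numer N j ℕ.* suc k ℕ.< suc (numer N k) ℕ.* suc j
numer-close N j k = cube-cancel-< (begin-strict
  (numer N j ℕ.* suc k) ℕ.^ 3            ≡⟨ cube-* (numer N j) (suc k) ⟩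
  numer N j ℕ.^ 3 ℕ.* suc k ℕ.^ 3
    ≤⟨ ℕₚ.*-monoˡ-≤ (suc k ℕ.^ 3) (floor∛-lower (N ℕ.* suc j ℕ.^ 3)) ⟩
  (N ℕ.* suc j ℕ.^ 3) ℕ.* suc k ℕ.^ 3    ≡⟨ swap N (suc j ℕ.^ 3) (suc k ℕ.^ 3) ⟩
  (N ℕ.* suc k ℕ.^ 3) ℕ.* suc j ℕ.^ 3
    <⟨ ℕₚ.*-monoˡ-< (suc j ℕ.^ 3) {{ℕₚ.m^n≢0 (suc j) 3}} (floor∛-upper (N ℕ.* suc k ℕ.^ 3)) ⟩
  suc (numer N k) ℕ.^ 3 ℕ.* suc j ℕ.^ 3  ≡⟨ sym (cube-* (suc (numer N k)) (suc j)) ⟩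
  (suc (numer N k) ℕ.* suc j) ℕ.^ 3      ∎)
  where
  open ℕₚ.≤-Reasoning
  open ℕSolver.+-*-Solver
  swap : ∀ a b c → a ℕ.* b ℕ.* c ≡ a ℕ.* c ℕ.* b
  swap = solve 3 (λ a b c → a :* b :* c := a :* c :* b) refl

∣-∣< : ∀ p q {ε} → p ℚ.< q ℚ.+ ε → q ℚ.< p ℚ.+ ε → ∣ p ℚ.- q ∣ ℚ.< ε
∣-∣< p q {ε} h₁ h₂ with ℚₚ.∣p∣≡p∨∣p∣≡-p (p ℚ.- q)
... | inj₁ e = subst₂ ℚ._<_ (sym e) (cancel q ε) (ℚₚ.+-monoˡ-< (ℚ.- q) h₁)
  where
  open ℚSolver.+-*-Solver
  cancel : ∀ a b → (a ℚ.+ b) ℚ.- a ≡ b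
  cancel = solve 2 (λ a b → (a :+ b) :- a := b) refl
... | inj₂ e = subst₂ ℚ._<_ (trans (flip q p) (sym e)) (cancel p ε) (ℚₚ.+-monoˡ-< (ℚ.- p) h₂)
  where
  open ℚSolver.+-*-Solver
  cancel : ∀ a b → (a ℚ.+ b) ℚ.- a ≡ b
  cancel = solve 2 (λ a b → (a :+ b) :- a := b) refl
  flip : ∀ a b → a ℚ.- b ≡ ℚ.- (b ℚ.- a)
  flip = solve 2 (λ a b → a :- b := :- (b :- a)) refl

-- The k-th term is the largest multiple of 1/(k+1) whose cube is at most N.
∛ : ℕ → ℝ
∛ N = mkℝ (λ k → + numer N k / suc k) λ ε 0<ε →
  let K , h = archimedean ε 0<ε
  in K , λ m n K≤m K≤n →
    ∣-∣< (+ numer N m / suc m) (+ numer N n / suc n)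
      (ℚₚ.<-trans (within m n) (ℚₚ.+-monoʳ-< (+ numer N n / suc n) (h n K≤n)))
      (ℚₚ.<-trans (within n m) (ℚₚ.+-monoʳ-< (+ numer N m / suc m) (h m K≤m)))
  where
  within : ∀ j k → + numer N j / suc j ℚ.< + numer N k / suc k ℚ.+ + 1 / suc k
  within j k = subst (+ numer N j / suc j ℚ.<_) (frac-suc (numer N k) k)
    (frac-< (numer N j) (suc (numer N k)) j k (numer-close N j k))

frac-cube : ∀ a k → (+ a / suc k) ℚ.* ((+ a / suc k) ℚ.* (+ a / suc k))
                    ≡ + (a ℕ.* (a ℕ.* a)) / (suc k ℕ.* (suc k ℕ.* suc k))
frac-cube a k = trans (cong ((+ a / suc k) ℚ.*_) (frac-* a a k k))
                      (frac-* a (a ℕ.* a) k (k ℕ.+ k ℕ.* suc k))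

cube≡ : ∀ a → a ℕ.^ 3 ≡ a ℕ.* (a ℕ.* a)
cube≡ a = cong (λ z → a ℕ.* (a ℕ.* z)) (ℕₚ.*-identityʳ a)

∛-lower : ∀ N k → let x = + numer N k / suc k in x ℚ.* (x ℚ.* x) ℚ.≤ + N / 1
∛-lower N k = subst (ℚ._≤ + N / 1) (sym (frac-cube (numer N k) k))
  (frac-≤ (r ℕ.* (r ℕ.* r)) N _ 0
    (subst₂ ℕ._≤_ (trans (cube≡ r) (sym (ℕₚ.*-identityʳ _))) (cong (N ℕ.*_) (cube≡ (suc k)))
      (floor∛-lower (N ℕ.* suc k ℕ.^ 3))))
  where r = numer N k

∛-upper : ∀ N k → let y = + numer N k / suc k ℚ.+ + 1 / suc k in + N / 1 ℚ.< y ℚ.* (y ℚ.* y)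
∛-upper N k = subst (λ y → + N / 1 ℚ.< y ℚ.* (y ℚ.* y)) (frac-suc r k)
  (subst (+ N / 1 ℚ.<_) (sym (frac-cube (suc r) k))
    (frac-< N (suc r ℕ.* (suc r ℕ.* suc r)) 0 _
      (subst₂ ℕ._<_ (cong (N ℕ.*_) (cube≡ (suc k))) (trans (cube≡ (suc r)) (sym (ℕₚ.*-identityʳ _)))
        (floor∛-upper (N ℕ.* suc k ℕ.^ 3)))))
  where r = numer N k

*-mono-≤-nonNeg : ∀ {p q r s} → 0ℚ ℚ.≤ r → 0ℚ ℚ.≤ q → p ℚ.≤ q → r ℚ.≤ s → p ℚ.* r ℚ.≤ q ℚ.* s
*-mono-≤-nonNeg {p} {q} {r} {s} 0≤r 0≤q p≤q r≤s = ℚₚ.≤-trans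
  (ℚₚ.*-monoʳ-≤-nonNeg r {{ℚ.nonNegative 0≤r}} p≤q)
  (ℚₚ.*-monoˡ-≤-nonNeg q {{ℚ.nonNegative 0≤q}} r≤s)

eventually-≤ : (x : ℝ) → ∃ λ B → 0ℚ ℚ.< B × Eventually λ n → seq x n ℚ.≤ B
eventually-≤ x = let B , 0<B , K , h = bounded x
              in B , 0<B , K , λ n K≤n → ℚₚ.≤-trans (p≤∣p∣ (seq x n)) (h n K≤n)
  where
  p≤∣p∣ : ∀ p → p ℚ.≤ ∣ p ∣
  p≤∣p∣ p with ℚₚ.≤-total 0ℚ p
  ... | inj₁ 0≤p = ℚₚ.≤-reflexive (sym (ℚₚ.0≤p⇒∣p∣≡p 0≤p))
  ... | inj₂ p≤0 = ℚₚ.≤-trans p≤0 (ℚₚ.0≤∣p∣ p)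

0≤∛ : ∀ N → 0ℝ ≤ ∛ N
0≤∛ N ε 0<ε = 0 , λ k _ → ℚₚ.≤-trans (frac-≤ 0 (numer N k) 0 k z≤n)
  (subst (ℚ._≤ + numer N k / suc k ℚ.+ ε) (ℚₚ.+-identityʳ _)
    (ℚₚ.+-monoʳ-≤ (+ numer N k / suc k) (ℚₚ.<⇒≤ 0<ε)))

∛-cubed : ∀ N → ∛ N * (∛ N * ∛ N) ≃ fromℕ N
∛-cubed N ε 0<ε =
  let B , 0<B , K , hB = eventually-≤ (∛ N)
      C                = (1ℚ ℚ.+ three ℚ.* B) ℚ.+ three ℚ.* (B ℚ.* B)
      0<C              = ℚₚ.+-mono-< (ℚₚ.+-mono-< (ℚₚ.positive⁻¹ 1ℚ) (0<* three B 0<3 0<B))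
                                     (0<* three (B ℚ.* B) 0<3 (0<* B B 0<B 0<B))
      δ , 0<δ , eq     = divide C ε 0<C 0<ε
      L , hL           = archimedean δ 0<δ
  in K ⊔ L , λ k p → let x = + numer N k / suc k ; η = + 1 / suc k in
    ∣-∣< (x ℚ.* (x ℚ.* x)) (+ N / 1)
      (ℚₚ.≤-<-trans (∛-lower N k)
        (subst (ℚ._< + N / 1 ℚ.+ ε) (ℚₚ.+-identityʳ _) (ℚₚ.+-monoʳ-< (+ N / 1) 0<ε)))
      (ℚₚ.<-≤-trans (∛-upper N k)
        (subst₂ ℚ._≤_ (sym (expand x η)) refl
          (ℚₚ.+-monoʳ-≤ (x ℚ.* (x ℚ.* x))
            (ℚₚ.≤-trans
              (*-mono-≤-nonNeg (0≤frac 1 k) (ℚₚ.<⇒≤ 0<C)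
                (bound (0≤frac (numer N k) k) (0≤frac 1 k) (η≤1 k)
                       (hB k (ℕₚ.m⊔n≤o⇒m≤o K L p)) (ℚₚ.<⇒≤ 0<B))
                (ℚₚ.<⇒≤ (hL k (ℕₚ.m⊔n≤o⇒n≤o K L p))))
              (ℚₚ.≤-reflexive eq)))))
  where
  three = 1ℚ ℚ.+ (1ℚ ℚ.+ 1ℚ)
  0<3 : 0ℚ ℚ.< three
  0<3 = ℚₚ.positive⁻¹ three
  0<* : ∀ p q → 0ℚ ℚ.< p → 0ℚ ℚ.< q → 0ℚ ℚ.< p ℚ.* q
  0<* p q 0<p 0<q = ℚₚ.positive⁻¹ (p ℚ.* q) {{ℚₚ.pos*pos⇒pos p {{ℚ.positive 0<p}} q {{ℚ.positive 0<q}}}}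
  0≤frac : ∀ a k → 0ℚ ℚ.≤ + a / suc k
  0≤frac a k = frac-≤ 0 a 0 k z≤n
  η≤1 : ∀ k → + 1 / suc k ℚ.≤ 1ℚ
  η≤1 k = frac-≤ 1 1 k 0 (s≤s z≤n)
  expand : ∀ x h → (x ℚ.+ h) ℚ.* ((x ℚ.+ h) ℚ.* (x ℚ.+ h))
         ≡ x ℚ.* (x ℚ.* x) ℚ.+ ((h ℚ.* h ℚ.+ three ℚ.* (x ℚ.* h)) ℚ.+ three ℚ.* (x ℚ.* x)) ℚ.* h
  expand = solve 2 (λ x h → (x :+ h) :* ((x :+ h) :* (x :+ h))
    := x :* (x :* x) :+ ((h :* h :+ con three :* (x :* h)) :+ con three :* (x :* x)) :* h) refl
    where open ℚSolver.+-*-Solver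
  bound : ∀ {x h B} → 0ℚ ℚ.≤ x → 0ℚ ℚ.≤ h → h ℚ.≤ 1ℚ → x ℚ.≤ B → 0ℚ ℚ.≤ B →
          (h ℚ.* h ℚ.+ three ℚ.* (x ℚ.* h)) ℚ.+ three ℚ.* (x ℚ.* x)
          ℚ.≤ (1ℚ ℚ.+ three ℚ.* B) ℚ.+ three ℚ.* (B ℚ.* B)
  bound {x} {h} {B} 0≤x 0≤h h≤1 x≤B 0≤B =
    ℚₚ.+-mono-≤
      (ℚₚ.+-mono-≤
        (*-mono-≤-nonNeg 0≤h (ℚₚ.nonNegative⁻¹ 1ℚ) h≤1 h≤1)
        (ℚₚ.*-monoˡ-≤-nonNeg three
          (subst (x ℚ.* h ℚ.≤_) (ℚₚ.*-identityʳ B) (*-mono-≤-nonNeg 0≤h 0≤B x≤B h≤1))))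
      (ℚₚ.*-monoˡ-≤-nonNeg three (*-mono-≤-nonNeg 0≤x 0≤B x≤B x≤B))

Point : Set
Point = ℝ × ℝ

_≈_ : Point → Point → Set
(x₁ , y₁) ≈ (x₂ , y₂) = x₁ ≃ x₂ × y₁ ≃ y₂

record Line : Set where
  field
    a b d         : ℝ
    nondegenerate : ¬ (a ≃ 0ℝ × b ≃ 0ℝ)

OnLine : Line → Point → Set
OnLine ℓ (x , y) = a * x + b * y ≃ d
  where open Line ℓ

Collinear : Point → Point → Point → Set
Collinear p q r = ∃ λ ℓ → OnLine ℓ p × OnLine ℓ q × OnLine ℓ r

-- The interior of a nondegenerate triangle consists of the convex
-- combinations of its vertices whose coefficients are all positive.
_∈Interior_ : Point → Point × Point × Point → Set
(x , y) ∈Interior ((x₁ , y₁) , (x₂ , y₂) , (x₃ , y₃)) =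
  ∃ λ α → ∃ λ β → ∃ λ γ →
    0ℝ < α × 0ℝ < β × 0ℝ < γ ×
    α + β + γ ≃ 1ℝ ×
    x ≃ α * x₁ + β * x₂ + γ * x₃ ×
    y ≃ α * y₁ + β * y₂ + γ * y₃

record ColouredPointSet (c n : ℕ) : Set where
  field
    point    : Fin n → Point
    distinct : Injective _≡_ _≈_ point
    colour   : Fin n → Fin c
open ColouredPointSet public

GeneralPosition : ∀ {c n} → ColouredPointSet c n → Set
GeneralPosition P = ∀ i j k → i ≢ j → j ≢ k → i ≢ k →
  ¬ Collinear (point P i) (point P j) (point P k)

-- Cardinality and minimum are relations rather than functions because
-- neither membership in a triangle nor the attainment of a minimum is
-- decidable for the real numbers above.
_HasSize_ : {A : Set} → (A → Set) → ℕ → Set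
Q HasSize k = ∃ λ xs → Unique xs × (∀ x → x ∈ xs ⇔ Q x) × length xs ≡ k

IsMinimum : (ℕ → Set) → ℕ → Set
IsMinimum V m = V m × (∀ k → V k → m ℕ.≤ k)

¬¬-minimum : ∀ {V : ℕ → Set} {k} → V k → ¬ ¬ ∃ (IsMinimum V)
¬¬-minimum {V} {k} Vk ∄min = none (suc k) k ℕₚ.≤-refl Vk
  where
  none : ∀ b j → j ℕ.< b → ¬ V j
  none (suc b) j (s≤s j≤b) Vj = ∄min (j , Vj , λ i Vi →
    ℕₚ.≮⇒≥ λ i<j → none b i (ℕₚ.<-≤-trans i<j j≤b) Vi)

-- A triangle is given by the indices of its vertices in increasing
-- order, so that each one is counted once.
MonochromaticTriangle≤ : ∀ {c n} → ℕ → ColouredPointSet c n → Fin n × Fin n × Fin n → Set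
MonochromaticTriangle≤ s P (i , j , k) =
  i Fin.< j × j Fin.< k ×
  colour P i ≡ colour P j × colour P j ≡ colour P k ×
  ∃ λ t → (λ l → point P l ∈Interior (point P i , point P j , point P k)) HasSize t × t ℕ.≤ s

-- X≤ s P k says that k is the number of monochromatic triangles of P
-- with at most s points of P in their interior.
X≤ : ∀ {c n} → ℕ → ColouredPointSet c n → ℕ → Set
X≤ s P k = MonochromaticTriangle≤ s P HasSize k

-- minX≤ c s n m says that m is the minimum of these numbers over all
-- c-coloured sets of n points in general position.
minX≤ : (c s n m : ℕ) → Set
minX≤ c s n = IsMinimum λ k →
  ∃ λ (P : ColouredPointSet c n) → GeneralPosition P × X≤ s P k

infix 9 _^4/3
_^4/3 : ℕ → ℝ
n ^4/3 = ∛ (n ℕ.^ 4)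

{-# OPTIONS --safe #-}

-- A triangle is red if its vertices are, for a fixed colour class of size at least n/c; put d = c − 1.
-- Among interior-disjoint red triangles without red points inside, those that are not good (that
-- have d or more points inside) number at most 1/d times the non-red points.  Hence:
--
-- * If in some convex part D of the set (the points in a convex region) a colour has more than its
--   share |D|/c of the points by t, then the stars of triangles around the points of that colour
--   give about |D| t good triangles.
-- * Otherwise every large convex part is balanced up to t, and its hull has at most 2t vertices,
--   as peeling off a red hull would make it unbalanced.  In a part with r red points whose hull is
--   red, fan out the hull and refine the fan with at most about n/t² red points into triangles
--   with at most t² unused red points each.  By Mirsky's theorem a cell with u ≤ t² such points
--   has a chain of at least u/t of them, each inside the triangle spanned by a fixed side of
--   the cell and the next one, and this yields u/t more triangles at the corners of the cell
--   than the star bound.  So about r/t triangles at hull vertices or refinement points are good.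
--   Now peel off the hull, exclude the refinement points from later refinements, and repeat
--   about n/t times.
--
-- Both cases give about n^(4/3) good triangles for t = n^(1/3).  The reals enter only through the
-- orientations of triples, which may be assumed decided since the final inequality between
-- natural numbers is decidable.
module Submission where

open import Data.Empty using (⊥; ⊥-elim)
open import Data.Fin.Base as Fin using (Fin)
import Data.Fin.Properties as Finₚ
open import Data.List.Base using (List; []; _∷_; _++_; length; filter; allFin; map)
import Data.List.Properties as Listₚ
open import Data.List.Membership.Propositional using (_∈_; _∉_)
open import Data.List.Membership.Propositional.Properties using (∈-++⁺ˡ; ∈-++⁺ʳ; ∈-++⁻; ∈-∃++; ∈-filter⁺; ∈-filter⁻; ∈-allFin; ∈-map⁺)
open import Data.List.Relation.Binary.Subset.Propositional using (_⊆_)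
open import Data.List.Relation.Unary.All as All using (All; []; _∷_)
open import Data.List.Relation.Unary.Any using (here; there; any?)
open import Data.List.Relation.Unary.AllPairs using ([]; _∷_)
open import Data.List.Relation.Unary.Unique.Propositional using (Unique)
import Data.List.Relation.Unary.Unique.Propositional.Properties as Uniqueₚ
open import Data.Nat.Base as ℕ using (ℕ; zero; suc; _∸_; z≤n; s≤s; NonZero; ⌊_/2⌋)
import Data.Nat.Properties as ℕₚ
import Data.Nat.DivMod as DivMod
open import Data.Nat.Tactic.RingSolver using (solve-∀)
open import Data.Product.Base using (∃; _×_; _,_; proj₁; proj₂)
open import Data.Sum.Base using (_⊎_; inj₁; inj₂; [_,_]′)
open import Data.Unit.Base using (⊤; tt)
open import Function.Base using (_∘_; id)
open import Level using (0ℓ)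
open import Relation.Binary.PropositionalEquality
open import Relation.Nullary using (¬_; Dec; yes; no; contradiction)
open import Relation.Nullary.Decidable using (¬?; _×-dec_; _⊎-dec_; _→-dec_; map′; decidable-stable)
open import Relation.Unary using (Pred; Decidable)

-- The star count of a part with `r` red and `b` other points produces about `r` triangles, of which
-- up to `b / d` can fail to be good. In a balanced part `b` is close to `d r`, so this count can
-- cancel completely, and an imbalance of `t` can swallow a further `t` triangles. Everything
-- therefore rests on the surplus of triangles over red points, called `gain` below, and a stage
-- pays only if its `gain` exceeds `t`; this is what chains and refinement points are for. Triangles
-- of different stages may overlap, so they are told apart by a marked vertex that serves once: a
-- hull vertex disappears by peeling, whereas a refinement point stays in the region and has to be
-- banned from later refinements. The bans are a budget: about `n / t^2` points in each of about
-- `n / t` stages remain a small part of `n` only if `t` is at least of order `n^(1/3)`. The same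
-- value equalises the two cases, which give about `n t` and `(n / t)^2` triangles.

module Combinatorics where

  open import Data.Nat.Base using (_+_; _*_; _≤_; _<_)

  -- Finite counting.

  length-⊆ : {A : Set} {xs ys : List A} → Unique xs → xs ⊆ ys → length xs ≤ length ys
  length-⊆ {xs = []}     _          _   = z≤n
  length-⊆ {xs = x ∷ xs} (x≢ ∷ xs!) sub with ∈-∃++ (sub (here refl))
  ... | ys , zs , refl = subst (suc (length xs) ≤_) (sym eq) (s≤s (length-⊆ xs! sub′))
    where
    eq : length (ys ++ x ∷ zs) ≡ suc (length (ys ++ zs))
    eq = trans (Listₚ.length-++ ys)
      (trans (ℕₚ.+-suc (length ys) (length zs)) (cong suc (sym (Listₚ.length-++ ys))))
    sub′ : xs ⊆ ys ++ zs
    sub′ y∈xs with ∈-++⁻ ys (sub (there y∈xs))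
    ... | inj₁ y∈ys          = ∈-++⁺ˡ y∈ys
    ... | inj₂ (here refl)   = contradiction refl (All.lookup x≢ y∈xs)
    ... | inj₂ (there y∈zs)  = ∈-++⁺ʳ ys y∈zs

  -- Irreflexivity and transitivity are required of members only, because the angular orders around
  -- a point, to which this is applied, are transitive only on suitable sets.
  minimal : {A : Set} {_≺_ : A → A → Set} → (∀ a b → Dec (a ≺ b)) → ∀ x xs →
    (∀ {a} → a ∈ x ∷ xs → ¬ a ≺ a) →
    (∀ {a b c} → a ∈ x ∷ xs → b ∈ x ∷ xs → c ∈ x ∷ xs → a ≺ b → b ≺ c → a ≺ c) →
    ∃ λ m → m ∈ x ∷ xs × (∀ {y} → y ∈ x ∷ xs → ¬ y ≺ m)
  minimal _≺?_ x [] irr _ = x , here refl , λ { (here refl) → irr (here refl) }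
  minimal _≺?_ x (y ∷ ys) irr tr
    with minimal _≺?_ y ys (irr ∘ there) (λ a b c → tr (there a) (there b) (there c))
  ... | m , m∈ , min with x ≺? m
  ... | no  x⊀m = m , there m∈ , λ { (here refl) → x⊀m ; (there z∈) → min z∈ }
  ... | yes x≺m = x , here refl , λ
    { (here refl) → irr (here refl)
    ; (there z∈) z≺x → min z∈ (tr (there z∈) (here refl) (there m∈) z≺x x≺m) }

  count : {A : Set} {P : Pred A 0ℓ} → Decidable P → List A → ℕ
  count P? xs = length (filter P? xs)

  count-⊎ : {A : Set} {P Q R : Pred A 0ℓ} (P? : Decidable P) (Q? : Decidable Q) (R? : Decidable R) →
    (∀ {x} → P x → R x) → (∀ {x} → Q x → R x) → (∀ {x} → P x → ¬ Q x) →
    ∀ xs → count P? xs + count Q? xs ≤ count R? xs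
  count-⊎ P? Q? R? P⇒R Q⇒R P#Q [] = z≤n
  count-⊎ P? Q? R? P⇒R Q⇒R P#Q (x ∷ xs) with ih ← count-⊎ P? Q? R? P⇒R Q⇒R P#Q xs | P? x | Q? x | R? x
  ... | yes p | yes q | _     = contradiction q (P#Q p)
  ... | yes p | no  _ | yes _ = s≤s ih
  ... | no  _ | yes q | yes _ = subst (_≤ suc (count R? xs)) (sym (ℕₚ.+-suc (count P? xs) (count Q? xs))) (s≤s ih)
  ... | no  _ | no  _ | yes _ = ℕₚ.m≤n⇒m≤1+n ih
  ... | no  _ | no  _ | no  _ = ih
  ... | yes p | _     | no ¬r = contradiction (P⇒R p) ¬r
  ... | _     | yes q | no ¬r = contradiction (Q⇒R q) ¬r

  count-cover : {A : Set} {P Q R : Pred A 0ℓ} (P? : Decidable P) (Q? : Decidable Q) (R? : Decidable R) →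
    (∀ {x} → R x → P x ⊎ Q x) → ∀ xs → count R? xs ≤ count P? xs + count Q? xs
  count-cover P? Q? R? cover [] = z≤n
  count-cover P? Q? R? cover (x ∷ xs) with ih ← count-cover P? Q? R? cover xs | P? x | Q? x | R? x
  ... | yes _ | yes _ | yes _ = s≤s (ℕₚ.≤-trans ih (ℕₚ.+-monoʳ-≤ _ (ℕₚ.n≤1+n _)))
  ... | yes _ | yes _ | no  _ = ℕₚ.m≤n⇒m≤1+n (ℕₚ.≤-trans ih (ℕₚ.+-monoʳ-≤ _ (ℕₚ.n≤1+n _)))
  ... | yes _ | no  _ | yes _ = s≤s ih
  ... | yes _ | no  _ | no  _ = ℕₚ.m≤n⇒m≤1+n ih
  ... | no  _ | yes _ | yes _ = subst (suc (count R? xs) ≤_) (sym (ℕₚ.+-suc (count P? xs) (count Q? xs))) (s≤s ih)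
  ... | no  _ | yes _ | no  _ = subst (count R? xs ≤_) (sym (ℕₚ.+-suc (count P? xs) (count Q? xs))) (ℕₚ.m≤n⇒m≤1+n ih)
  ... | no  _ | no  _ | no  _ = ih
  ... | no ¬p | no ¬q | yes r = [ (λ p → contradiction p ¬p) , (λ q → contradiction q ¬q) ]′ (cover r)

  count-mono : {A : Set} {P Q : Pred A 0ℓ} (P? : Decidable P) (Q? : Decidable Q) →
    (∀ {x} → P x → Q x) → ∀ xs → count P? xs ≤ count Q? xs
  count-mono P? Q? P⇒Q [] = z≤n
  count-mono P? Q? P⇒Q (x ∷ xs) with ih ← count-mono P? Q? P⇒Q xs | P? x | Q? x
  ... | yes _ | yes _ = s≤s ih
  ... | yes p | no ¬q = contradiction (P⇒Q p) ¬q
  ... | no  _ | yes _ = ℕₚ.m≤n⇒m≤1+n ih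
  ... | no  _ | no  _ = ih

  # : ∀ {n} {P : Pred (Fin n) 0ℓ} → Decidable P → ℕ
  # P? = count P? (allFin _)

  #-mono : ∀ {n} {P Q : Pred (Fin n) 0ℓ} (P? : Decidable P) (Q? : Decidable Q) →
    (∀ {x} → P x → Q x) → # P? ≤ # Q?
  #-mono P? Q? P⇒Q = count-mono P? Q? P⇒Q (allFin _)

  #-⊎ : ∀ {n} {P Q R : Pred (Fin n) 0ℓ} (P? : Decidable P) (Q? : Decidable Q) (R? : Decidable R) →
    (∀ {x} → P x → R x) → (∀ {x} → Q x → R x) → (∀ {x} → P x → ¬ Q x) → # P? + # Q? ≤ # R?
  #-⊎ P? Q? R? P⇒R Q⇒R P#Q = count-⊎ P? Q? R? P⇒R Q⇒R P#Q (allFin _)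

  #-⊎₃ : ∀ {n} {P Q R W : Pred (Fin n) 0ℓ}
    (P? : Decidable P) (Q? : Decidable Q) (R? : Decidable R) (W? : Decidable W) →
    (∀ {x} → P x → W x) → (∀ {x} → Q x → W x) → (∀ {x} → R x → W x) →
    (∀ {x} → P x → ¬ Q x) → (∀ {x} → Q x → ¬ R x) → (∀ {x} → R x → ¬ P x) →
    # P? + # Q? + # R? ≤ # W?
  #-⊎₃ P? Q? R? W? P⇒W Q⇒W R⇒W P#Q Q#R R#P = ℕₚ.≤-trans
    (ℕₚ.+-monoˡ-≤ (# R?) (#-⊎ P? Q? (λ x → P? x ⊎-dec Q? x) inj₁ inj₂ P#Q))
    (#-⊎ (λ x → P? x ⊎-dec Q? x) R? W? [ P⇒W , Q⇒W ]′ R⇒W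
      [ (λ p r → R#P r p) , Q#R ]′)

  #-cover : ∀ {n} {P Q R : Pred (Fin n) 0ℓ} (P? : Decidable P) (Q? : Decidable Q) (R? : Decidable R) →
    (∀ {x} → R x → P x ⊎ Q x) → # R? ≤ # P? + # Q?
  #-cover P? Q? R? cover = count-cover P? Q? R? cover (allFin _)

  #-cover₃ : ∀ {n} {P Q R W : Pred (Fin n) 0ℓ}
    (P? : Decidable P) (Q? : Decidable Q) (R? : Decidable R) (W? : Decidable W) →
    (∀ {x} → W x → P x ⊎ Q x ⊎ R x) → # W? ≤ # P? + # Q? + # R?
  #-cover₃ P? Q? R? W? cover = ℕₚ.≤-trans
    (#-cover P? (λ x → Q? x ⊎-dec R? x) W? cover)
    (ℕₚ.≤-trans (ℕₚ.+-monoʳ-≤ (# P?) (#-cover Q? R? (λ x → Q? x ⊎-dec R? x) id))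
      (ℕₚ.≤-reflexive (sym (ℕₚ.+-assoc (# P?) (# Q?) (# R?)))))

  list≤# : ∀ {n} {P : Pred (Fin n) 0ℓ} (P? : Decidable P) {xs} → Unique xs → (∀ {x} → x ∈ xs → P x) →
    length xs ≤ # P?
  list≤# P? xs! all = length-⊆ xs! (λ x∈xs → ∈-filter⁺ P? (∈-allFin _) (all x∈xs))

  #≤list : ∀ {n} {P : Pred (Fin n) 0ℓ} (P? : Decidable P) {xs} → (∀ {x} → P x → x ∈ xs) →
    # P? ≤ length xs
  #≤list {n} P? sub = length-⊆ (Uniqueₚ.filter⁺ P? (Uniqueₚ.allFin⁺ n))
    (λ x∈ → sub (proj₂ (∈-filter⁻ P? {xs = allFin n} x∈)))

  #-extract : ∀ {n} {P Q : Pred (Fin n) 0ℓ} (P? : Decidable P) (Q? : Decidable Q) {z} →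
    P z → (∀ {x} → Q x → P x) → ¬ Q z → # Q? < # P?
  #-extract P? Q? {z} Pz Q⇒P ¬Qz = ℕₚ.≤-trans
    (ℕₚ.+-monoˡ-≤ (# Q?) (list≤# (Finₚ._≟ z) ([] ∷ []) (λ { (here refl) → refl })))
    (#-⊎ (Finₚ._≟ z) Q? P? (λ { refl → Pz }) Q⇒P (λ { refl → ¬Qz }))

  #-nonempty : ∀ {n} {P : Pred (Fin n) 0ℓ} (P? : Decidable P) → 0 < # P? → ∃ P
  #-nonempty {n} P? pos with filter P? (allFin n) in eq
  ... | x ∷ _ = x , proj₂ (∈-filter⁻ P? {xs = allFin n} (subst (x ∈_) (sym eq) (here refl)))

  #-minimal : ∀ {n} {P : Pred (Fin n) 0ℓ} (P? : Decidable P) {_≺_ : Fin n → Fin n → Set} →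
    (∀ a b → Dec (a ≺ b)) → ∃ P → (∀ {a} → P a → ¬ a ≺ a) →
    (∀ {a b c} → P a → P b → P c → a ≺ b → b ≺ c → a ≺ c) →
    ∃ λ m → P m × (∀ {y} → P y → ¬ y ≺ m)
  #-minimal {n} {P} P? _≺?_ (x , Px) irr tr =
    let m , m∈ , min = minimal _≺?_ x (filter P? (allFin n)) (λ a → irr (get a))
                               (λ a b c → tr (get a) (get b) (get c))
    in m , get m∈ , λ Py → min (there (∈-filter⁺ P? (∈-allFin _) Py))
    where
    get : ∀ {a} → a ∈ x ∷ filter P? (allFin n) → P a
    get (here refl) = Px
    get (there a∈)  = proj₂ (∈-filter⁻ P? {xs = allFin n} a∈)

  -- P ≤ Q is derived from L ≤ R by exhibiting the slack of the linear combination.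
  linear : ∀ {L R} P Q s → L ≤ R → Q + L ≡ P + R + s → P ≤ Q
  linear {L} {R} P Q s L≤R eq = ℕₚ.+-cancelʳ-≤ R P Q (begin
    P + R     ≤⟨ ℕₚ.m≤m+n (P + R) s ⟩
    P + R + s ≡⟨ sym eq ⟩
    Q + L     ≤⟨ ℕₚ.+-monoʳ-≤ Q L≤R ⟩
    Q + R     ∎)
    where open ℕₚ.≤-Reasoning

  -- The closed half-plane to the left of `u v`: in general position its boundary line carries no
  -- points other than `u` and `v`.
  data Side {A : Set} (ccw : A → A → A → Set) (u v : A) : A → Set where
    source : Side ccw u v u
    target : Side ccw u v v
    left   : ∀ {y} → ccw u v y → Side ccw u v y

  -- Knuth's CC systems, with his interiority and transitivity axioms replaced by
  -- the convexity of closed half-planes, from which they follow.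
  record OrderType (n : ℕ) : Set₁ where
    field
      ccw   : Fin n → Fin n → Fin n → Set
      ccw?  : ∀ a b c → Dec (ccw a b c)
      rot   : ∀ {a b c} → ccw a b c → ccw b c a
      asym  : ∀ {a b c} → ccw a b c → ¬ ccw b a c
      total : ∀ {a b c} → a ≢ b → b ≢ c → a ≢ c → ccw a b c ⊎ ccw b a c

    In : Fin n → Fin n → Fin n → Fin n → Set
    In a b c z = ccw a b z × ccw b c z × ccw c a z

    field
      convex : ∀ {u v a b c z} → Side ccw u v a → Side ccw u v b → Side ccw u v c →
               In a b c z → ccw u v z

  -- Triangles and half-planes in an order type.

  module OrderTypeProperties {n : ℕ} (O : OrderType n) where
    open OrderType O public

    V : Set
    V = Fin n

    LeftOf : V → V → V → Set
    LeftOf = Side ccw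

    In? : ∀ a b c z → Dec (In a b c z)
    In? a b c z = ccw? a b z ×-dec ccw? b c z ×-dec ccw? c a z

    ≢₁₂ : ∀ {a b c} → ccw a b c → a ≢ b
    ≢₁₂ p refl = asym p p

    ≢₂₃ : ∀ {a b c} → ccw a b c → b ≢ c
    ≢₂₃ p = ≢₁₂ (rot p)

    ≢₁₃ : ∀ {a b c} → ccw a b c → a ≢ c
    ≢₁₃ p = ≢-sym (≢₁₂ (rot (rot p)))

    -- If `a b c` were clockwise, all three would lie in the closed half-plane left of `b a`, and
    -- convexity would put `z` strictly there, against `ccw a b z`.
    In⇒ccw : ∀ {a b c z} → In a b c z → ccw a b c
    In⇒ccw i@(abz , bcz , caz) with total (≢₁₂ abz) (≢₁₂ bcz) (≢-sym (≢₁₂ caz))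
    ... | inj₁ abc = abc
    ... | inj₂ bac = contradiction (convex target source (left bac) i) (asym abz)

    In-rot : ∀ {a b c z} → In a b c z → In b c a z
    In-rot (p , q , r) = q , r , p

    opposite : ∀ {u v y} → LeftOf u v y → LeftOf v u y → y ≡ u ⊎ y ≡ v
    opposite source   _        = inj₁ refl
    opposite target   _        = inj₂ refl
    opposite (left _) source   = inj₂ refl
    opposite (left _) target   = inj₁ refl
    opposite (left p) (left q) = contradiction q (asym p)

    two-points : ∀ {u v a b c} → ccw a b c → a ≡ u ⊎ a ≡ v → b ≡ u ⊎ b ≡ v → c ≡ u ⊎ c ≡ v → ⊥
    two-points abc (inj₁ refl) (inj₁ refl) _           = ≢₁₂ abc refl
    two-points abc (inj₂ refl) (inj₂ refl) _           = ≢₁₂ abc refl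
    two-points abc (inj₁ refl) (inj₂ _)    (inj₁ refl) = ≢₁₃ abc refl
    two-points abc (inj₂ refl) (inj₁ _)    (inj₂ refl) = ≢₁₃ abc refl
    two-points abc (inj₁ _)    (inj₂ refl) (inj₂ refl) = ≢₂₃ abc refl
    two-points abc (inj₂ _)    (inj₁ refl) (inj₁ refl) = ≢₂₃ abc refl

    record Closed (x y z p : V) : Set where
      constructor closed
      field
        side₁ : LeftOf x y p
        side₂ : LeftOf y z p
        side₃ : LeftOf z x p
    open Closed public

    module _ {x y z : V} (xyz : ccw x y z) where
      vertex₁ : Closed x y z x
      vertex₁ = closed source (left (rot xyz)) target

      vertex₂ : Closed x y z y
      vertex₂ = closed target source (left (rot (rot xyz)))

      vertex₃ : Closed x y z z
      vertex₃ = closed (left xyz) target source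

    In⇒Closed : ∀ {x y z p} → In x y z p → Closed x y z p
    In⇒Closed (p , q , r) = closed (left p) (left q) (left r)

    Closed-convex : ∀ {x y z a b c p} → Closed x y z a → Closed x y z b → Closed x y z c →
                    In a b c p → In x y z p
    Closed-convex (closed a₁ a₂ a₃) (closed b₁ b₂ b₃) (closed c₁ c₂ c₃) i =
      convex a₁ b₁ c₁ i , convex a₂ b₂ c₂ i , convex a₃ b₃ c₃ i

    Closed-cases : ∀ {x y z p} → Closed x y z p → p ≡ x ⊎ p ≡ y ⊎ p ≡ z ⊎ In x y z p
    Closed-cases (closed source   _        _)        = inj₁ refl
    Closed-cases (closed target   _        _)        = inj₂ (inj₁ refl)
    Closed-cases (closed (left _) source   _)        = inj₂ (inj₁ refl)
    Closed-cases (closed (left _) target   _)        = inj₂ (inj₂ (inj₁ refl))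
    Closed-cases (closed (left _) (left _) source)   = inj₂ (inj₂ (inj₁ refl))
    Closed-cases (closed (left _) (left _) target)   = inj₁ refl
    Closed-cases (closed (left p) (left q) (left r)) = inj₂ (inj₂ (inj₂ (p , q , r)))

    Closed-mono : ∀ {x y z a b c p} → Closed x y z a → Closed x y z b → Closed x y z c →
                  Closed a b c p → Closed x y z p
    Closed-mono a b c p with Closed-cases p
    ... | inj₁ refl               = a
    ... | inj₂ (inj₁ refl)        = b
    ... | inj₂ (inj₂ (inj₁ refl)) = c
    ... | inj₂ (inj₂ (inj₂ i))    = In⇒Closed (Closed-convex a b c i)

    In-trans : ∀ {x y z q p} → In x y z q → In x y q p → In x y z p
    In-trans i = Closed-convex (vertex₁ (In⇒ccw i)) (vertex₂ (In⇒ccw i)) (In⇒Closed i)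

    Closed-rot : ∀ {x y z p} → Closed x y z p → Closed y z x p
    Closed-rot (closed a b c) = closed b c a

    not-all-left : ∀ {a b c z p} → In a b c z → ccw a z p → ccw b z p → ccw c z p → ⊥
    not-all-left i azp bzp czp =
      ≢₁₃ (convex (left (rot azp)) (left (rot bzp)) (left (rot czp)) i) refl

    not-all-right : ∀ {a b c z p} → In a b c z → ccw z a p → ccw z b p → ccw z c p → ⊥
    not-all-right i zap zbp zcp =
      ≢₂₃ (convex (left (rot (rot zap))) (left (rot (rot zbp))) (left (rot (rot zcp))) i) refl

    -- The line through `z` and `p` has vertices on both sides, since otherwise convexity would
    -- place `z` strictly to one side of a line through itself. Going round the triangle, the side
    -- therefore changes in the right direction between two consecutive vertices, and these span
    -- with `z` the triangle that contains `p`.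
    In-split : ∀ {a b c z p} → In a b c z → In a b c p → p ≢ z →
               In a b z p ⊎ In b c z p ⊎ In c a z p
    In-split {a} {b} {c} {z} {p} z∈@(abz , bcz , caz) p∈@(abp , bcp , cap) p≢z
      with total {a} {z} {p} (≢₁₃ abz) (≢-sym p≢z) (≢₁₃ abp)
         | total {b} {z} {p} (≢₁₃ bcz) (≢-sym p≢z) (≢₁₃ bcp)
         | total {c} {z} {p} (≢₁₃ caz) (≢-sym p≢z) (≢₁₃ cap)
    ... | inj₁ azp | inj₁ bzp | inj₁ czp = ⊥-elim (not-all-left z∈ azp bzp czp)
    ... | inj₂ zap | inj₂ zbp | inj₂ zcp = ⊥-elim (not-all-right z∈ zap zbp zcp)
    ... | inj₂ zap | inj₁ bzp | _        = inj₁ (abp , bzp , zap)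
    ... | _        | inj₂ zbp | inj₁ czp = inj₂ (inj₁ (bcp , czp , zbp))
    ... | inj₁ azp | _        | inj₂ zcp = inj₂ (inj₂ (cap , azp , zcp))

    -- Order around p: valid because a cyclic triple would have p in its interior.
    around-trans : ∀ {p a b c} → (∀ {x} → x ≡ a ⊎ x ≡ b ⊎ x ≡ c → p ≢ x) →
      ¬ In a b c p → ccw p a b → ccw p b c → ccw p a c
    around-trans {p} {a} {b} {c} p≢ p∉ pab pbc
      with total {p} {a} {c} (p≢ (inj₁ refl)) a≢c (p≢ (inj₂ (inj₂ refl)))
      where
      a≢c : a ≢ c
      a≢c refl = asym (rot pab) (rot pbc)
    ... | inj₁ pac = pac
    ... | inj₂ apc = contradiction (rot pab , rot pbc , rot (rot apc)) p∉

    -- A triangle with all its vertices left of `p q` cannot contain `p`, which would then be left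
    -- of a line through itself.
    around-transˡ : ∀ {p q a b c} → ccw p q a → ccw p q b → ccw p q c →
      ccw p a b → ccw p b c → ccw p a c
    around-transˡ a b c = around-trans
      (λ { (inj₁ refl) → ≢₁₃ a ; (inj₂ (inj₁ refl)) → ≢₁₃ b ; (inj₂ (inj₂ refl)) → ≢₁₃ c })
      (λ i → ≢₁₃ (convex (left a) (left b) (left c) i) refl)

  -- Good triangles, families of them, and empty triangles around a point.

  module Coloured {n d : ℕ} (O : OrderType n) (colour : Fin n → Fin (suc d)) where
    open OrderTypeProperties O public

    Triple : Set
    Triple = V × V × V

    -- There are `c = suc d` colours, so at most `c - 2` interior points means fewer than `d`.
    Good : V → V → V → Set
    Good a b c = ccw a b c × colour a ≡ colour b × colour b ≡ colour c × # (In? a b c) < d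

    data Member (F R : Pred V 0ℓ) : Triple → Set where
      member : ∀ {a b c} → Good a b c → F a → R a → R b → R c → Member F R (a , b , c)

    Distinct : Pred Triple 0ℓ → ℕ → Set
    Distinct M k = ∃ λ ts → Unique ts × (∀ {t} → t ∈ ts → M t) × length ts ≡ k

    Distinct-++ : ∀ {M₁ M₂ M : Pred Triple 0ℓ} {k₁ k₂} → (∀ {t} → M₁ t → M t) → (∀ {t} → M₂ t → M t) →
      (∀ {t} → M₁ t → ¬ M₂ t) → Distinct M₁ k₁ → Distinct M₂ k₂ → Distinct M (k₁ + k₂)
    Distinct-++ {M = M} f g dis (ts , ts! , m₁ , refl) (us , us! , m₂ , refl) =
      ts ++ us , Uniqueₚ.++⁺ ts! us! (λ (t∈ , t∈′) → dis (m₁ t∈) (m₂ t∈′)) , m , Listₚ.length-++ ts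
      where
      m : ∀ {t} → t ∈ ts ++ us → M t
      m t∈ with ∈-++⁻ ts t∈
      ... | inj₁ t∈ts = f (m₁ t∈ts)
      ... | inj₂ t∈us = g (m₂ t∈us)

    -- A triangle is listed with a vertex in F first and the others following anticlockwise,
    -- so that families with disjoint F are disjoint.
    Family : (F R : Pred V 0ℓ) → ℕ → Set
    Family F R = Distinct (Member F R)

    Member-mono : ∀ {F F′ R R′ t} → (∀ {a} → F a → F′ a) → (∀ {a} → R a → R′ a) →
                  Member F R t → Member F′ R′ t
    Member-mono f r (member g Fa Ra Rb Rc) = member g (f Fa) (r Ra) (r Rb) (r Rc)

    Family-mono : ∀ {F F′ R R′ k} → (∀ {a} → F a → F′ a) → (∀ {a} → R a → R′ a) →
                  Family F R k → Family F′ R′ k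
    Family-mono {F} {F′} {R} {R′} f r (ts , ts! , mem , len) =
      ts , ts! , (Member-mono {F} {F′} {R} {R′} f r ∘ mem) , len

    Family-[] : ∀ {F R} → Family F R 0
    Family-[] = [] , [] , (λ ()) , refl

    Family-singleton : ∀ {F R a b c} → Member F R (a , b , c) → Family F R 1
    Family-singleton {a = a} {b} {c} m = (a , b , c) ∷ [] , [] ∷ [] , (λ { (here refl) → m }) , refl

    Family-++ : ∀ {F₁ F₂ F R₁ R₂ R k₁ k₂} →
      (∀ {a} → F₁ a → F a) → (∀ {a} → F₂ a → F a) →
      (∀ {a} → R₁ a → R a) → (∀ {a} → R₂ a → R a) →
      (∀ {t} → Member F₁ R₁ t → ¬ Member F₂ R₂ t) →
      Family F₁ R₁ k₁ → Family F₂ R₂ k₂ → Family F R (k₁ + k₂)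
    Family-++ {F₁} {F₂} {F} {R₁} {R₂} {R} f₁ f₂ r₁ r₂ =
      Distinct-++ (Member-mono {F₁} {F} {R₁} {R} f₁ r₁) (Member-mono {F₂} {F} {R₂} {R} f₂ r₂)

    Family-++₃ : ∀ {F₁ F₂ F₃ F R₁ R₂ R₃ R k₁ k₂ k₃} →
      (∀ {a} → F₁ a → F a) → (∀ {a} → F₂ a → F a) → (∀ {a} → F₃ a → F a) →
      (∀ {a} → R₁ a → R a) → (∀ {a} → R₂ a → R a) → (∀ {a} → R₃ a → R a) →
      (∀ {t} → Member F₁ R₁ t → ¬ Member F₂ R₂ t) →
      (∀ {t} → Member F₂ R₂ t → ¬ Member F₃ R₃ t) →
      (∀ {t} → Member F₃ R₃ t → ¬ Member F₁ R₁ t) →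
      Family F₁ R₁ k₁ → Family F₂ R₂ k₂ → Family F₃ R₃ k₃ → Family F R (k₁ + k₂ + k₃)
    Family-++₃ {F₁} {F₂} {F₃} {F} {R₁} {R₂} {R₃} {R} f₁ f₂ f₃ r₁ r₂ r₃ d₁₂ d₂₃ d₃₁ T₁ T₂ T₃ = Distinct-++
      {M₁ = λ t → Member F₁ R₁ t ⊎ Member F₂ R₂ t}
      [ Member-mono {F₁} {F} {R₁} {R} f₁ r₁ , Member-mono {F₂} {F} {R₂} {R} f₂ r₂ ]′
      (Member-mono {F₃} {F} {R₃} {R} f₃ r₃)
      [ (λ m₁ m₃ → d₃₁ m₃ m₁) , d₂₃ ]′ (Distinct-++ inj₁ inj₂ d₁₂ T₁ T₂) T₃

    -- Neighbouring cells share only the line `u v`: a triangle found on both sides would have all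
    -- three vertices among `u` and `v`. Disjointness of families thus needs no argument about
    -- interiors.
    separated-members : ∀ {F₁ F₂ R₁ R₂} u v → (∀ {a} → R₁ a → LeftOf u v a) →
      (∀ {a} → R₂ a → LeftOf v u a) → ∀ {t} → Member F₁ R₁ t → Member F₂ R₂ t → ⊥
    separated-members u v r₁ r₂ (member (abc , _) _ a b c) (member _ _ a′ b′ c′) =
      two-points abc (opposite (r₁ a) (r₂ a′)) (opposite (r₁ b) (r₂ b′)) (opposite (r₁ c) (r₂ c′))

    within? : ∀ {P : Pred V 0ℓ} → Decidable P → ∀ a b c → Decidable (λ x → P x × In a b c x)
    within? P? a b c x = P? x ×-dec In? a b c x

    within : ∀ {P : Pred V 0ℓ} → Decidable P → V → V → V → ℕ
    within P? a b c = # (within? P? a b c)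

    within-rot : ∀ {P : Pred V 0ℓ} (P? : Decidable P) a b c → within P? a b c ≡ within P? b c a
    within-rot P? a b c = ℕₚ.≤-antisym
      (#-mono (within? P? a b c) (within? P? b c a) (λ (p , i) → p , In-rot i))
      (#-mono (within? P? b c a) (within? P? a b c) (λ (p , i) → p , In-rot (In-rot i)))

    equal? : ∀ a → Decidable {A = V} (_≡ a)
    equal? a x = x Finₚ.≟ a

    #equal≤1 : ∀ a → # (equal? a) ≤ 1
    #equal≤1 a = #≤list (equal? a) {a ∷ []} (λ { refl → here refl })

    within-cover : ∀ {P : Pred V 0ℓ} (P? : Decidable P) {x y z q} → In x y z q →
      within P? x y z ≤ 1 + (within P? x y q + within P? y z q + within P? z x q)
    within-cover {P} P? {x} {y} {z} {q} q∈ = ℕₚ.≤-trans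
      (#-cover (equal? q) sub? (within? P? x y z) cases)
      (ℕₚ.+-mono-≤ (#equal≤1 q) (#-cover₃ (within? P? x y q) (within? P? y z q) (within? P? z x q) sub? id))
      where
      sub? : Decidable _
      sub? p = within? P? x y q p ⊎-dec within? P? y z q p ⊎-dec within? P? z x q p
      cases : ∀ {p} → P p × In x y z p →
        p ≡ q ⊎ (P p × In x y q p) ⊎ (P p × In y z q p) ⊎ (P p × In z x q p)
      cases {p} (Pp , i) with p Finₚ.≟ q
      ... | yes p≡q = inj₁ p≡q
      ... | no  p≢q with In-split q∈ i p≢q
      ... | inj₁ j        = inj₂ (inj₁ (Pp , j))
      ... | inj₂ (inj₁ j) = inj₂ (inj₂ (inj₁ (Pp , j)))
      ... | inj₂ (inj₂ j) = inj₂ (inj₂ (inj₂ (Pp , j)))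

    within-⊎ : ∀ {P : Pred V 0ℓ} (P? : Decidable P) {x y z q} → In x y z q →
      within P? x y q + within P? y z q + within P? z x q ≤ within P? x y z
    within-⊎ P? {x} {y} {z} {q} i =
      #-⊎₃ (within? P? x y q) (within? P? y z q) (within? P? z x q) (within? P? x y z)
        (λ (p , j) → p , In-trans i j)
        (λ (p , j) → p , In-rot (In-rot (In-trans (In-rot i) j)))
        (λ (p , j) → p , In-rot (In-trans (In-rot (In-rot i)) j))
        (λ (_ , _ , yqp , _) (_ , _ , _ , qyp) → asym yqp qyp)
        (λ (_ , _ , zqp , _) (_ , _ , _ , qzp) → asym zqp qzp)
        (λ (_ , _ , xqp , _) (_ , _ , _ , qxp) → asym xqp qxp)

    within-< : ∀ {P : Pred V 0ℓ} (P? : Decidable P) {x y z q} → P q → In x y z q →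
      within P? x y q + within P? y z q + within P? z x q < within P? x y z
    within-< P? {x} {y} {z} {q} Pq i = ℕₚ.≤-<-trans
      (#-⊎₃ (within? P? x y q) (within? P? y z q) (within? P? z x q)
        (λ p → within? P? x y z p ×-dec ¬? (p Finₚ.≟ q))
        (λ (p , j@(_ , yqp , _)) → (p , In-trans i j) , ≢-sym (≢₂₃ yqp))
        (λ (p , j@(_ , zqp , _)) → (p , In-rot (In-rot (In-trans (In-rot i) j))) , ≢-sym (≢₂₃ zqp))
        (λ (p , j@(_ , xqp , _)) → (p , In-rot (In-trans (In-rot (In-rot i)) j)) , ≢-sym (≢₂₃ xqp))
        (λ (_ , _ , yqp , _) (_ , _ , _ , qyp) → asym yqp qyp)
        (λ (_ , _ , zqp , _) (_ , _ , _ , qzp) → asym zqp qzp)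
        (λ (_ , _ , xqp , _) (_ , _ , _ , qxp) → asym xqp qxp))
      (#-extract (within? P? x y z) _ (Pq , i) proj₁ (λ (_ , q≢q) → q≢q refl))

    module Colour (κ : Fin (suc d)) where

      Red : V → Set
      Red x = colour x ≡ κ

      Red? : Decidable Red
      Red? x = colour x Finₚ.≟ κ

      Blue? : Decidable (λ x → ¬ Red x)
      Blue? x = ¬? (Red? x)

      reds blues : V → V → V → ℕ
      reds  = within Red?
      blues = within Blue?

      inside≤blues : ∀ {a b c} → (∀ {x} → Red x → ¬ In a b c x) → # (In? a b c) ≤ blues a b c
      inside≤blues {a} {b} {c} none = #-mono (In? a b c) (within? Blue? a b c) λ i → (λ r → none r i) , i

      -- Consecutive elements a, a′ of q, A in the order around p form a triangle p a a′ with no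
      -- red points inside, and the interiors of these triangles are disjoint.
      wedge : ∀ k {p q} {A B : Pred V 0ℓ} (A? : Decidable A) (B? : Decidable B) → # A? ≤ k →
        Red p → Red q → (∀ {a} → A a → Red a × ccw p q a) →
        (∀ {a b x} → a ≡ q ⊎ A a → b ≡ q ⊎ A b → In p a b x → Red x → A x) →
        (∀ {a b x} → a ≡ q ⊎ A a → b ≡ q ⊎ A b → In p a b x → ¬ Red x → B x) →
        ∃ λ k → Family (_≡ p) (λ a → a ≡ p ⊎ a ≡ q ⊎ A a) k × d * # A? ≤ d * k + # B?
      wedge k A? B? A≤k pR qR redA completeA completeB with 0 ℕₚ.<? # A?
      wedge k A? B? A≤k pR qR redA completeA completeB | no A≡0 = 0 , Family-[] ,
        subst (λ a → d * a ≤ d * 0 + # B?) (sym (ℕₚ.n≤0⇒n≡0 (ℕₚ.≮⇒≥ A≡0))) (ℕₚ.m≤m+n (d * 0) (# B?))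
      wedge zero A? B? A≤k pR qR redA completeA completeB | yes 0<A =
        contradiction (ℕₚ.<-≤-trans 0<A A≤k) (ℕₚ.<-irrefl refl)
      wedge (suc k) {p} {q} {A} {B} A? B? A≤k pR qR redA completeA completeB | yes 0<A
        with #-minimal A? (ccw? p) (#-nonempty A? 0<A) (λ _ x → ≢₂₃ x refl)
               (λ a b c → around-transˡ (proj₂ (redA a)) (proj₂ (redA b)) (proj₂ (redA c)))
      ... | a , Aa , min = result
        where
        pqa : ccw p q a
        pqa = proj₂ (redA Aa)
        aR : Red a
        aR = proj₁ (redA Aa)
        A′ B′ : Pred V 0ℓ
        A′ x = A x × ccw p a x
        B′ x = B x × ccw p a x
        A′? : Decidable A′
        A′? x = A? x ×-dec ccw? p a x
        B′? : Decidable B′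
        B′? x = B? x ×-dec ccw? p a x
        A′<A : # A′? < # A?
        A′<A = #-extract A? A′? Aa proj₁ (λ (_ , paa) → ≢₂₃ paa refl)
        A≤1+A′ : # A? ≤ 1 + # A′?
        A≤1+A′ = ℕₚ.≤-trans (#-cover (equal? a) A′? A? after) (ℕₚ.+-monoˡ-≤ (# A′?) (#equal≤1 a))
          where
          after : ∀ {x} → A x → x ≡ a ⊎ A′ x
          after {x} Ax with x Finₚ.≟ a
          ... | yes x≡a = inj₁ x≡a
          ... | no  x≢a with total {p} {a} (≢₁₃ pqa) (≢-sym x≢a) (≢₁₃ (proj₂ (redA Ax)))
          ... | inj₁ pax = inj₂ (Ax , pax)
          ... | inj₂ apx = contradiction (rot apx) (min Ax)
        old : ∀ {x} → x ≡ a ⊎ A′ x → x ≡ q ⊎ A x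
        old (inj₁ refl)     = inj₂ Aa
        old (inj₂ (Ax , _)) = inj₂ Ax
        beyond : ∀ {u v x} → u ≡ a ⊎ A′ u → v ≡ a ⊎ A′ v → In p u v x → ccw p a x
        beyond u v = convex source (side u) (side v)
          where
          side : ∀ {u} → u ≡ a ⊎ A′ u → LeftOf p a u
          side (inj₁ refl)       = target
          side (inj₂ (_ , pau)) = left pau
        rest = wedge k A′? B′? (ℕₚ.≤-pred (ℕₚ.≤-trans A′<A A≤k)) pR aR (λ (Ax , pax) → proj₁ (redA Ax) , pax)
          (λ u v i r → completeA (old u) (old v) i r , beyond u v i)
          (λ u v i r → completeB (old u) (old v) i r , beyond u v i)
        no-red : ∀ {x} → Red x → ¬ In p q a x
        no-red r i@(_ , _ , apx) =
          min (completeA (inj₁ refl) (inj₂ Aa) i r) (rot apx)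
        ≢q : ∀ {x} → x ≡ q → ¬ (x ≡ p ⊎ x ≡ a ⊎ A′ x)
        ≢q refl (inj₁ refl)                   = ≢₁₂ pqa refl
        ≢q refl (inj₂ (inj₁ refl))            = ≢₂₃ pqa refl
        ≢q refl (inj₂ (inj₂ (Aq , _)))        = ≢₂₃ (proj₂ (redA Aq)) refl
        common : ∀ {x} → x ≡ p ⊎ x ≡ q ⊎ x ≡ a → x ≡ p ⊎ x ≡ a ⊎ A′ x → x ≡ p ⊎ x ≡ a
        common (inj₁ x≡p)        _  = inj₁ x≡p
        common (inj₂ (inj₁ x≡q)) x∈ = contradiction x∈ (≢q x≡q)
        common (inj₂ (inj₂ x≡a)) _  = inj₂ x≡a
        old-region : ∀ {x} → x ≡ p ⊎ x ≡ a ⊎ A′ x → x ≡ p ⊎ x ≡ q ⊎ A x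
        old-region (inj₁ x≡p)               = inj₁ x≡p
        old-region (inj₂ (inj₁ refl))       = inj₂ (inj₂ Aa)
        old-region (inj₂ (inj₂ (Ax , _)))   = inj₂ (inj₂ Ax)
        result : ∃ λ k → Family (_≡ p) (λ a → a ≡ p ⊎ a ≡ q ⊎ A a) k × d * # A? ≤ d * k + # B?
        -- If the triangle `p q a` is not good, it holds at least `d` points, all blue. Since `B′`
        -- keeps only points past the ray `p a`, these are charged to no later triangle.
        result with rest | # (In? p q a) ℕₚ.<? d
        ... | k , ts , bound | yes few =
          1 + k , Family-++ {F₁ = _≡ p} {R₁ = λ x → x ≡ p ⊎ x ≡ q ⊎ x ≡ a} id id
            (λ { (inj₁ e) → inj₁ e ; (inj₂ (inj₁ e)) → inj₂ (inj₁ e) ; (inj₂ (inj₂ refl)) → inj₂ (inj₂ Aa) })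
            old-region
            (λ { (member (bce , _) _ b c e) (member _ _ b′ c′ e′) → two-points bce (common b b′) (common c c′) (common e e′) })
            (Family-singleton (member (pqa , trans pR (sym qR) , trans qR (sym aR) , few)
              refl (inj₁ refl) (inj₂ (inj₁ refl)) (inj₂ (inj₂ refl)))) ts ,
          arith d (# A?) (# A′?) k (# B′?) (# B?) A≤1+A′ bound (#-mono B′? B? proj₁)
          where
          arith : ∀ d A A′ k B′ B → A ≤ 1 + A′ → d * A′ ≤ d * k + B′ → B′ ≤ B → d * A ≤ d * (1 + k) + B
          arith d A A′ k B′ B h₁ h₂ h₃ = linear (d * A) (d * (1 + k) + B) 0
            (ℕₚ.+-mono-≤ (ℕₚ.*-monoʳ-≤ d h₁) (ℕₚ.+-mono-≤ h₂ h₃)) (eq d A A′ k B′ B)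
            where
            eq : ∀ d A A′ k B′ B → d * (1 + k) + B + (d * A + (d * A′ + B′)) ≡
              d * A + (d * (1 + A′) + (d * k + B′ + B)) + 0
            eq = solve-∀
        ... | k , ts , bound | no many = k , Family-mono id old-region ts ,
          arith d (# A?) (# A′?) k (# B′?) (blues p q a) (# B?) A≤1+A′ bound
            (ℕₚ.≤-trans (ℕₚ.≮⇒≥ many) (inside≤blues no-red))
            (#-⊎ B′? (within? Blue? p q a) B? proj₁ (λ (b , i) → completeB (inj₁ refl) (inj₂ Aa) i b)
              (λ (_ , pax) (_ , _ , _ , apx) → asym pax apx))
          where
          arith : ∀ d A A′ k B′ b B → A ≤ 1 + A′ → d * A′ ≤ d * k + B′ → d ≤ b → B′ + b ≤ B →
            d * A ≤ d * k + B
          arith d A A′ k B′ b B h₁ h₂ h₃ h₄ = linear (d * A) (d * k + B) 0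
            (ℕₚ.+-mono-≤ (ℕₚ.*-monoʳ-≤ d h₁) (ℕₚ.+-mono-≤ h₂ (ℕₚ.+-mono-≤ h₃ h₄))) (eq d A A′ k B′ b B)
            where
            eq : ∀ d A A′ k B′ b B → d * k + B + (d * A + (d * A′ + (d + (B′ + b)))) ≡
              d * A + (d * (1 + A′) + (d * k + B′ + (b + B))) + 0
            eq = solve-∀

  -- Stars, chains and the gain of a single triangle.

  module Triangles {n d : ℕ} (O : OrderType n) (colour : Fin n → Fin (suc d)) (κ : Fin (suc d)) where
    open Coloured O colour public
    open Colour κ public

    -- The red points inside cut the angle at `p` into `reds p u v + 1` sectors; `v` is put into `A`
    -- as the last ray and accounts for the `+ 1`.
    star : ∀ {p u v} → ccw p u v → Red p → Red u → Red v →
      ∃ λ k → Family (_≡ p) (Closed p u v) k × d * (reds p u v + 1) ≤ d * k + blues p u v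
    star {p} {u} {v} puv pR uR vR =
      let k , ts , bound = wedge (# A?) A? (within? Blue? p u v) ℕₚ.≤-refl pR uR redA
                             (λ a b i r → inj₂ (r , corner a b i)) (λ a b i ¬r → ¬r , corner a b i)
      in k , Family-mono id [ (λ { refl → vertex₁ puv }) , toClosed ]′ ts ,
         ℕₚ.≤-trans (ℕₚ.*-monoʳ-≤ d more) bound
      where
      A : Pred V 0ℓ
      A x = x ≡ v ⊎ Red x × In p u v x
      A? : Decidable A
      A? x = (x Finₚ.≟ v) ⊎-dec within? Red? p u v x
      redA : ∀ {a} → A a → Red a × ccw p u a
      redA (inj₁ refl)          = vR , puv
      redA (inj₂ (r , pua , _)) = r , pua
      toClosed : ∀ {a} → a ≡ u ⊎ A a → Closed p u v a
      toClosed (inj₁ refl)               = vertex₂ puv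
      toClosed (inj₂ (inj₁ refl))        = vertex₃ puv
      toClosed (inj₂ (inj₂ (_ , i)))     = In⇒Closed i
      corner : ∀ {a b x} → a ≡ u ⊎ A a → b ≡ u ⊎ A b → In p a b x → In p u v x
      corner a b = Closed-convex (vertex₁ puv) (toClosed a) (toClosed b)
      more : reds p u v + 1 ≤ # A?
      more = subst (_≤ # A?) (ℕₚ.+-comm 1 (reds p u v))
        (#-extract A? (within? Red? p u v) (inj₁ refl) inj₂ (λ (_ , _ , uvv , _) → ≢₂₃ uvv refl))

    -- The last point of a chain comes first in the list.
    data Chain (x y : V) : V → List V → Set where
      []  : ∀ {z} → Chain x y z []
      _∷_ : ∀ {z q qs} → Red q × In x y z q → Chain x y q qs → Chain x y z (q ∷ qs)

    -- Each point q of the chain is the apex of one triangle at x and one at y more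
    -- than the star at x alone would give.
    chain-family : ∀ {x y z qs} → ccw x y z → Red x → Red y → Red z → Chain x y z qs →
      ∃ λ k → Family (λ a → a ≡ x ⊎ a ≡ y) (Closed x y z) k ×
        d * (reds x y z + 1 + length qs) ≤ d * k + blues x y z
    chain-family {x} {y} {z} xyz xR yR zR [] =
      let k , ts , bound = star xyz xR yR zR
      in k , Family-mono inj₁ id ts ,
         subst (λ m → d * m ≤ d * k + blues x y z) (sym (ℕₚ.+-identityʳ (reds x y z + 1))) bound
    chain-family {x} {y} {z} {q ∷ qs} xyz xR yR zR ((qR , i@(xyq , yzq , zxq)) ∷ chain) =
      let k₁ , T₁ , h₁ = chain-family xyq xR yR qR chain
          -- The outer cells get their stars at `y` and `x`, never at `q`: chain points are not
          -- banned from later stages, so they must not become marked vertices.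
          k₂ , T₂ , h₂ = star yzq yR zR qR
          k₃ , T₃ , h₃ = star (rot zxq) xR qR zR
          h₃′ = subst₂ (λ r b → d * (r + 1) ≤ d * k₃ + b)
                  (sym (within-rot Red? z x q)) (sym (within-rot Blue? z x q)) h₃
      in k₁ + k₂ + k₃ ,
         Family-++₃ id inj₂ inj₁
           (Closed-mono (vertex₁ xyz) (vertex₂ xyz) q∈)
           (Closed-mono (vertex₂ xyz) (vertex₃ xyz) q∈)
           (Closed-mono (vertex₁ xyz) q∈ (vertex₃ xyz))
           (separated-members y q side₂ side₃)
           (separated-members z q side₂ side₂)
           (separated-members x q side₁ side₃) T₁ T₂ T₃ ,
         -- The three cells bring a `+ 1` each, where the whole triangle had one, and `q` itself
         -- drops out of the count of interior points: a net gain of one.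
         arith d (reds x y z) (reds x y q) (reds y z q) (reds z x q) (length qs) k₁ k₂ k₃
           (blues x y q) (blues y z q) (blues z x q) (blues x y z)
           (within-cover Red? i) (within-⊎ Blue? i) h₁ h₂ h₃′
      where
      q∈ : Closed x y z q
      q∈ = In⇒Closed i
      arith : ∀ d r r₁ r₂ r₃ l k₁ k₂ k₃ b₁ b₂ b₃ b → r ≤ 1 + (r₁ + r₂ + r₃) → b₁ + b₂ + b₃ ≤ b →
        d * (r₁ + 1 + l) ≤ d * k₁ + b₁ → d * (r₂ + 1) ≤ d * k₂ + b₂ → d * (r₃ + 1) ≤ d * k₃ + b₃ →
        d * (r + 1 + suc l) ≤ d * (k₁ + k₂ + k₃) + b
      arith d r r₁ r₂ r₃ l k₁ k₂ k₃ b₁ b₂ b₃ b h₁ h₂ h₃ h₄ h₅ =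
        linear (d * (r + 1 + suc l)) (d * (k₁ + k₂ + k₃) + b) 0
          (ℕₚ.+-mono-≤ (ℕₚ.*-monoʳ-≤ d h₁) (ℕₚ.+-mono-≤ h₂ (ℕₚ.+-mono-≤ h₃ (ℕₚ.+-mono-≤ h₄ h₅))))
          (eq d r r₁ r₂ r₃ l k₁ k₂ k₃ b₁ b₂ b₃ b)
        where
        eq : ∀ d r r₁ r₂ r₃ l k₁ k₂ k₃ b₁ b₂ b₃ b →
          d * (k₁ + k₂ + k₃) + b + (d * r + (b₁ + b₂ + b₃ + (d * (r₁ + 1 + l) + (d * (r₂ + 1) + d * (r₃ + 1))))) ≡
          d * (r + 1 + suc l) + (d * (1 + (r₁ + r₂ + r₃)) + (b + (d * k₁ + b₁ + (d * k₂ + b₂ + (d * k₃ + b₃))))) + 0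
        eq = solve-∀

    -- Mirsky's theorem for the order in which `a` is below `b` when `a` is inside `x y b`. Layers
    -- of maximal elements are removed as long as they have at most `w` elements; a chain in the
    -- rest is prolonged by one, since its top element is below some element of `P`.
    chain-⊎-antichain : ∀ k {x y z} {P : Pred V 0ℓ} (P? : Decidable P) → # P? ≤ k →
      (∀ {a} → P a → Red a × In x y z a) → ∀ w →
      (∃ λ ms → Unique ms × (∀ {a} → a ∈ ms → P a) × (∀ {a b} → a ∈ ms → b ∈ ms → ¬ In x y b a) × w < length ms)
      ⊎ (∃ λ qs → Chain x y z qs × All P qs × # P? ≤ length qs * w)
    chain-⊎-antichain k {x} {y} {z} {P} P? P≤k sub w with 0 ℕₚ.<? # P?
    ... | no  P≡0 = inj₂ ([] , [] , [] , ℕₚ.≮⇒≥ P≡0)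
    chain-⊎-antichain zero P? P≤k sub w | yes 0<P = contradiction (ℕₚ.<-≤-trans 0<P P≤k) (ℕₚ.<-irrefl refl)
    chain-⊎-antichain (suc k) {x} {y} {z} {P} P? P≤k sub w | yes 0<P = result
      where
      Below : V → Set
      Below a = ∃ λ b → P b × In x y b a
      Below? : Decidable Below
      Below? a = Finₚ.any? (λ b → P? b ×-dec In? x y b a)
      Max? : Decidable (λ a → P a × ¬ Below a)
      Max? a = P? a ×-dec ¬? (Below? a)
      Rest? : Decidable (λ a → P a × Below a)
      Rest? a = P? a ×-dec Below? a
      top : ∃ λ m → P m × (∀ {a} → P a → ¬ In x y a m)
      top = #-minimal P? (In? x y) (#-nonempty P? 0<P) (λ _ (_ , yaa , _) → ≢₂₃ yaa refl) (λ _ _ _ → In-trans)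
      Rest<P : # Rest? < # P?
      Rest<P = let m , Pm , max = top
               in #-extract P? Rest? Pm proj₁ (λ (_ , b , Pb , i) → max Pb i)
      P≤Max+Rest : # P? ≤ # Max? + # Rest?
      P≤Max+Rest = #-cover Max? Rest? P? cases
        where
        cases : ∀ {a} → P a → P a × ¬ Below a ⊎ P a × Below a
        cases {a} Pa with Below? a
        ... | yes b = inj₂ (Pa , b)
        ... | no ¬b = inj₁ (Pa , ¬b)
      result : (∃ λ ms → Unique ms × (∀ {a} → a ∈ ms → P a) × (∀ {a b} → a ∈ ms → b ∈ ms → ¬ In x y b a) × w < length ms)
               ⊎ (∃ λ qs → Chain x y z qs × All P qs × # P? ≤ length qs * w)
      result with w ℕₚ.<? # Max?
      ... | yes w<Max = inj₁ (filter Max? (allFin n) , Uniqueₚ.filter⁺ Max? (Uniqueₚ.allFin⁺ n) ,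
          proj₁ ∘ get , (λ a∈ b∈ i → proj₂ (get a∈) (_ , proj₁ (get b∈) , i)) , w<Max)
        where
        get : ∀ {a} → a ∈ filter Max? (allFin n) → P a × ¬ Below a
        get a∈ = proj₂ (∈-filter⁻ Max? {xs = allFin n} a∈)
      ... | no  w≮Max with chain-⊎-antichain k Rest? (ℕₚ.≤-pred (ℕₚ.≤-trans Rest<P P≤k)) (sub ∘ proj₁) w
      ... | inj₁ (ms , ms! , all , anti , big) = inj₁ (ms , ms! , proj₁ ∘ all , anti , big)
      -- An empty chain has no top element to prolong, but it also means that the rest is empty, so
      -- any element of `P` will do.
      ... | inj₂ ([] , _ , _ , Rest≤) =
        let m , Pm , _ = top
        in inj₂ (m ∷ [] , sub Pm ∷ [] , Pm ∷ [] ,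
                 ℕₚ.≤-trans P≤Max+Rest (ℕₚ.+-mono-≤ (ℕₚ.≮⇒≥ w≮Max) Rest≤))
      ... | inj₂ (q ∷ qs , (qR , _) ∷ chain , all@((_ , b , Pb , i) ∷ _) , Rest≤) =
        inj₂ (b ∷ q ∷ qs , sub Pb ∷ (qR , i) ∷ chain , Pb ∷ All.map proj₁ all ,
              ℕₚ.≤-trans P≤Max+Rest (ℕₚ.+-mono-≤ (ℕₚ.≮⇒≥ w≮Max) Rest≤))

    Vertex : V → V → V → V → Set
    Vertex x y z a = a ≡ x ⊎ a ≡ y ⊎ a ≡ z

    -- The point `a` lies in one of the three triangles that `b` spans with a side, and vice versa.
    -- If `x y` is excluded and `z x` does not occur, both triangles stand on `y z`, and each point
    -- would lie inside the triangle of the other.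
    antichain-comparable : ∀ {x y z a b} → In x y z a → In x y z b → a ≢ b →
      ¬ In x y b a → ¬ In x y a b → In z x b a ⊎ In z x a b
    antichain-comparable a∈ b∈ a≢b a∉ b∉ with In-split b∈ a∈ a≢b | In-split a∈ b∈ (≢-sym a≢b)
    ... | inj₁ i        | _             = contradiction i a∉
    ... | inj₂ (inj₂ i) | _             = inj₁ i
    ... | _             | inj₁ j        = contradiction j b∉
    ... | _             | inj₂ (inj₂ j) = inj₂ j
    ... | inj₂ (inj₁ i) | inj₂ (inj₁ j) = contradiction refl (≢₂₃ (proj₁ (proj₂ (In-trans j i))))

    -- A long antichain for the side x y is a long chain for the side z x.
    triangle-gain : ∀ {x y z} {U : Pred V 0ℓ} (U? : Decidable U) → (∀ {a} → U a → Red a) → ∀ w →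
      ccw x y z → Red x → Red y → Red z → within U? x y z ≤ w * w →
      ∃ λ l → ∃ λ k → Family (Vertex x y z) (Closed x y z) k ×
        d * (reds x y z + 1 + l) ≤ d * k + blues x y z × within U? x y z ≤ l * w
    triangle-gain {x} {y} {z} {U} U? U⇒Red w xyz xR yR zR small
      with chain-⊎-antichain (within U? x y z) (within? U? x y z) ℕₚ.≤-refl (λ (u , i) → U⇒Red u , i) w
    ... | inj₂ (qs , chain , _ , long) =
      let k , ts , bound = chain-family xyz xR yR zR chain
      in length qs , k , Family-mono [ inj₁ , inj₂ ∘ inj₁ ]′ id ts , bound , long
    ... | inj₁ (ms , ms! , all , anti , big)
      with chain-⊎-antichain (# ms?) {z} {x} {y} ms? ℕₚ.≤-refl
             (λ a∈ → U⇒Red (proj₁ (all a∈)) , In-rot (In-rot (proj₂ (all a∈)))) 1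
      where
      ms? : Decidable (_∈ ms)
      ms? a = any? (a Finₚ.≟_) ms
    ... | inj₁ (a ∷ b ∷ _ , (a≢b ∷ _) ∷ _ , ⊆ms , anti′ , _) =
      ⊥-elim ([ anti′ (here refl) (there (here refl)) , anti′ (there (here refl)) (here refl) ]′
        (antichain-comparable (proj₂ (all a∈)) (proj₂ (all b∈)) a≢b (anti a∈ b∈) (anti b∈ a∈)))
      where
      a∈ = ⊆ms (here refl)
      b∈ = ⊆ms (there (here refl))
    ... | inj₁ (_ ∷ [] , _ , _ , _ , s≤s ())
    ... | inj₂ (qs , chain , _ , long) =
      let k , ts , bound = chain-family (rot (rot xyz)) zR xR yR chain
      in length qs , k , Family-mono [ inj₂ ∘ inj₂ , inj₁ ]′ Closed-rot ts ,
         subst₂ (λ r b → d * (r + 1 + length qs) ≤ d * k + b) (within-rot Red? z x y) (within-rot Blue? z x y) bound ,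
         -- An antichain longer than `w` is long enough because `U` has at most `w * w` points in
         -- the triangle.
         ℕₚ.≤-trans small (ℕₚ.*-monoˡ-≤ w (begin
           w               ≤⟨ ℕₚ.<⇒≤ big ⟩
           length ms       ≤⟨ list≤# (λ a → any? (a Finₚ.≟_) ms) ms! id ⟩
           _               ≤⟨ long ⟩
           length qs * 1   ≡⟨ ℕₚ.*-identityʳ (length qs) ⟩
           length qs       ∎))
      where open ℕₚ.≤-Reasoning

  -- Refining a triangle at balanced points.

  module Refinements {n d : ℕ} (O : OrderType n) (colour : Fin n → Fin (suc d)) (κ : Fin (suc d)) where
    open Triangles O colour κ public

    module _ {P : Pred V 0ℓ} (P? : Decidable P) where

      Heavy? : ∀ x y z u → Decidable (λ q → (P q × In x y z q) × 2 * u < 3 * within P? x y q)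
      Heavy? x y z u q = within? P? x y z q ×-dec (2 * u ℕₚ.<? 3 * within P? x y q)

      -- A minimal heavy point q has no heavy points in its triangle x y q, which already contains
      -- more than two thirds of all the points.
      heavy-few : ∀ x y z u → 0 < u → within P? x y z ≤ u → 3 * # (Heavy? x y z u) < u
      heavy-few x y z u 0<u ≤u with 0 ℕₚ.<? # (Heavy? x y z u)
      ... | no  none = subst (λ h → 3 * h < u) (sym (ℕₚ.n≤0⇒n≡0 (ℕₚ.≮⇒≥ none))) 0<u
      ... | yes some =
        let m , (Pm , 2u<) , min = #-minimal (Heavy? x y z u) (λ a b → In? x y b a)
              (#-nonempty (Heavy? x y z u) some) (λ _ (_ , yaa , _) → ≢₂₃ yaa refl)
              (λ _ _ _ a≺b b≺c → In-trans b≺c a≺b)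
        in arith (# (Heavy? x y z u)) (within P? x y m) u
             (ℕₚ.≤-trans (#-⊎ (Heavy? x y z u) (within? P? x y m) (within? P? x y z) proj₁
               (λ (p , i) → p , In-trans (proj₂ Pm) i) (λ h (_ , i) → min h i)) ≤u) 2u<
        where
        arith : ∀ h v u → h + v ≤ u → 2 * u < 3 * v → 3 * h < u
        arith h v u h₁ h₂ = linear (suc (3 * h)) u 0 (ℕₚ.+-mono-≤ (ℕₚ.*-monoʳ-≤ 3 h₁) h₂) (eq h v u)
          where
          eq : ∀ h v u → u + (3 * (h + v) + suc (2 * u)) ≡ suc (3 * h) + (3 * u + 3 * v) + 0
          eq = solve-∀

      -- For each of the three sides fewer than a third of the points are heavy, so some point is
      -- heavy for none of them.
      balanced-point : ∀ x y z → let u = within P? x y z in 0 < u →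
        ∃ λ q → (P q × In x y z q) ×
          3 * within P? x y q ≤ 2 * u × 3 * within P? y z q ≤ 2 * u × 3 * within P? z x q ≤ 2 * u
      balanced-point x y z 0<u with Finₚ.any? (λ q → within? P? x y z q ×-dec
        (3 * within P? x y q ℕₚ.≤? 2 * u) ×-dec (3 * within P? y z q ℕₚ.≤? 2 * u) ×-dec (3 * within P? z x q ℕₚ.≤? 2 * u))
        where u = within P? x y z
      ... | yes found = found
      ... | no  none = contradiction
        (arith (# (Heavy? x y z u)) (# (Heavy? y z x u)) (# (Heavy? z x y u)) u (heavy-few x y z u 0<u ℕₚ.≤-refl)
          (heavy-few y z x u 0<u (ℕₚ.≤-reflexive (sym (within-rot P? x y z))))
          (heavy-few z x y u 0<u (ℕₚ.≤-reflexive (within-rot P? z x y)))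
          (#-cover₃ (Heavy? x y z u) (Heavy? y z x u) (Heavy? z x y u) (within? P? x y z) cases))
        (ℕₚ.<-irrefl refl)
        where
        u = within P? x y z
        cases : ∀ {q} → P q × In x y z q →
          ((P q × In x y z q) × 2 * u < 3 * within P? x y q) ⊎
          ((P q × In y z x q) × 2 * u < 3 * within P? y z q) ⊎
          ((P q × In z x y q) × 2 * u < 3 * within P? z x q)
        cases {q} (Pq , i) with 3 * within P? x y q ℕₚ.≤? 2 * u | 3 * within P? y z q ℕₚ.≤? 2 * u
                              | 3 * within P? z x q ℕₚ.≤? 2 * u
        ... | no ¬h | _     | _     = inj₁ ((Pq , i) , ℕₚ.≰⇒> ¬h)
        ... | _     | no ¬h | _     = inj₂ (inj₁ ((Pq , In-rot i) , ℕₚ.≰⇒> ¬h))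
        ... | _     | _     | no ¬h = inj₂ (inj₂ ((Pq , In-rot (In-rot i)) , ℕₚ.≰⇒> ¬h))
        ... | yes a | yes b | yes c = contradiction (q , (Pq , i) , a , b , c) none
        arith : ∀ a b c u → 3 * a < u → 3 * b < u → 3 * c < u → u ≤ a + b + c → u < u
        arith a b c u h₁ h₂ h₃ h₄ = ⊥-elim (absurd (linear 3 0 0
          (ℕₚ.+-mono-≤ h₁ (ℕₚ.+-mono-≤ h₂ (ℕₚ.+-mono-≤ h₃ (ℕₚ.*-monoʳ-≤ 3 h₄)))) (eq a b c u)))
          where
          eq : ∀ a b c u → 0 + (suc (3 * a) + (suc (3 * b) + (suc (3 * c) + 3 * u))) ≡
            3 + (u + (u + (u + 3 * (a + b + c)))) + 0
          eq = solve-∀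
          absurd : 3 ≤ 0 → ⊥
          absurd ()

    module _ {U : Pred V 0ℓ} (U? : Decidable U) (U⇒Red : ∀ {a} → U a → Red a) (w : ℕ) where

      -- The `suc` strengthens the bound on the sample so that it survives a split, where the new
      -- point has to be paid for. An empty sample is exempt, since then `u` may be smaller than
      -- `w * w / 3`.
      Bounded : ℕ → ℕ → Set
      Bounded s u = s ≡ 0 ⊎ suc s * (w * w) ≤ 3 * u

      -- `gain` counts what the triangles, good or not, exceed the `reds x y z + 1` of a star at one
      -- corner by. It has to cover all points of `U` at `w` points per unit, except those in the
      -- sample.
      record Refinement (x y z : V) : Set where
        field
          sample         : List V
          sample-unique  : Unique sample
          sample⊆        : ∀ {a} → a ∈ sample → U a × In x y z a
          {gain size}    : ℕ
          family         : Family (λ a → Vertex x y z a ⊎ a ∈ sample) (Closed x y z) size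
          size-bound     : d * (reds x y z + 1 + gain) ≤ d * size + blues x y z
          gain-bound     : within U? x y z ≤ gain * w + length sample
          sample-bounded : Bounded (length sample) (within U? x y z)

      open Refinement

      bounded⇒≤ : ∀ {s} u → Bounded s u → s * (w * w) ≤ 3 * u
      bounded⇒≤ _ (inj₁ refl) = z≤n
      bounded⇒≤ {s} _ (inj₂ h) = ℕₚ.≤-trans (ℕₚ.*-monoˡ-≤ (w * w) (ℕₚ.n≤1+n s)) h

      -- If two of the parts have samples, the spare units in their bounds pay for the new point and
      -- for the new spare unit. If only one has, its bound is at most `2 * u` by the choice of the
      -- point, and `w * w < u` pays for one more unit. If none has, `w * w < u` suffices for both
      -- units.
      bounded-split : ∀ u u₁ u₂ u₃ {s₁ s₂ s₃} → w * w < u → suc (u₁ + u₂ + u₃) ≤ u →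
        3 * u₁ ≤ 2 * u → 3 * u₂ ≤ 2 * u → 3 * u₃ ≤ 2 * u →
        Bounded s₁ u₁ → Bounded s₂ u₂ → Bounded s₃ u₃ → suc (suc (s₁ + s₂ + s₃)) * (w * w) ≤ 3 * u
      bounded-split u u₁ u₂ u₃ {s₁} {s₂} {s₃} w²<u sum v₁ v₂ v₃ = cases
        where
        none : ∀ u W → suc W ≤ u → 2 * W ≤ 3 * u
        none u W h = linear (2 * W) (3 * u) (2 + u) (ℕₚ.*-monoʳ-≤ 2 h) (eq u W)
          where
          eq : ∀ u W → 3 * u + 2 * suc W ≡ 2 * W + 2 * u + (2 + u)
          eq = solve-∀
        one : ∀ u u₁ s W → suc W ≤ u → 3 * u₁ ≤ 2 * u → suc s * W ≤ 3 * u₁ → suc (suc s) * W ≤ 3 * u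
        one u u₁ s W h₁ h₂ h₃ = linear (suc (suc s) * W) (3 * u) 1
          (ℕₚ.+-mono-≤ h₁ (ℕₚ.+-mono-≤ h₂ h₃)) (eq u u₁ s W)
          where
          eq : ∀ u u₁ s W → 3 * u + (suc W + (3 * u₁ + suc s * W)) ≡ suc (suc s) * W + (u + (2 * u + 3 * u₁)) + 1
          eq = solve-∀
        two : ∀ u u₁ u₂ u₃ s₁ s₂ s₃ W → suc (u₁ + u₂ + u₃) ≤ u → suc s₁ * W ≤ 3 * u₁ → suc s₂ * W ≤ 3 * u₂ →
          s₃ * W ≤ 3 * u₃ → suc (suc (s₁ + s₂ + s₃)) * W ≤ 3 * u
        two u u₁ u₂ u₃ s₁ s₂ s₃ W h₁ h₂ h₃ h₄ = linear (suc (suc (s₁ + s₂ + s₃)) * W) (3 * u) 3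
          (ℕₚ.+-mono-≤ (ℕₚ.*-monoʳ-≤ 3 h₁) (ℕₚ.+-mono-≤ h₂ (ℕₚ.+-mono-≤ h₃ h₄))) (eq u u₁ u₂ u₃ s₁ s₂ s₃ W)
          where
          eq : ∀ u u₁ u₂ u₃ s₁ s₂ s₃ W →
            3 * u + (3 * suc (u₁ + u₂ + u₃) + (suc s₁ * W + (suc s₂ * W + s₃ * W))) ≡
            suc (suc (s₁ + s₂ + s₃)) * W + (3 * u + (3 * u₁ + (3 * u₂ + 3 * u₃))) + 3
          eq = solve-∀
        cases : Bounded s₁ u₁ → Bounded s₂ u₂ → Bounded s₃ u₃ → suc (suc (s₁ + s₂ + s₃)) * (w * w) ≤ 3 * u
        cases (inj₁ refl) (inj₁ refl) (inj₁ refl) = none u (w * w) w²<u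
        cases (inj₂ h)    (inj₁ refl) (inj₁ refl) = subst (λ s → suc (suc s) * (w * w) ≤ 3 * u)
          (sym (trans (ℕₚ.+-identityʳ (s₁ + 0)) (ℕₚ.+-identityʳ s₁))) (one u u₁ s₁ (w * w) w²<u v₁ h)
        cases (inj₁ refl) (inj₂ h)    (inj₁ refl) = subst (λ s → suc (suc s) * (w * w) ≤ 3 * u)
          (sym (ℕₚ.+-identityʳ s₂)) (one u u₂ s₂ (w * w) w²<u v₂ h)
        cases (inj₁ refl) (inj₁ refl) (inj₂ h)    = one u u₃ s₃ (w * w) w²<u v₃ h
        cases (inj₂ h₁)   (inj₂ h₂)   b₃          = two u u₁ u₂ u₃ s₁ s₂ s₃ (w * w) sum h₁ h₂ (bounded⇒≤ u₃ b₃)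
        cases (inj₂ h₁)   b₂          (inj₂ h₃)   = subst₂ (λ s _ → suc (suc s) * (w * w) ≤ 3 * u) (swap s₁ s₃ s₂) (swap u₁ u₃ u₂)
          (two u u₁ u₃ u₂ s₁ s₃ s₂ (w * w) (subst (λ v → suc v ≤ u) (sym (swap u₁ u₃ u₂)) sum) h₁ h₃ (bounded⇒≤ u₂ b₂))
          where
          swap : ∀ a b c → a + b + c ≡ a + c + b
          swap = solve-∀
        cases b₁          (inj₂ h₂)   (inj₂ h₃)   = subst (λ s → suc (suc s) * (w * w) ≤ 3 * u) (cycle s₂ s₃ s₁)
          (two u u₂ u₃ u₁ s₂ s₃ s₁ (w * w) (subst (λ v → suc v ≤ u) (sym (cycle u₂ u₃ u₁)) sum) h₂ h₃ (bounded⇒≤ u₁ b₁))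
          where
          cycle : ∀ a b c → a + b + c ≡ c + a + b
          cycle = solve-∀

      refine : ∀ k {x y z} → within U? x y z ≤ k → ccw x y z → Red x → Red y → Red z → Refinement x y z
      refine k {x} {y} {z} u≤k xyz xR yR zR with within U? x y z ℕₚ.≤? w * w
      ... | yes small =
        let l , k , ts , bound , long = triangle-gain U? U⇒Red w xyz xR yR zR small
        in record
          { sample = [] ; sample-unique = [] ; sample⊆ = λ () ; family = Family-mono inj₁ id ts
          ; size-bound = bound ; gain-bound = subst (within U? x y z ≤_) (sym (ℕₚ.+-identityʳ (l * w))) long
          ; sample-bounded = inj₁ refl }
      refine zero u≤k xyz xR yR zR | no large = contradiction (ℕₚ.≤-trans u≤k z≤n) large
      refine (suc k) {x} {y} {z} u≤k xyz xR yR zR | no large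
        with balanced-point U? x y z (ℕₚ.≤-<-trans z≤n (ℕₚ.≰⇒> large))
      ... | q , (Uq , i@(xyq , yzq , zxq)) , v₁ , v₂ , v₃ = record
          { sample = q ∷ sample A ++ (sample B ++ sample C)
          ; sample-unique = unique
          ; sample⊆ = members
          -- The split trades one `+ 1` for three and uses up `q`, so it gains one triangle by
          -- itself.
          ; gain = suc ((gain A) + (gain B) + (gain C))
          ; family = Family-++₃
              [ [ inj₁ ∘ inj₁ , [ inj₁ ∘ inj₂ ∘ inj₁ , inj₂ ∘ here ]′ ]′ , inj₂ ∘ there ∘ ∈-++⁺ˡ ]′
              [ [ inj₁ ∘ inj₂ ∘ inj₁ , [ inj₁ ∘ inj₂ ∘ inj₂ , inj₂ ∘ here ]′ ]′ , inj₂ ∘ there ∘ ∈-++⁺ʳ (sample A) ∘ ∈-++⁺ˡ ]′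
              [ [ inj₁ ∘ inj₂ ∘ inj₂ , [ inj₁ ∘ inj₁ , inj₂ ∘ here ]′ ]′ , inj₂ ∘ there ∘ ∈-++⁺ʳ (sample A) ∘ ∈-++⁺ʳ (sample B) ]′
              (Closed-mono (vertex₁ xyz) (vertex₂ xyz) q∈)
              (Closed-mono (vertex₂ xyz) (vertex₃ xyz) q∈)
              (Closed-mono (vertex₃ xyz) (vertex₁ xyz) q∈)
              (separated-members y q side₂ side₃)
              (separated-members z q side₂ side₃)
              (separated-members x q side₂ side₃) (family A) (family B) (family C)
          ; size-bound = arith d (reds x y z) (reds x y q) (reds y z q) (reds z x q) (gain A) (gain B) (gain C)
              (size A) (size B) (size C) (blues x y q) (blues y z q) (blues z x q) (blues x y z)
              (within-cover Red? i) (within-⊎ Blue? i) (size-bound A) (size-bound B) (size-bound C)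
          ; gain-bound = gains w (within U? x y z) (within U? x y q) (within U? y z q) (within U? z x q)
              (gain A) (gain B) (gain C) (length (sample A)) (length (sample B)) (length (sample C)) _
              (within-cover U? i) lengths (gain-bound A) (gain-bound B) (gain-bound C)
          ; sample-bounded = inj₂ (subst (λ s → suc (suc s) * (w * w) ≤ 3 * within U? x y z) (sym lengths)
              (bounded-split (within U? x y z) (within U? x y q) (within U? y z q) (within U? z x q)
                (ℕₚ.≰⇒> large) sum v₁ v₂ v₃ (sample-bounded A) (sample-bounded B) (sample-bounded C)))
          }
        where
        uR = U⇒Red Uq
        q∈ : Closed x y z q
        q∈ = In⇒Closed i
        sum : within U? x y q + within U? y z q + within U? z x q < within U? x y z
        sum = within-< U? Uq i
        rec : ∀ {u} → u ≤ within U? x y q + within U? y z q + within U? z x q → u ≤ k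
        rec h = ℕₚ.≤-pred (ℕₚ.≤-trans (s≤s h) (ℕₚ.≤-trans sum u≤k))
        A : Refinement x y q
        A = refine k (rec (ℕₚ.≤-trans (ℕₚ.m≤m+n _ (within U? y z q)) (ℕₚ.m≤m+n _ (within U? z x q)))) xyq xR yR uR
        B : Refinement y z q
        B = refine k (rec (ℕₚ.≤-trans (ℕₚ.m≤n+m _ (within U? x y q)) (ℕₚ.m≤m+n _ (within U? z x q)))) yzq yR zR uR
        C : Refinement z x q
        C = refine k (rec (ℕₚ.m≤n+m _ (within U? x y q + within U? y z q))) zxq zR xR uR
        lengths : length (sample A ++ (sample B ++ sample C)) ≡ length (sample A) + length (sample B) + length (sample C)
        lengths = trans (Listₚ.length-++ (sample A))
          (trans (cong (length (sample A) +_) (Listₚ.length-++ (sample B)))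
            (sym (ℕₚ.+-assoc (length (sample A)) (length (sample B)) (length (sample C)))))
        sample-cases : ∀ {a} → a ∈ sample A ++ (sample B ++ sample C) → U a × (In x y q a ⊎ In y z q a ⊎ In z x q a)
        sample-cases a∈ with ∈-++⁻ (sample A) a∈
        ... | inj₁ a∈A = let u , j = sample⊆ A a∈A in u , inj₁ j
        ... | inj₂ a∈BC with ∈-++⁻ (sample B) a∈BC
        ... | inj₁ a∈B = let u , j = sample⊆ B a∈B in u , inj₂ (inj₁ j)
        ... | inj₂ a∈C = let u , j = sample⊆ C a∈C in u , inj₂ (inj₂ j)
        unique : Unique (q ∷ sample A ++ (sample B ++ sample C))
        unique = All.tabulate q∉ ∷
          Uniqueₚ.++⁺ (sample-unique A) (Uniqueₚ.++⁺ (sample-unique B) (sample-unique C) B#C) A#BC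
          where
          q∉ : ∀ {a} → a ∈ sample A ++ (sample B ++ sample C) → q ≢ a
          q∉ a∈ with sample-cases a∈
          ... | _ , inj₁ (_ , yqa , _)        = ≢₂₃ yqa
          ... | _ , inj₂ (inj₁ (_ , zqa , _)) = ≢₂₃ zqa
          ... | _ , inj₂ (inj₂ (_ , xqa , _)) = ≢₂₃ xqa
          B#C : ∀ {a} → a ∈ sample B × a ∈ sample C → ⊥
          B#C (a∈B , a∈C) = let _ , _ , zqa , _ = sample⊆ B a∈B ; _ , _ , _ , qza = sample⊆ C a∈C in asym zqa qza
          A#BC : ∀ {a} → a ∈ sample A × a ∈ sample B ++ sample C → ⊥
          A#BC (a∈A , a∈BC) with sample⊆ A a∈A | ∈-++⁻ (sample B) a∈BC
          ... | _ , _ , yqa , _ | inj₁ a∈B = let _ , _ , _ , qya = sample⊆ B a∈B in asym yqa qya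
          ... | _ , _ , _ , qxa | inj₂ a∈C = let _ , _ , xqa , _ = sample⊆ C a∈C in asym xqa qxa
        members : ∀ {a} → a ∈ q ∷ sample A ++ (sample B ++ sample C) → U a × In x y z a
        members (here refl) = Uq , i
        members (there a∈) with sample-cases a∈
        ... | u , inj₁ j        = u , In-trans i j
        ... | u , inj₂ (inj₁ j) = u , In-rot (In-rot (In-trans (In-rot i) j))
        ... | u , inj₂ (inj₂ j) = u , In-rot (In-trans (In-rot (In-rot i)) j)
        gains : ∀ w u u₁ u₂ u₃ l₁ l₂ l₃ s₁ s₂ s₃ s → u ≤ 1 + (u₁ + u₂ + u₃) → s ≡ s₁ + s₂ + s₃ →
          u₁ ≤ l₁ * w + s₁ → u₂ ≤ l₂ * w + s₂ → u₃ ≤ l₃ * w + s₃ → u ≤ suc (l₁ + l₂ + l₃) * w + suc s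
        gains w u u₁ u₂ u₃ l₁ l₂ l₃ s₁ s₂ s₃ _ h refl h₁ h₂ h₃ =
          linear u (suc (l₁ + l₂ + l₃) * w + suc (s₁ + s₂ + s₃)) w
            (ℕₚ.+-mono-≤ h (ℕₚ.+-mono-≤ h₁ (ℕₚ.+-mono-≤ h₂ h₃))) (eq w u u₁ u₂ u₃ l₁ l₂ l₃ s₁ s₂ s₃)
          where
          eq : ∀ w u u₁ u₂ u₃ l₁ l₂ l₃ s₁ s₂ s₃ →
            suc (l₁ + l₂ + l₃) * w + suc (s₁ + s₂ + s₃) + (u + (u₁ + (u₂ + u₃))) ≡
            u + (1 + (u₁ + u₂ + u₃) + (l₁ * w + s₁ + (l₂ * w + s₂ + (l₃ * w + s₃)))) + w
          eq = solve-∀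
        arith : ∀ d r r₁ r₂ r₃ l₁ l₂ l₃ k₁ k₂ k₃ b₁ b₂ b₃ b → r ≤ 1 + (r₁ + r₂ + r₃) → b₁ + b₂ + b₃ ≤ b →
          d * (r₁ + 1 + l₁) ≤ d * k₁ + b₁ → d * (r₂ + 1 + l₂) ≤ d * k₂ + b₂ → d * (r₃ + 1 + l₃) ≤ d * k₃ + b₃ →
          d * (r + 1 + suc (l₁ + l₂ + l₃)) ≤ d * (k₁ + k₂ + k₃) + b
        arith d r r₁ r₂ r₃ l₁ l₂ l₃ k₁ k₂ k₃ b₁ b₂ b₃ b h₁ h₂ h₃ h₄ h₅ =
          linear (d * (r + 1 + suc (l₁ + l₂ + l₃))) (d * (k₁ + k₂ + k₃) + b) 0
            (ℕₚ.+-mono-≤ (ℕₚ.*-monoʳ-≤ d h₁) (ℕₚ.+-mono-≤ h₂ (ℕₚ.+-mono-≤ h₃ (ℕₚ.+-mono-≤ h₄ h₅))))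
            (eq d r r₁ r₂ r₃ l₁ l₂ l₃ k₁ k₂ k₃ b₁ b₂ b₃ b)
          where
          eq : ∀ d r r₁ r₂ r₃ l₁ l₂ l₃ k₁ k₂ k₃ b₁ b₂ b₃ b →
            d * (k₁ + k₂ + k₃) + b + (d * r + (b₁ + b₂ + b₃ +
              (d * (r₁ + 1 + l₁) + (d * (r₂ + 1 + l₂) + d * (r₃ + 1 + l₃))))) ≡
            d * (r + 1 + suc (l₁ + l₂ + l₃)) + (d * (1 + (r₁ + r₂ + r₃)) +
              (b + (d * k₁ + b₁ + (d * k₂ + b₂ + (d * k₃ + b₃))))) + 0
          eq = solve-∀

  -- Convex parts and hull edges.

  module Hulls {n : ℕ} (O : OrderType n) where
    open OrderTypeProperties O

    _∈?_ : ∀ (x : V) D → Dec (x ∈ D)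
    x ∈? D = any? (x Finₚ.≟_) D

    Convex : List V → Set
    Convex D = ∀ {a b c x} → a ∈ D → b ∈ D → c ∈ D → In a b c x → x ∈ D

    Extreme : List V → V → Set
    Extreme D x = ∀ {a b c} → a ∈ D → b ∈ D → c ∈ D → ¬ In a b c x

    _∖_ : List V → List V → List V
    D ∖ H = filter (λ x → ¬? (x ∈? H)) D

    ∈-∖⁺ : ∀ {D H x} → x ∈ D → x ∉ H → x ∈ D ∖ H
    ∈-∖⁺ {H = H} = ∈-filter⁺ (λ x → ¬? (x ∈? H))

    ∈-∖⁻ : ∀ D H {x} → x ∈ D ∖ H → x ∈ D × x ∉ H
    ∈-∖⁻ D H = ∈-filter⁻ (λ x → ¬? (x ∈? H)) {xs = D}

    -- A removed point is extreme, so it is missing from no triangle spanned by the remaining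
    -- points.
    ∖-convex : ∀ {D} H → Convex D → (∀ {x} → x ∈ H → Extreme D x) → Convex (D ∖ H)
    ∖-convex {D} H conv ext a b c i =
      let a∈ = proj₁ (∈-∖⁻ D H a) ; b∈ = proj₁ (∈-∖⁻ D H b) ; c∈ = proj₁ (∈-∖⁻ D H c)
      in ∈-∖⁺ (conv a∈ b∈ c∈ i) (λ x∈H → ext x∈H a∈ b∈ c∈ i)

    record Edge (P : Pred V 0ℓ) (u v : V) : Set where
      constructor edge
      field
        distinct-ends : u ≢ v
        end₁    : P u
        end₂    : P v
        support : ∀ y → P y → LeftOf u v y
    open Edge public

    LeftOf? : ∀ u v y → Dec (LeftOf u v y)
    LeftOf? u v y with y Finₚ.≟ u | y Finₚ.≟ v | ccw? u v y
    ... | yes refl | _        | _      = yes source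
    ... | no _     | yes refl | _      = yes target
    ... | no _     | no _     | yes p  = yes (left p)
    ... | no y≢u   | no y≢v   | no ¬p  = no λ { source → y≢u refl ; target → y≢v refl ; (left p) → ¬p p }

    Edge? : ∀ {P : Pred V 0ℓ} → Decidable P → ∀ u v → Dec (Edge P u v)
    Edge? P? u v = map′ (λ (a , b , c , e) → edge a b c e) (λ (edge a b c e) → a , b , c , e)
      (¬? (u Finₚ.≟ v) ×-dec P? u ×-dec P? v ×-dec Finₚ.all? (λ y → P? y →-dec LeftOf? u v y))

    extreme₁ : ∀ {D u v} → Edge (_∈ D) u v → Extreme D u
    extreme₁ e a b c i = ≢₁₃ (convex (support e _ a) (support e _ b) (support e _ c) i) refl

    extreme₂ : ∀ {D u v} → Edge (_∈ D) u v → Extreme D v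
    extreme₂ e a b c i = ≢₂₃ (convex (support e _ a) (support e _ b) (support e _ c) i) refl

    ∈-third⁺ : ∀ {a b y z : V} {D} → z ∈ a ∷ b ∷ D → z ∈ a ∷ b ∷ y ∷ D
    ∈-third⁺ (here p)          = here p
    ∈-third⁺ (there (here p))  = there (here p)
    ∈-third⁺ (there (there p)) = there (there (there p))

    ∈-third⁻ : ∀ {a b y z : V} {D} → z ∈ a ∷ b ∷ y ∷ D → z ≡ y ⊎ z ∈ a ∷ b ∷ D
    ∈-third⁻ (here p)                  = inj₂ (here p)
    ∈-third⁻ (there (here p))          = inj₂ (there (here p))
    ∈-third⁻ (there (there (here p)))  = inj₁ p
    ∈-third⁻ (there (there (there p))) = inj₂ (there (there p))

    -- If the new point y lies beyond the edge u v, then the old points are linearly ordered around y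
    -- and the first of them spans an edge with y.
    edge-exists : ∀ {a b} → a ≢ b → ∀ D → ∃ λ u → ∃ λ v → Edge (_∈ a ∷ b ∷ D) u v
    edge-exists {a} {b} a≢b [] = a , b , edge a≢b (here refl) (there (here refl)) λ
      { _ (here refl) → source ; _ (there (here refl)) → target }
    edge-exists {a} {b} a≢b (y ∷ D) with edge-exists a≢b D
    ... | u , v , e with LeftOf? u v y
    ... | yes uvy = u , v , edge (distinct-ends e) (∈-third⁺ (end₁ e)) (∈-third⁺ (end₂ e)) λ z z∈ → side z (∈-third⁻ z∈)
      where
      side : ∀ z → z ≡ y ⊎ z ∈ a ∷ b ∷ D → LeftOf u v z
      side z (inj₁ refl) = uvy
      side z (inj₂ z∈)   = support e z z∈
    ... | no  ¬uvy =
      let m , m∈ , min = minimal (ccw? y) a (b ∷ D) (λ _ x → ≢₂₃ x refl) (λ p q r → around-trans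
                           (λ { (inj₁ refl) → y≢ p ; (inj₂ (inj₁ refl)) → y≢ q ; (inj₂ (inj₂ refl)) → y≢ r })
                           (λ i → ¬uvy (left (convex (support e _ p) (support e _ q) (support e _ r) i))))
      in y , m , edge (y≢ m∈) (there (there (here refl))) (∈-third⁺ m∈) λ z z∈ → side m∈ min z (∈-third⁻ z∈)
      where
      y≢ : ∀ {z} → z ∈ a ∷ b ∷ D → y ≢ z
      y≢ z∈ refl = ¬uvy (support e _ z∈)
      side : ∀ {m} → m ∈ a ∷ b ∷ D → (∀ {z} → z ∈ a ∷ b ∷ D → ¬ ccw y z m) →
        ∀ z → z ≡ y ⊎ z ∈ a ∷ b ∷ D → LeftOf y m z
      side m∈ min z (inj₁ refl) = source
      side {m} m∈ min z (inj₂ z∈) with z Finₚ.≟ m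
      ... | yes refl = target
      ... | no  z≢m with total {y} {m} {z} (y≢ m∈) (≢-sym z≢m) (y≢ z∈)
      ... | inj₁ ymz = left ymz
      ... | inj₂ myz = contradiction (rot myz) (min z∈)

    -- Gift wrapping: `v` is extreme, so the other points are linearly ordered around it, and the
    -- first one after the direction opposite to the incoming edge is the next hull vertex.
    next-edge : ∀ {D u v x} → Edge (_∈ D) u v → x ∈ D → x ≢ u → x ≢ v → ∃ λ w → Edge (_∈ D) v w
    next-edge {D} {u} {v} {x} e x∈ x≢u x≢v with #-minimal Rest? (ccw? v) (x , x∈ , x≢u , x≢v)
                           (λ _ y → ≢₂₃ y refl) (λ p q r → around-trans
                             (λ { (inj₁ refl) → ≢-sym (proj₂ (proj₂ p)) ; (inj₂ (inj₁ refl)) → ≢-sym (proj₂ (proj₂ q))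
                                ; (inj₂ (inj₂ refl)) → ≢-sym (proj₂ (proj₂ r)) })
                             (extreme₂ e (proj₁ p) (proj₁ q) (proj₁ r)))
      where
      Rest? : Decidable (λ y → y ∈ D × y ≢ u × y ≢ v)
      Rest? y = (y ∈? D) ×-dec ¬? (y Finₚ.≟ u) ×-dec ¬? (y Finₚ.≟ v)
    ... | w , (w∈ , w≢u , w≢v) , min = w , edge (≢-sym w≢v) (end₂ e) w∈ side
      where
      uvw : ccw u v w
      uvw with support e w w∈
      ... | source = contradiction refl w≢u
      ... | target = contradiction refl w≢v
      ... | left p = p
      side : ∀ y → y ∈ D → LeftOf v w y
      side y y∈ with y Finₚ.≟ v | y Finₚ.≟ w | y Finₚ.≟ u
      ... | yes refl | _        | _        = source
      ... | _        | yes refl | _        = target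
      ... | _        | _        | yes refl = left (rot uvw)
      ... | no y≢v   | no y≢w   | no y≢u with total {v} {w} {y} (≢-sym w≢v) (≢-sym y≢w) (≢-sym y≢v)
      ... | inj₁ vwy = left vwy
      ... | inj₂ wvy = contradiction (rot wvy) (min (y∈ , y≢u , y≢v))

  -- Fans over a red hull.

  module Fans {n d : ℕ} (O : OrderType n) (colour : Fin n → Fin (suc d)) (κ : Fin (suc d)) where
    open Refinements O colour κ public
    open Hulls O public

    RedHull : List V → Set
    RedHull D = ∀ {u v} → Edge (_∈ D) u v → Red u × Red v

    module _ {D : List V} (conv : Convex D) where

      Beyond? : ∀ {P : Pred V 0ℓ} (P? : Decidable P) x v → Decidable (λ y → P y × y ∈ D × ccw x v y)
      Beyond? P? x v y = P? y ×-dec (y ∈? D) ×-dec ccw? x v y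

      beyond : ∀ {P : Pred V 0ℓ} (P? : Decidable P) → V → V → ℕ
      beyond P? x v = # (Beyond? P? x v)

      -- The fan from the extreme point `x` has reached the hull vertex `v`, and the points left of
      -- `x v` remain. The witness `y₀` shows that the hull edge leaving `v` does not return to `x`
      -- yet.
      module FanStep {x v w y₀ : V} (x-ext : Extreme D x) (x∈ : x ∈ D) (v≢x : v ≢ x)
                     (e : Edge (_∈ D) v w) (y₀∈ : y₀ ∈ D) (xvy₀ : ccw x v y₀) where

        xvw : ccw x v w
        xvw with support e x x∈
        ... | source = contradiction refl v≢x
        ... | left p = rot (rot p)
        ... | target with support e y₀ y₀∈
        ... | source = contradiction refl (≢₂₃ xvy₀)
        ... | target = contradiction refl (≢₁₃ xvy₀)
        ... | left p = contradiction p (asym xvy₀)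

        -- Otherwise the extreme point `x` would be inside the triangle `v w y`.
        sub : ∀ {y} → y ∈ D → ccw x w y → ccw x v y
        sub {y} y∈ xwy with total {x} {v} {y} (≢-sym v≢x) v≢y (≢₁₃ xwy)
          where
          v≢y : v ≢ y
          v≢y refl = asym (rot (rot xwy)) xvw
        ... | inj₁ xvy = xvy
        ... | inj₂ vxy with support e y y∈
        ... | source = contradiction refl (≢₁₃ vxy)
        ... | target = contradiction refl (≢₂₃ xwy)
        ... | left vwy = contradiction (rot xvw , rot xwy , rot (rot vxy)) (x-ext (end₁ e) (end₂ e) y∈)

        sub-side : ∀ {y} → y ∈ D → LeftOf x w y → LeftOf x v y
        sub-side _  source   = source
        sub-side _  target   = left xvw
        sub-side y∈ (left p) = left (sub y∈ p)

        triangle⊆D : ∀ {y} → Closed x v w y → y ∈ D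
        triangle⊆D y∈T with Closed-cases y∈T
        ... | inj₁ refl               = x∈
        ... | inj₂ (inj₁ refl)        = end₁ e
        ... | inj₂ (inj₂ (inj₁ refl)) = end₂ e
        ... | inj₂ (inj₂ (inj₂ i))    = conv x∈ (end₁ e) (end₂ e) i

        beyond-cover : ∀ {P : Pred V 0ℓ} (P? : Decidable P) →
          beyond P? x v ≤ 1 + (within P? x v w + beyond P? x w)
        beyond-cover {P} P? = ℕₚ.≤-trans (#-cover (equal? w) rest? (Beyond? P? x v) cases)
          (ℕₚ.+-mono-≤ (#equal≤1 w) (#-cover (within? P? x v w) (Beyond? P? x w) rest? id))
          where
          rest? : Decidable _
          rest? y = within? P? x v w y ⊎-dec Beyond? P? x w y
          cases : ∀ {y} → P y × y ∈ D × ccw x v y →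
            y ≡ w ⊎ (P y × In x v w y) ⊎ (P y × y ∈ D × ccw x w y)
          cases {y} (Py , y∈ , xvy) with support e y y∈
          ... | source = contradiction refl (≢₂₃ xvy)
          ... | target = inj₁ refl
          ... | left vwy with total {x} {w} {y} (≢₁₃ xvw) (≢₂₃ vwy) (≢₁₃ xvy)
          ... | inj₁ xwy = inj₂ (inj₂ (Py , y∈ , xwy))
          ... | inj₂ wxy = inj₂ (inj₁ (Py , xvy , vwy , wxy))

        beyond-⊎ : ∀ {P : Pred V 0ℓ} (P? : Decidable P) →
          within P? x v w + beyond P? x w ≤ beyond P? x v
        beyond-⊎ P? = #-⊎ (within? P? x v w) (Beyond? P? x w) (Beyond? P? x v)
          (λ (p , i@(xvy , _)) → p , conv x∈ (end₁ e) (end₂ e) i , xvy)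
          (λ (p , y∈ , xwy) → p , y∈ , sub y∈ xwy)
          (λ (_ , _ , _ , wxy) (_ , _ , xwy) → asym xwy wxy)

        beyond-< : ∀ {P : Pred V 0ℓ} (P? : Decidable P) → P w → beyond P? x w < beyond P? x v
        beyond-< P? Pw = #-extract (Beyond? P? x v) (Beyond? P? x w) (Pw , end₂ e , xvw)
          (λ (p , y∈ , xwy) → p , y∈ , sub y∈ xwy) (λ (_ , _ , xww) → ≢₂₃ xww refl)

      module _ (red : RedHull D) {U : Pred V 0ℓ} (U? : Decidable U) (U⇒Red : ∀ {a} → U a → Red a) (w : ℕ) where

        -- The new hull vertex of a cell is red and counted beyond `x v`. The `+ 1` in the bound for
        -- the cell pays for it, so `size-bound` has no constant; `gain-bound` charges it to `hull`.
        record Fan (x v : V) : Set where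
          field
            hull           : List V
            hull-unique    : Unique hull
            hull⊆          : ∀ {a} → a ∈ hull → Red a × (a ∈ D × ccw x v a) × Extreme D a
            sample         : List V
            sample-unique  : Unique sample
            sample⊆        : ∀ {a} → a ∈ sample → U a × a ∈ D × ccw x v a
            {gain size}    : ℕ
            family         : Family (λ a → (a ≡ x ⊎ a ≡ v ⊎ a ∈ hull) ⊎ a ∈ sample) (λ a → a ∈ D × LeftOf x v a) size
            size-bound     : d * (beyond Red? x v + gain) ≤ d * size + beyond Blue? x v
            gain-bound     : beyond U? x v ≤ gain * w + (length sample + length hull)
            sample-bounded : length sample * (w * w) ≤ 3 * beyond U? x v

        fan : ∀ k {x u v} → Extreme D x → x ∈ D → v ≢ x → Red x → Edge (_∈ D) u v →
          beyond Red? x v ≤ k → Fan x v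
        fan k {x} {u} {v} x-ext x∈ v≢x xR e ≤k with Finₚ.any? (λ y → (y ∈? D) ×-dec ccw? x v y)
        ... | no none = record
          { hull = [] ; hull-unique = [] ; hull⊆ = λ () ; sample = [] ; sample-unique = [] ; sample⊆ = λ ()
          ; gain = 0 ; size = 0 ; family = Family-[]
          ; size-bound = ℕₚ.≤-trans (ℕₚ.≤-reflexive (cong (d *_) (trans (ℕₚ.+-identityʳ (beyond Red? x v)) (empty Red?))))
                           (ℕₚ.m≤m+n (d * 0) (beyond Blue? x v))
          ; gain-bound = ℕₚ.≤-reflexive (empty U?)
          ; sample-bounded = z≤n }
          where
          empty : ∀ {P : Pred V 0ℓ} (P? : Decidable P) → beyond P? x v ≡ 0
          empty P? = ℕₚ.n≤0⇒n≡0 (#≤list (Beyond? P? x v) {[]} (λ (_ , y) → contradiction (_ , y) none))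
        ... | yes (y₀ , y₀∈ , xvy₀) = extend k ≤k (next-edge e y₀∈ y₀≢u (≢-sym (≢₂₃ xvy₀)))
          where
          -- The previous hull vertex `u` cannot be left of `x v`, since `x` is left of the edge
          -- `u v`.
          y₀≢u : y₀ ≢ u
          y₀≢u refl with support e x x∈
          ... | source = ≢₁₃ xvy₀ refl
          ... | target = v≢x refl
          ... | left p = asym p (rot xvy₀)
          extend : ∀ k → beyond Red? x v ≤ k → (∃ λ w → Edge (_∈ D) v w) → Fan x v
          extend zero ≤0 (h , e′) =
            contradiction (ℕₚ.≤-trans (FanStep.beyond-< x-ext x∈ v≢x e′ y₀∈ xvy₀ Red? (proj₂ (red e′))) ≤0) λ ()
          extend (suc k) ≤k (h , e′) = record
            { hull = h ∷ Fan.hull F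
            ; hull-unique = All.tabulate (λ a∈ → ≢₂₃ (proj₂ (proj₁ (proj₂ (Fan.hull⊆ F a∈))))) ∷ Fan.hull-unique F
            ; hull⊆ = λ { (here refl) → proj₂ (red e′) , (end₂ e′ , xvw) , extreme₂ e′
                        ; (there a∈) → let r , (a∈D , xha) , ext = Fan.hull⊆ F a∈ in r , (a∈D , sub a∈D xha) , ext }
            ; sample = Refinement.sample T ++ Fan.sample F
            ; sample-unique = Uniqueₚ.++⁺ (Refinement.sample-unique T) (Fan.sample-unique F) T#F
            ; sample⊆ = sample⊆
            ; gain = Refinement.gain T + Fan.gain F
            ; size = Refinement.size T + Fan.size F
            ; family = Family-++
                [ [ inj₁ ∘ inj₁ , [ inj₁ ∘ inj₂ ∘ inj₁ , inj₁ ∘ inj₂ ∘ inj₂ ∘ here ]′ ]′ , inj₂ ∘ ∈-++⁺ˡ ]′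
                [ [ inj₁ ∘ inj₁ , [ inj₁ ∘ inj₂ ∘ inj₂ ∘ here , inj₁ ∘ inj₂ ∘ inj₂ ∘ there ]′ ]′ , inj₂ ∘ ∈-++⁺ʳ (Refinement.sample T) ]′
                (λ c → triangle⊆D c , side₁ c)
                (λ (a∈ , s) → a∈ , sub-side a∈ s)
                (λ m₁ m₂ → separated-members x h proj₂ side₃ m₂ m₁)
                (Refinement.family T) (Fan.family F)
            ; size-bound = size-arith d (beyond Red? x v) (reds x v h) (beyond Red? x h) (Refinement.gain T) (Fan.gain F)
                (Refinement.size T) (Fan.size F) (blues x v h) (beyond Blue? x h) (beyond Blue? x v)
                (beyond-cover Red?) (beyond-⊎ Blue?) (Refinement.size-bound T) (Fan.size-bound F)
            ; gain-bound = gain-arith w (beyond U? x v) (within U? x v h) (beyond U? x h) (Refinement.gain T) (Fan.gain F)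
                (length (Refinement.sample T)) (length (Fan.sample F)) (length (Fan.hull F)) _
                (Listₚ.length-++ (Refinement.sample T)) (beyond-cover U?) (Refinement.gain-bound T) (Fan.gain-bound F)
            ; sample-bounded = sample-arith (w * w) (beyond U? x v) (within U? x v h) (beyond U? x h)
                (length (Refinement.sample T)) (length (Fan.sample F)) _
                (Listₚ.length-++ (Refinement.sample T)) (beyond-⊎ U?)
                (bounded⇒≤ U? U⇒Red w (within U? x v h) (Refinement.sample-bounded T)) (Fan.sample-bounded F)
            }
            where
            open FanStep x-ext x∈ v≢x e′ y₀∈ xvy₀
            F : Fan x h
            F = fan k x-ext x∈ (≢-sym (≢₁₃ xvw)) xR e′
                  (ℕₚ.≤-pred (ℕₚ.≤-trans (beyond-< Red? (proj₂ (red e′))) ≤k))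
            T : Refinement U? U⇒Red w x v h
            T = refine U? U⇒Red w (within U? x v h) ℕₚ.≤-refl xvw xR (proj₁ (red e′)) (proj₂ (red e′))
            T#F : ∀ {a} → a ∈ Refinement.sample T × a ∈ Fan.sample F → ⊥
            T#F (a∈T , a∈F) =
              let _ , _ , _ , hxa = Refinement.sample⊆ T a∈T ; _ , _ , xha = Fan.sample⊆ F a∈F in asym xha hxa
            sample⊆ : ∀ {a} → a ∈ Refinement.sample T ++ Fan.sample F → U a × a ∈ D × ccw x v a
            sample⊆ a∈ with ∈-++⁻ (Refinement.sample T) a∈
            ... | inj₁ a∈T = let u , i = Refinement.sample⊆ T a∈T in u , triangle⊆D (In⇒Closed i) , proj₁ i
            ... | inj₂ a∈F = let u , a∈D , xha = Fan.sample⊆ F a∈F in u , a∈D , sub a∈D xha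
            size-arith : ∀ d r r₁ r₂ l₁ l₂ k₁ k₂ b₁ b₂ b → r ≤ 1 + (r₁ + r₂) → b₁ + b₂ ≤ b →
              d * (r₁ + 1 + l₁) ≤ d * k₁ + b₁ → d * (r₂ + l₂) ≤ d * k₂ + b₂ →
              d * (r + (l₁ + l₂)) ≤ d * (k₁ + k₂) + b
            size-arith d r r₁ r₂ l₁ l₂ k₁ k₂ b₁ b₂ b h₁ h₂ h₃ h₄ =
              linear (d * (r + (l₁ + l₂))) (d * (k₁ + k₂) + b) 0
                (ℕₚ.+-mono-≤ (ℕₚ.*-monoʳ-≤ d h₁) (ℕₚ.+-mono-≤ h₂ (ℕₚ.+-mono-≤ h₃ h₄)))
                (eq d r r₁ r₂ l₁ l₂ k₁ k₂ b₁ b₂ b)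
              where
              eq : ∀ d r r₁ r₂ l₁ l₂ k₁ k₂ b₁ b₂ b →
                d * (k₁ + k₂) + b + (d * r + (b₁ + b₂ + (d * (r₁ + 1 + l₁) + d * (r₂ + l₂)))) ≡
                d * (r + (l₁ + l₂)) + (d * (1 + (r₁ + r₂)) + (b + (d * k₁ + b₁ + (d * k₂ + b₂)))) + 0
              eq = solve-∀
            gain-arith : ∀ w u u₁ u₂ l₁ l₂ s₁ s₂ h s → s ≡ s₁ + s₂ → u ≤ 1 + (u₁ + u₂) →
              u₁ ≤ l₁ * w + s₁ → u₂ ≤ l₂ * w + (s₂ + h) → u ≤ (l₁ + l₂) * w + (s + suc h)
            gain-arith w u u₁ u₂ l₁ l₂ s₁ s₂ h _ refl h₁ h₂ h₃ =
              linear u ((l₁ + l₂) * w + (s₁ + s₂ + suc h)) 0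
                (ℕₚ.+-mono-≤ h₁ (ℕₚ.+-mono-≤ h₂ h₃)) (eq w u u₁ u₂ l₁ l₂ s₁ s₂ h)
              where
              eq : ∀ w u u₁ u₂ l₁ l₂ s₁ s₂ h →
                (l₁ + l₂) * w + (s₁ + s₂ + suc h) + (u + (u₁ + u₂)) ≡
                u + (1 + (u₁ + u₂) + (l₁ * w + s₁ + (l₂ * w + (s₂ + h)))) + 0
              eq = solve-∀
            sample-arith : ∀ W u u₁ u₂ s₁ s₂ s → s ≡ s₁ + s₂ → u₁ + u₂ ≤ u →
              s₁ * W ≤ 3 * u₁ → s₂ * W ≤ 3 * u₂ → s * W ≤ 3 * u
            sample-arith W u u₁ u₂ s₁ s₂ _ refl h₁ h₂ h₃ =
              linear ((s₁ + s₂) * W) (3 * u) 0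
                (ℕₚ.+-mono-≤ (ℕₚ.*-monoʳ-≤ 3 h₁) (ℕₚ.+-mono-≤ h₂ h₃)) (eq W u u₁ u₂ s₁ s₂)
              where
              eq : ∀ W u u₁ u₂ s₁ s₂ → 3 * u + (3 * (u₁ + u₂) + (s₁ * W + s₂ * W)) ≡
                (s₁ + s₂) * W + (3 * u + (3 * u₁ + 3 * u₂)) + 0
              eq = solve-∀

  -- A single stage, and stars of pairs in a convex part.

  module Stages {n d : ℕ} (O : OrderType n) (colour : Fin n → Fin (suc d)) (κ : Fin (suc d)) where
    open Fans O colour κ public

    Of? : ∀ {P : Pred V 0ℓ} (P? : Decidable P) D → Decidable (λ x → P x × x ∈ D)
    Of? P? D x = P? x ×-dec (x ∈? D)

    amount : ∀ {P : Pred V 0ℓ} → Decidable P → List V → ℕ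
    amount P? D = # (Of? P? D)

    card : List V → ℕ
    card D = # (_∈? D)

    amount-cover : ∀ {P : Pred V 0ℓ} (P? : Decidable P) D H → amount P? D ≤ length H + amount P? (D ∖ H)
    amount-cover {P} P? D H = ℕₚ.≤-trans (#-cover (_∈? H) (Of? P? (D ∖ H)) (Of? P? D) cases)
      (ℕₚ.+-monoˡ-≤ (amount P? (D ∖ H)) (#≤list (_∈? H) id))
      where
      cases : ∀ {x} → P x × x ∈ D → x ∈ H ⊎ P x × x ∈ D ∖ H
      cases {x} (Px , x∈) with x ∈? H
      ... | yes x∈H = inj₁ x∈H
      ... | no  x∉H = inj₂ (Px , ∈-∖⁺ x∈ x∉H)

    amount-⊎ : ∀ {P : Pred V 0ℓ} (P? : Decidable P) {D H} → Unique H → (∀ {x} → x ∈ H → P x × x ∈ D) →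
      length H + amount P? (D ∖ H) ≤ amount P? D
    amount-⊎ P? {D} {H} H! H⊆ = ℕₚ.≤-trans (ℕₚ.+-monoˡ-≤ (amount P? (D ∖ H)) (list≤# (_∈? H) H! id))
      (#-⊎ (_∈? H) (Of? P? (D ∖ H)) (Of? P? D) H⊆ (λ (p , x∈) → p , proj₁ (∈-∖⁻ D H x∈))
        (λ x∈H (_ , x∈) → proj₂ (∈-∖⁻ D H x∈) x∈H))

    ≤card : ∀ D → amount Red? D + amount Blue? D ≤ card D
    ≤card D = #-⊎ (Of? Red? D) (Of? Blue? D) (_∈? D) proj₂ proj₂ (λ (r , _) (b , _) → b r)

    -- Deleting a blue end of a hull edge preserves convexity and all red points, but it can expose
    -- further blue hull points, so it is repeated.
    purify : ∀ k {D} → card D ≤ k → Convex D →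
      ∃ λ D′ → Convex D′ × D′ ⊆ D × (∀ {x} → Red x → x ∈ D → x ∈ D′) × RedHull D′
    purify k {D} D≤k conv with Finₚ.any? (λ u → Finₚ.any? (λ v → Edge? (_∈? D) u v ×-dec (Blue? u ⊎-dec Blue? v)))
    ... | no none = D , conv , id , (λ _ x∈ → x∈) , redHull
      where
      redHull : RedHull D
      redHull {u} {v} e with Red? u | Red? v
      ... | yes r | yes s = r , s
      ... | no ¬r | _     = contradiction (u , v , e , inj₁ ¬r) none
      ... | _     | no ¬s = contradiction (u , v , e , inj₂ ¬s) none
    ... | yes (u , v , e , blue) = remove k D≤k (case blue)
      where
      case : ¬ Red u ⊎ ¬ Red v → ∃ λ h → ¬ Red h × h ∈ D × Extreme D h
      case (inj₁ b) = u , b , end₁ e , extreme₁ e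
      case (inj₂ b) = v , b , end₂ e , extreme₂ e
      remove : ∀ k → card D ≤ k → (∃ λ h → ¬ Red h × h ∈ D × Extreme D h) →
        ∃ λ D′ → Convex D′ × D′ ⊆ D × (∀ {x} → Red x → x ∈ D → x ∈ D′) × RedHull D′
      remove k D≤k (h , hB , h∈ , ext) = step k D≤k
        where
        smaller : card (D ∖ (h ∷ [])) < card D
        smaller = #-extract (_∈? D) (_∈? (D ∖ (h ∷ []))) h∈ (λ x∈ → proj₁ (∈-∖⁻ D (h ∷ []) x∈))
          (λ h∈′ → proj₂ (∈-∖⁻ D (h ∷ []) h∈′) (here refl))
        step : ∀ k → card D ≤ k →
          ∃ λ D′ → Convex D′ × D′ ⊆ D × (∀ {x} → Red x → x ∈ D → x ∈ D′) × RedHull D′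
        step zero    D≤0 = contradiction (ℕₚ.≤-trans smaller D≤0) λ ()
        step (suc k) D≤k =
          let D′ , conv′ , sub , keep , red = purify k (ℕₚ.≤-pred (ℕₚ.≤-trans smaller D≤k))
                                                (∖-convex (h ∷ []) conv (λ { (here refl) → ext }))
          in D′ , conv′ , (λ x∈ → proj₁ (∈-∖⁻ D (h ∷ []) (sub x∈))) ,
             (λ r x∈ → keep r (∈-∖⁺ x∈ (λ { (here refl) → hB r }))) , red

    -- The `2` in `size-bound` stands for the ends of the hull edge at which the fan starts; they
    -- are not beyond that edge.
    record Stage (D : List V) (U : Pred V 0ℓ) (U? : Decidable U) (w : ℕ) : Set where
      field
        hull           : List V
        hull-unique    : Unique hull
        hull⊆          : ∀ {a} → a ∈ hull → Red a × a ∈ D × Extreme D a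
        sample         : List V
        sample-unique  : Unique sample
        sample⊆        : ∀ {a} → a ∈ sample → U a × a ∈ D
        {gain size}    : ℕ
        family         : Family (λ a → a ∈ hull ⊎ a ∈ sample) (λ _ → ⊤) size
        size-bound     : d * (amount Red? D + gain) ≤ d * (2 + size) + amount Blue? D
        gain-bound     : amount U? D ≤ gain * w + (length sample + length hull)
        sample-bounded : length sample * (w * w) ≤ 3 * amount U? D

    module _ {D : List V} (conv : Convex D) where

      beyond≤amount : ∀ {P : Pred V 0ℓ} (P? : Decidable P) x v → beyond conv P? x v ≤ amount P? D
      beyond≤amount P? x v = #-mono (Beyond? conv P? x v) (Of? P? D) (λ (p , y∈ , _) → p , y∈)

      stage : ∀ {U : Pred V 0ℓ} (U? : Decidable U) w → RedHull D → (∀ {a} → U a → Red a) →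
        ∀ {a b} → a ∈ D → b ∈ D → a ≢ b → Stage D U U? w
      stage {U} U? w red U⇒Red {a} {b} a∈ b∈ a≢b with edge-exists a≢b D
      ... | x , v , e = record
        { hull = x ∷ v ∷ Fan.hull F
        ; hull-unique =
            (distinct-ends e ∷ All.tabulate (λ a∈ → ≢₁₃ (proj₂ (proj₁ (proj₂ (Fan.hull⊆ F a∈))))))
            ∷ All.tabulate (λ a∈ → ≢₂₃ (proj₂ (proj₁ (proj₂ (Fan.hull⊆ F a∈)))))
            ∷ Fan.hull-unique F
        ; hull⊆ = λ { (here refl) → proj₁ (red e′) , end₁ e′ , extreme₁ e′
                    ; (there (here refl)) → proj₂ (red e′) , end₂ e′ , extreme₂ e′
                    ; (there (there h∈)) → let r , (h∈D , _) , ext = Fan.hull⊆ F h∈ in r , h∈D , ext }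
        ; sample = Fan.sample F
        ; sample-unique = Fan.sample-unique F
        ; sample⊆ = λ s∈ → let u , s∈D , _ = Fan.sample⊆ F s∈ in u , s∈D
        ; family = Family-mono
            [ inj₁ ∘ [ here , [ there ∘ here , there ∘ there ]′ ]′ , inj₂ ]′ (λ _ → tt) (Fan.family F)
        ; size-bound = size-arith d (amount Red? D) (beyond conv Red? x v) (Fan.gain F) (Fan.size F)
            (beyond conv Blue? x v) (amount Blue? D) (cover Red?) (beyond≤amount Blue? x v) (Fan.size-bound F)
        ; gain-bound = gain-arith w (amount U? D) (beyond conv U? x v) (Fan.gain F) (length (Fan.sample F))
            (length (Fan.hull F)) (cover U?) (Fan.gain-bound F)
        ; sample-bounded = ℕₚ.≤-trans (Fan.sample-bounded F) (ℕₚ.*-monoʳ-≤ 3 (beyond≤amount U? x v))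
        }
        where
        ∈D : ∀ {y} → y ∈ a ∷ b ∷ D → y ∈ D
        ∈D (here refl)         = a∈
        ∈D (there (here refl)) = b∈
        ∈D (there (there y∈))  = y∈
        e′ : Edge (_∈ D) x v
        e′ = edge (distinct-ends e) (∈D (end₁ e)) (∈D (end₂ e)) (λ y y∈ → support e y (there (there y∈)))
        F : Fan conv red U? U⇒Red w x v
        F = fan conv red U? U⇒Red w (beyond conv Red? x v) (extreme₁ e′) (end₁ e′) (≢-sym (distinct-ends e))
              (proj₁ (red e′)) e′ ℕₚ.≤-refl
        cover : ∀ {P : Pred V 0ℓ} (P? : Decidable P) → amount P? D ≤ 2 + beyond conv P? x v
        cover {P} P? = ℕₚ.≤-trans (#-cover₃ (equal? x) (equal? v) (Beyond? conv P? x v) (Of? P? D) cases)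
          (ℕₚ.+-monoˡ-≤ (beyond conv P? x v) (ℕₚ.+-mono-≤ (#equal≤1 x) (#equal≤1 v)))
          where
          cases : ∀ {y} → P y × y ∈ D → y ≡ x ⊎ y ≡ v ⊎ P y × y ∈ D × ccw x v y
          cases (Py , y∈) with support e′ _ y∈
          ... | source = inj₁ refl
          ... | target = inj₂ (inj₁ refl)
          ... | left p = inj₂ (inj₂ (Py , y∈ , p))
        size-arith : ∀ d r r′ g s b′ b → r ≤ 2 + r′ → b′ ≤ b → d * (r′ + g) ≤ d * s + b′ →
          d * (r + g) ≤ d * (2 + s) + b
        size-arith d r r′ g s b′ b h₁ h₂ h₃ = linear (d * (r + g)) (d * (2 + s) + b) 0
          (ℕₚ.+-mono-≤ (ℕₚ.*-monoʳ-≤ d h₁) (ℕₚ.+-mono-≤ h₂ h₃)) (eq d r r′ g s b′ b)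
          where
          eq : ∀ d r r′ g s b′ b → d * (2 + s) + b + (d * r + (b′ + d * (r′ + g))) ≡
            d * (r + g) + (d * (2 + r′) + (b + (d * s + b′))) + 0
          eq = solve-∀
        gain-arith : ∀ w u u′ g s h → u ≤ 2 + u′ → u′ ≤ g * w + (s + h) → u ≤ g * w + (s + (2 + h))
        gain-arith w u u′ g s h h₁ h₂ = linear u (g * w + (s + (2 + h))) 0 (ℕₚ.+-mono-≤ h₁ h₂) (eq w u u′ g s h)
          where
          eq : ∀ w u u′ g s h → g * w + (s + (2 + h)) + (u + u′) ≡ u + (2 + u′ + (g * w + (s + h))) + 0
          eq = solve-∀

      -- Only one side of `p q` is taken because the angular order around `p` is linear there, even
      -- when `p` is not extreme.
      half-star : ∀ {p q} → Red p → p ∈ D → Red q → q ∈ D →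
        ∃ λ k → Family (_≡ p) (λ _ → ⊤) k × d * beyond conv Red? p q ≤ d * k + beyond conv Blue? p q
      half-star {p} {q} pR p∈ qR q∈ =
        let k , ts , bound = wedge (beyond conv Red? p q) (Beyond? conv Red? p q) (Beyond? conv Blue? p q) ℕₚ.≤-refl
                               pR qR (λ (r , _ , pqa) → r , pqa)
                               (λ a b i r → r , inside a b i) (λ a b i ¬r → ¬r , inside a b i)
        in k , Family-mono id (λ _ → tt) ts , bound
        where
        corner : ∀ {a} → a ≡ q ⊎ Red a × a ∈ D × ccw p q a → a ∈ D × LeftOf p q a
        corner (inj₁ refl)           = q∈ , target
        corner (inj₂ (_ , a∈ , pqa)) = a∈ , left pqa
        inside : ∀ {a b x} → a ≡ q ⊎ Red a × a ∈ D × ccw p q a → b ≡ q ⊎ Red b × b ∈ D × ccw p q b →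
          In p a b x → x ∈ D × ccw p q x
        inside a b i = let a∈ , l = corner a ; b∈ , m = corner b in conv p∈ a∈ b∈ i , convex source l m i

      -- The stars of p and q on the two sides of the line p q together make up a full star.
      pair-star : ∀ {p q} → p ≢ q → Red p → p ∈ D → Red q → q ∈ D →
        ∃ λ k → Family (λ a → a ≡ p ⊎ a ≡ q) (λ _ → ⊤) k × d * amount Red? D ≤ d * (2 + k) + amount Blue? D
      pair-star {p} {q} p≢q pR p∈ qR q∈ =
        let k₁ , T₁ , h₁ = half-star pR p∈ qR q∈
            k₂ , T₂ , h₂ = half-star qR q∈ pR p∈
        in k₁ + k₂ ,
           Family-++ inj₁ inj₂ id id (λ { (member _ refl _ _ _) (member _ e _ _ _) → p≢q e }) T₁ T₂ ,
           arith d (amount Red? D) (beyond conv Red? p q) (beyond conv Red? q p) k₁ k₂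
             (beyond conv Blue? p q) (beyond conv Blue? q p) (amount Blue? D) cover disjoint h₁ h₂
        where
        cover : amount Red? D ≤ 2 + (beyond conv Red? p q + beyond conv Red? q p)
        cover = ℕₚ.≤-trans (#-cover₃ (equal? p) (equal? q) sides? (Of? Red? D) cases)
          (ℕₚ.+-mono-≤ (ℕₚ.+-mono-≤ (#equal≤1 p) (#equal≤1 q))
            (#-cover (Beyond? conv Red? p q) (Beyond? conv Red? q p) sides? id))
          where
          sides? : Decidable _
          sides? y = Beyond? conv Red? p q y ⊎-dec Beyond? conv Red? q p y
          cases : ∀ {y} → Red y × y ∈ D → y ≡ p ⊎ y ≡ q ⊎
            (Red y × y ∈ D × ccw p q y ⊎ Red y × y ∈ D × ccw q p y)
          cases {y} (r , y∈) with y Finₚ.≟ p | y Finₚ.≟ q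
          ... | yes y≡p | _       = inj₁ y≡p
          ... | _       | yes y≡q = inj₂ (inj₁ y≡q)
          ... | no y≢p  | no y≢q with total p≢q (≢-sym y≢q) (≢-sym y≢p)
          ... | inj₁ pqy = inj₂ (inj₂ (inj₁ (r , y∈ , pqy)))
          ... | inj₂ qpy = inj₂ (inj₂ (inj₂ (r , y∈ , qpy)))
        disjoint : beyond conv Blue? p q + beyond conv Blue? q p ≤ amount Blue? D
        disjoint = #-⊎ (Beyond? conv Blue? p q) (Beyond? conv Blue? q p) (Of? Blue? D)
          (λ (b , y∈ , _) → b , y∈) (λ (b , y∈ , _) → b , y∈) (λ (_ , _ , pqy) (_ , _ , qpy) → asym pqy qpy)
        arith : ∀ d r r₁ r₂ k₁ k₂ b₁ b₂ b → r ≤ 2 + (r₁ + r₂) → b₁ + b₂ ≤ b →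
          d * r₁ ≤ d * k₁ + b₁ → d * r₂ ≤ d * k₂ + b₂ → d * r ≤ d * (2 + (k₁ + k₂)) + b
        arith d r r₁ r₂ k₁ k₂ b₁ b₂ b h₁ h₂ h₃ h₄ = linear (d * r) (d * (2 + (k₁ + k₂)) + b) 0
          (ℕₚ.+-mono-≤ (ℕₚ.*-monoʳ-≤ d h₁) (ℕₚ.+-mono-≤ h₂ (ℕₚ.+-mono-≤ h₃ h₄))) (eq d r r₁ r₂ k₁ k₂ b₁ b₂ b)
          where
          eq : ∀ d r r₁ r₂ k₁ k₂ b₁ b₂ b →
            d * (2 + (k₁ + k₂)) + b + (d * r + (b₁ + b₂ + (d * r₁ + d * r₂))) ≡
            d * r + (d * (2 + (r₁ + r₂)) + (b + (d * k₁ + b₁ + (d * k₂ + b₂)))) + 0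
          eq = solve-∀

      module _ {{_ : NonZero d}} {g : ℕ} (excess : d * (2 + g) + amount Blue? D ≤ d * amount Red? D) where

        -- By `excess` each pair yields at least `g` triangles. They are marked by members of the
        -- pair, so disjoint pairs give disjoint families.
        pairs : ∀ ps → Unique ps → (∀ {p} → p ∈ ps → Red p × p ∈ D) →
          ∃ λ k → Family (_∈ ps) (λ _ → ⊤) k × g * ⌊ length ps /2⌋ ≤ k
        pairs []           _ _ = 0 , Family-[] , ℕₚ.≤-reflexive (ℕₚ.*-zeroʳ g)
        pairs (_ ∷ [])     _ _ = 0 , Family-[] , ℕₚ.≤-reflexive (ℕₚ.*-zeroʳ g)
        pairs (p ∷ q ∷ ps) ((p≢q ∷ p∉) ∷ q∉ ∷ ps!) mem =
          let pR , p∈ = mem (here refl)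
              qR , q∈ = mem (there (here refl))
              k₁ , T₁ , h₁ = pair-star p≢q pR p∈ qR q∈
              k₂ , T₂ , h₂ = pairs ps ps! (mem ∘ there ∘ there)
          in k₁ + k₂ ,
             Family-++ [ here , there ∘ here ]′ (there ∘ there) id id
               (λ { (member _ (inj₁ refl) _ _ _) (member _ p∈ _ _ _) → All.lookup p∉ p∈ refl
                  ; (member _ (inj₂ refl) _ _ _) (member _ q∈ _ _ _) → All.lookup q∉ q∈ refl }) T₁ T₂ ,
             ℕₚ.≤-trans (ℕₚ.≤-reflexive (ℕₚ.*-suc g ⌊ length ps /2⌋))
               (ℕₚ.+-mono-≤ (ℕₚ.*-cancelˡ-≤ d (arith d g k₁ (amount Red? D) (amount Blue? D) excess h₁)) h₂)
          where
          arith : ∀ d g k r b → d * (2 + g) + b ≤ d * r → d * r ≤ d * (2 + k) + b → d * g ≤ d * k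
          arith d g k r b h₁ h₂ = linear (d * g) (d * k) 0 (ℕₚ.+-mono-≤ h₁ h₂) (eq d g k r b)
            where
            eq : ∀ d g k r b → d * k + (d * (2 + g) + b + d * r) ≡ d * g + (d * r + (d * (2 + k) + b)) + 0
            eq = solve-∀

        excess-family : ∃ λ k → Family (λ _ → ⊤) (λ _ → ⊤) k × g * ⌊ amount Red? D /2⌋ ≤ k
        excess-family =
          let k , ts , bound = pairs (filter (Of? Red? D) (allFin n)) (Uniqueₚ.filter⁺ (Of? Red? D) (Uniqueₚ.allFin⁺ n))
                                 (λ p∈ → proj₂ (∈-filter⁻ (Of? Red? D) {xs = allFin n} p∈))
          in k , Family-mono (λ _ → tt) id ts , bound

  -- Balance of the colour classes and iteration of the stages.

  sumᶠ : ∀ {m} → (Fin m → ℕ) → ℕ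
  sumᶠ {zero}  f = 0
  sumᶠ {suc m} f = f Fin.zero + sumᶠ (f ∘ Fin.suc)

  sumᶠ≤ : ∀ {m} (f : Fin m → ℕ) {B} → (∀ j → f j ≤ B) → sumᶠ f ≤ m * B
  sumᶠ≤ {zero}  f ≤B = z≤n
  sumᶠ≤ {suc m} f ≤B = ℕₚ.+-mono-≤ (≤B Fin.zero) (sumᶠ≤ (f ∘ Fin.suc) (≤B ∘ Fin.suc))

  sumᶠ≤-at : ∀ {m} (f : Fin (suc m) → ℕ) {B} → (∀ j → f j ≤ B) → ∀ i → sumᶠ f ≤ f i + m * B
  sumᶠ≤-at f ≤B Fin.zero = ℕₚ.+-monoʳ-≤ (f Fin.zero) (sumᶠ≤ (f ∘ Fin.suc) (≤B ∘ Fin.suc))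
  sumᶠ≤-at {suc m} f {B} ≤B (Fin.suc i) = begin
    f Fin.zero + sumᶠ (f ∘ Fin.suc)    ≤⟨ ℕₚ.+-mono-≤ (≤B Fin.zero) (sumᶠ≤-at (f ∘ Fin.suc) (≤B ∘ Fin.suc) i) ⟩
    B + (f (Fin.suc i) + m * B)        ≡⟨ swap B (f (Fin.suc i)) (m * B) ⟩
    f (Fin.suc i) + (B + m * B)        ∎
    where
    open ℕₚ.≤-Reasoning
    swap : ∀ a b c → a + (b + c) ≡ b + (a + c)
    swap = solve-∀

  *#-cover : ∀ a {n m} {P : Pred (Fin n) 0ℓ} (P? : Decidable P) {Q : Fin m → Pred (Fin n) 0ℓ} (Q? : ∀ j → Decidable (Q j)) →
    (∀ {x} → P x → ∃ λ j → Q j x) → a * # P? ≤ sumᶠ (λ j → a * # (Q? j))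
  *#-cover a {m = zero} P? Q? cover = ℕₚ.≤-reflexive (trans (cong (a *_) (ℕₚ.n≤0⇒n≡0
    (#≤list P? {[]} (λ p → contradiction (proj₁ (cover p)) λ ())))) (ℕₚ.*-zeroʳ a))
  *#-cover a {m = suc m} {P} P? {Q} Q? cover = begin
    a * # P?                                 ≤⟨ ℕₚ.*-monoʳ-≤ a (#-cover (Q? Fin.zero) Rest? P? cases) ⟩
    a * (# (Q? Fin.zero) + # Rest?)          ≡⟨ ℕₚ.*-distribˡ-+ a (# (Q? Fin.zero)) (# Rest?) ⟩
    a * # (Q? Fin.zero) + a * # Rest?        ≤⟨ ℕₚ.+-monoʳ-≤ (a * # (Q? Fin.zero)) (*#-cover a Rest? (Q? ∘ Fin.suc) later) ⟩
    a * # (Q? Fin.zero) + sumᶠ (λ j → a * # (Q? (Fin.suc j))) ∎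
    where
    open ℕₚ.≤-Reasoning
    Rest? : Decidable (λ x → P x × ¬ Q Fin.zero x)
    Rest? x = P? x ×-dec ¬? (Q? Fin.zero x)
    cases : ∀ {x} → P x → Q Fin.zero x ⊎ P x × ¬ Q Fin.zero x
    cases {x} p with Q? Fin.zero x
    ... | yes q = inj₁ q
    ... | no ¬q = inj₂ (p , ¬q)
    later : ∀ {x} → P x × ¬ Q Fin.zero x → ∃ λ j → Q (Fin.suc j) x
    later (p , ¬q) with cover p
    ... | Fin.zero  , q = contradiction q ¬q
    ... | Fin.suc j , q = j , q

  -- t, of order n^(1/3), is the allowed imbalance of the colour classes as well as the parameter w of the
  -- refinements; 50, 76 and 100 leave room for the reds that are used up in the τ t stages.
  module Iteration {n d′ : ℕ} (O : OrderType n) (colour : Fin n → Fin (suc (suc d′))) (κ : Fin (suc (suc d′)))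
                   (τ t : ℕ) (1≤τ : 1 ≤ τ) (t≡ : t ≡ suc (suc d′) * τ * 100)
                   (t³≤n : t * (t * t) ≤ n) (n≤8t³ : n ≤ t * (t * t) * 8) where
    open Stages O colour κ

    d : ℕ
    d = suc d′

    -- As `t` is a constant multiple of `τ`, this has order `t^4`, that is `n^(4/3)`.
    size₀ : ℕ
    size₀ = τ * (τ * τ * t)

    Large : Set
    Large = ∃ λ k → Family (λ _ → ⊤) (λ _ → ⊤) k × size₀ ≤ k

    class : Fin (suc d) → List V → ℕ
    class j D = # (λ x → (colour x Finₚ.≟ j) ×-dec (x ∈? D))

    100≤t : 100 ≤ t
    100≤t = subst (100 ≤_) (sym t≡) (ℕₚ.*-monoˡ-≤ 100 (ℕₚ.*-mono-≤ (s≤s (z≤n {d})) 1≤τ))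

    instance
      t≢0 : NonZero t
      t≢0 = ℕ.>-nonZero (ℕₚ.≤-trans (s≤s z≤n) 100≤t)

    -- If `suc d * r` exceeds `card D + t` for a class of size `r`, subtracting `r` shows that
    -- `d * r` exceeds the number of other points by at least `t`. Since `t` is at least
    -- `d * (2 + τ)`, every pair of points of the class yields `τ` good triangles.
    large⊎balanced : ∀ {D} → Convex D → τ * (t * t) * 50 ≤ card D →
      Large ⊎ (∀ j → suc d * class j D ≤ card D + t)
    large⊎balanced {D} conv big with Finₚ.any? (λ j → card D + t ℕₚ.<? suc d * class j D)
    ... | no none = inj₂ λ j → ℕₚ.≮⇒≥ λ h → none (j , h)
    ... | yes (j , h) = inj₁ (k , ts , ℕₚ.≤-trans (ℕₚ.*-monoʳ-≤ τ half) bound)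
      where
      blue = Stages.amount O colour j (Stages.Blue? O colour j) D
      excess : d * (2 + τ) + blue ≤ d * class j D
      excess = ℕₚ.≤-trans (ℕₚ.+-monoˡ-≤ blue (threshold d 1≤τ t≡))
        (rearrange d (card D) t (class j D) blue h (Stages.≤card O colour j D))
        where
        threshold : ∀ d {τ t} → 1 ≤ τ → t ≡ suc d * τ * 100 → d * (2 + τ) ≤ t
        threshold d {suc τ} _ refl = linear (d * (3 + τ)) (suc d * suc τ * 100)
          (100 + τ * 100 + d * 97 + d * τ * 99) (z≤n {0}) (eq d τ)
          where
          eq : ∀ d τ → suc d * suc τ * 100 + 0 ≡ d * (3 + τ) + 0 + (100 + τ * 100 + d * 97 + d * τ * 99)
          eq = solve-∀
        rearrange : ∀ d N t r b → N + t < suc d * r → r + b ≤ N → t + b ≤ d * r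
        rearrange d N t r b h₁ h₂ = linear (t + b) (d * r) 1 (ℕₚ.+-mono-≤ h₁ h₂) (eq d N t r b)
          where
          eq : ∀ d N t r b → d * r + (suc (N + t) + (r + b)) ≡ t + b + (suc d * r + N) + 1
          eq = solve-∀
      -- One factor `t` of `τ * (t * t) * 50` is `suc d * τ * 100`, so the class has at least
      -- `5000 * τ * τ * t` points, of which only `2 * τ * τ * t` are needed.
      half : τ * τ * t ≤ ⌊ class j D /2⌋
      half = subst (_≤ ⌊ class j D /2⌋) (sym (ℕₚ.n≡⌊n+n/2⌋ (τ * τ * t)))
        (ℕₚ.⌊n/2⌋-mono (ℕₚ.*-cancelˡ-≤ (suc d) (begin
          suc d * (τ * τ * t + τ * τ * t)                ≤⟨ ℕₚ.m≤m+n (suc d * (τ * τ * t + τ * τ * t)) (suc d * (τ * τ * t) * 4998) ⟩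
          suc d * (τ * τ * t + τ * τ * t) + suc d * (τ * τ * t) * 4998 ≡⟨ eq (suc d) τ t ⟩
          τ * (suc d * τ * 100 * t) * 50                 ≡⟨ cong (λ u → τ * (u * t) * 50) (sym t≡) ⟩
          τ * (t * t) * 50                               ≤⟨ big ⟩
          card D                                         ≤⟨ ℕₚ.m≤m+n (card D) t ⟩
          card D + t                                     ≤⟨ ℕₚ.<⇒≤ h ⟩
          suc d * class j D                              ∎)))
        where
        open ℕₚ.≤-Reasoning
        eq : ∀ c τ t → c * (τ * τ * t + τ * τ * t) + c * (τ * τ * t) * 4998 ≡ τ * (c * τ * 100 * t) * 50
        eq = solve-∀
      found = Stages.excess-family O colour j conv {τ} excess
      k = proj₁ found
      ts = proj₁ (proj₂ found)
      bound = proj₂ (proj₂ found)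

    -- The upper bounds on the `d` other classes leave a lower bound for the red one.
    balanced-below : ∀ D → (∀ j → suc d * class j D ≤ card D + t) → card D ≤ suc d * amount Red? D + d * t
    balanced-below D bal = arith d (card D) (amount Red? D) t (ℕₚ.≤-trans
      (*#-cover (suc d) (_∈? D) (λ j x → (colour x Finₚ.≟ j) ×-dec (x ∈? D)) (λ {x} x∈ → colour x , refl , x∈))
      (sumᶠ≤-at (λ j → suc d * class j D) bal κ))
      where
      arith : ∀ d N r t → suc d * N ≤ suc d * r + d * (N + t) → N ≤ suc d * r + d * t
      arith d N r t h = linear N (suc d * r + d * t) 0 h (eq d N r t)
        where
        eq : ∀ d N r t → suc d * r + d * t + suc d * N ≡ N + (suc d * r + d * (N + t)) + 0
        eq = solve-∀

    split : ∀ {A B R : Pred V 0ℓ} {k} → Family (λ a → A a ⊎ B a) R k →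
      ∃ λ k₁ → ∃ λ k₂ → Family A R k₁ × Family B R k₂ × k ≡ k₁ + k₂
    split {A} {B} {R} (ts , ts! , mem , refl) =
      let us , vs , us! , vs! , us⊆ , vs⊆ , len = go ts ts! mem
      in length us , length vs , (us , us! , proj₂ ∘ us⊆ , refl) , (vs , vs! , proj₂ ∘ vs⊆ , refl) , len
      where
      go : ∀ ts → Unique ts → (∀ {t} → t ∈ ts → Member (λ a → A a ⊎ B a) R t) →
        ∃ λ us → ∃ λ vs → Unique us × Unique vs × (∀ {t} → t ∈ us → t ∈ ts × Member A R t) ×
          (∀ {t} → t ∈ vs → t ∈ ts × Member B R t) × length ts ≡ length us + length vs
      go [] _ _ = [] , [] , [] , [] , (λ ()) , (λ ()) , refl
      go (t ∷ ts) (t∉ ∷ ts!) mem with go ts ts! (mem ∘ there) | mem (here refl)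
      ... | us , vs , us! , vs! , us⊆ , vs⊆ , len | member g (inj₁ a) r₁ r₂ r₃ =
        t ∷ us , vs , All.tabulate (λ u∈ → All.lookup t∉ (proj₁ (us⊆ u∈))) ∷ us! , vs! ,
        (λ { (here refl) → here refl , member g a r₁ r₂ r₃
           ; (there u∈) → there (proj₁ (us⊆ u∈)) , proj₂ (us⊆ u∈) }) ,
        (λ v∈ → there (proj₁ (vs⊆ v∈)) , proj₂ (vs⊆ v∈)) , cong suc len
      ... | us , vs , us! , vs! , us⊆ , vs⊆ , len | member g (inj₂ b) r₁ r₂ r₃ =
        us , t ∷ vs , us! , All.tabulate (λ v∈ → All.lookup t∉ (proj₁ (vs⊆ v∈))) ∷ vs! ,
        (λ u∈ → there (proj₁ (us⊆ u∈)) , proj₂ (us⊆ u∈)) ,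
        (λ { (here refl) → here refl , member g b r₁ r₂ r₃
           ; (there v∈) → there (proj₁ (vs⊆ v∈)) , proj₂ (vs⊆ v∈) }) ,
        trans (cong suc len) (sym (ℕₚ.+-suc (length us) (length vs)))

    -- Triangles found so far are sorted by whether their first vertex was a peeled hull vertex
    -- or a sampled point: each point plays each of the two roles at most once.
    record State (R₀ j : ℕ) : Set where
      field
        region      : List V
        region-conv : Convex region
        used        : List V
        reds-left   : R₀ ≤ amount Red? region + t * j * 24
        used-few    : length used ≤ t * j * 24
        {k₁ k₂}     : ℕ
        peeled      : Family (_∉ region) (λ _ → ⊤) k₁
        sampled     : Family (_∈ used) (λ _ → ⊤) k₂
        progress    : τ * t * j ≤ k₁ + k₂

    module Step {R₀ j : ℕ} (R₀-large : τ * (t * t) * 100 ≤ R₀) (j< : j < τ * t) (S : State R₀ j)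
                {D : List V} (D-conv : Convex D) (D⊆ : ∀ {x} → x ∈ D → x ∈ State.region S)
                (D-keeps : ∀ {x} → Red x → x ∈ State.region S → x ∈ D) (D-red : RedHull D) where
      open State S

      j-bound : t * j ≤ τ * (t * t)
      j-bound = ℕₚ.≤-trans (ℕₚ.*-monoʳ-≤ t (ℕₚ.<⇒≤ j<)) (ℕₚ.≤-reflexive (eq t τ))
        where
        eq : ∀ t τ → t * (τ * t) ≡ τ * (t * t)
        eq = solve-∀

      U : Pred V 0ℓ
      U x = Red x × x ∉ used

      U? : Decidable U
      U? x = Red? x ×-dec ¬? (x ∈? used)

      R₀≤ : R₀ ≤ amount Red? D + t * j * 24
      R₀≤ = ℕₚ.≤-trans reds-left (ℕₚ.+-monoˡ-≤ (t * j * 24)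
        (#-mono (Of? Red? region) (Of? Red? D) (λ (r , x∈) → r , D-keeps r x∈)))

      -- Fewer than `τ * t` earlier stages, each allowed to cost `24 * t` red points, leave `76` of
      -- the `100`.
      many-reds : τ * (t * t) * 76 ≤ amount Red? D
      many-reds = arith τ (t * t) R₀ (amount Red? D) t j R₀-large R₀≤ j-bound
        where
        arith : ∀ τ T R r t j → τ * T * 100 ≤ R → R ≤ r + t * j * 24 → t * j ≤ τ * T → τ * T * 76 ≤ r
        arith τ T R r t j h₁ h₂ h₃ = linear (τ * T * 76) r 0
          (ℕₚ.+-mono-≤ h₁ (ℕₚ.+-mono-≤ h₂ (ℕₚ.*-monoˡ-≤ 24 h₃))) (eq τ T R r t j)
          where
          eq : ∀ τ T R r t j → r + (τ * T * 100 + (R + t * j * 24)) ≡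
            τ * T * 76 + (R + (r + t * j * 24 + τ * T * 24)) + 0
          eq = solve-∀

      reds≤card : ∀ D → amount Red? D ≤ card D
      reds≤card D = #-mono (Of? Red? D) (_∈? D) proj₂

      t≤τt² : t ≤ τ * (t * t)
      t≤τt² = ℕₚ.≤-trans (ℕₚ.m≤m*n t t) (ℕₚ.≤-trans (ℕₚ.≤-reflexive (sym (ℕₚ.*-identityˡ (t * t)))) (ℕₚ.*-monoˡ-≤ (t * t) 1≤τ))

      D-large : τ * (t * t) * 50 ≤ card D
      D-large = ℕₚ.≤-trans (ℕₚ.*-monoʳ-≤ (τ * (t * t)) (ℕₚ.m≤m+n 50 26)) (ℕₚ.≤-trans many-reds (reds≤card D))

      two-reds : ∃ λ a → ∃ λ b → a ∈ D × b ∈ D × a ≢ b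
      two-reds =
        let a , aR , a∈ = #-nonempty (Of? Red? D) (ℕₚ.≤-trans (s≤s z≤n) enough)
            Other? = λ x → Of? Red? D x ×-dec ¬? (x Finₚ.≟ a)
            b , (_ , b∈) , b≢a = #-nonempty Other? (other a)
        in a , b , a∈ , b∈ , ≢-sym b≢a
        where
        enough : 100 ≤ amount Red? D
        enough = begin
          100                 ≤⟨ 100≤t ⟩
          t                   ≤⟨ t≤τt² ⟩
          τ * (t * t)         ≤⟨ ℕₚ.m≤m*n (τ * (t * t)) 76 ⟩
          τ * (t * t) * 76    ≤⟨ many-reds ⟩
          amount Red? D           ∎
          where open ℕₚ.≤-Reasoning
        other : ∀ a → 0 < # (λ x → Of? Red? D x ×-dec ¬? (x Finₚ.≟ a))
        other a = ℕₚ.≤-pred (ℕₚ.≤-trans (ℕₚ.m≤m+n 2 98) (ℕₚ.≤-trans enough (ℕₚ.≤-trans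
          (#-cover (equal? a) _ (Of? Red? D) cases) (ℕₚ.+-monoˡ-≤ _ (#equal≤1 a)))))
          where
          cases : ∀ {x} → Red x × x ∈ D → x ≡ a ⊎ (Red x × x ∈ D) × x ≢ a
          cases {x} p with x Finₚ.≟ a
          ... | yes x≡a = inj₁ x≡a
          ... | no  x≢a = inj₂ (p , x≢a)

      -- Peeling `2 t + 1` red points lowers `suc d * r` by at least `(d + 1)(2 t + 1)`, whereas
      -- balance before and after permits a drop of at most `(d + 3) t + 1`, which is less as `d` is
      -- at least `1`. So the rest is unbalanced. Exactly `2 t + 1` points are peeled so that the
      -- rest stays large enough for `large⊎balanced`.
      hull-small : ∀ {H} → Unique H → (∀ {a} → a ∈ H → Red a × a ∈ D × Extreme D a) → length H ≡ suc (2 * t) →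
        (∀ j → suc d * class j D ≤ card D + t) → Large
      hull-small {H} H! H⊆ len bal = [ id , (λ bal′ → ⊥-elim (unbalanced bal′)) ]′
        (large⊎balanced (∖-convex H D-conv (proj₂ ∘ proj₂ ∘ H⊆)) D′-large)
        where
        D′-large : τ * (t * t) * 50 ≤ card (D ∖ H)
        D′-large = arith τ (t * t) (amount Red? D) (length H) (amount Red? (D ∖ H)) (card (D ∖ H)) t many-reds
          (amount-cover Red? D H) (ℕₚ.≤-reflexive len) (reds≤card (D ∖ H)) t≤τt² (ℕₚ.≤-trans (s≤s z≤n) 100≤t)
          where
          arith : ∀ τ T r h r′ N t → τ * T * 76 ≤ r → r ≤ h + r′ → h ≤ suc (2 * t) → r′ ≤ N → t ≤ τ * T → 1 ≤ t →
            τ * T * 50 ≤ N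
          arith τ T r h r′ N t h₁ h₂ h₃ h₄ h₅ h₆ = linear (τ * T * 50) N (τ * T * 23)
            (ℕₚ.+-mono-≤ h₁ (ℕₚ.+-mono-≤ h₂ (ℕₚ.+-mono-≤ h₃ (ℕₚ.+-mono-≤ h₄ (ℕₚ.+-mono-≤ (ℕₚ.*-monoʳ-≤ 3 h₅) h₆)))))
            (eq τ T r h r′ N t)
            where
            eq : ∀ τ T r h r′ N t → N + (τ * T * 76 + (r + (h + (r′ + (3 * t + 1))))) ≡
              τ * T * 50 + (r + (h + r′ + (suc (2 * t) + (N + (3 * (τ * T) + t))))) + τ * T * 23
            eq = solve-∀
        card-cover : card D ≤ length H + card (D ∖ H)
        card-cover = ℕₚ.≤-trans (#-cover (_∈? H) (_∈? (D ∖ H)) (_∈? D) cases)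
          (ℕₚ.+-monoˡ-≤ (card (D ∖ H)) (#≤list (_∈? H) id))
          where
          cases : ∀ {x} → x ∈ D → x ∈ H ⊎ x ∈ D ∖ H
          cases {x} x∈ with x ∈? H
          ... | yes x∈H = inj₁ x∈H
          ... | no  x∉H = inj₂ (∈-∖⁺ x∈ x∉H)
        arith : ∀ d′ N N′ r r′ t → (2 + d′) * r ≤ N + t → N′ ≤ (2 + d′) * r′ + (1 + d′) * t →
          suc (2 * t) + r′ ≤ r → N ≤ suc (2 * t) + N′ → ⊥
        arith d′ N N′ r r′ t h₁ h₂ h₃ h₄ = contradiction (linear 1 0 (d′ * t + d′)
          (ℕₚ.+-mono-≤ h₁ (ℕₚ.+-mono-≤ h₂ (ℕₚ.+-mono-≤ (ℕₚ.*-monoʳ-≤ (2 + d′) h₃) h₄))) (eq d′ N N′ r r′ t)) λ ()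
          where
          eq : ∀ d′ N N′ r r′ t →
            0 + ((2 + d′) * r + (N′ + ((2 + d′) * (suc (2 * t) + r′) + N))) ≡
            1 + (N + t + ((2 + d′) * r′ + (1 + d′) * t + ((2 + d′) * r + (suc (2 * t) + N′)))) + (d′ * t + d′)
          eq = solve-∀
        unbalanced : ¬ (∀ j → suc d * class j (D ∖ H) ≤ card (D ∖ H) + t)
        unbalanced bal′ = arith d′ (card D) (card (D ∖ H)) (amount Red? D) (amount Red? (D ∖ H)) t (bal κ) (balanced-below (D ∖ H) bal′)
          (subst (λ h → h + amount Red? (D ∖ H) ≤ amount Red? D) len (amount-⊎ Red? H! (λ a∈ → let r , a∈D , _ = H⊆ a∈ in r , a∈D)))
          (subst (λ h → card D ≤ h + card (D ∖ H)) len card-cover)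

      uncovered : amount Red? D ≤ length used + amount U? D
      uncovered = ℕₚ.≤-trans (#-cover (_∈? used) (Of? U? D) (Of? Red? D) cases)
        (ℕₚ.+-monoˡ-≤ (amount U? D) (#≤list (_∈? used) id))
        where
        cases : ∀ {x} → Red x × x ∈ D → x ∈ used ⊎ U x × x ∈ D
        cases {x} (r , x∈) with x ∈? used
        ... | yes x∈used = inj₁ x∈used
        ... | no  x∉used = inj₂ ((r , x∉used) , x∈)

      module Advance (St : Stage D U U? t) where
        open Stage St

        -- The constant `24` is `3 * 8`: a sample has at most `3 n / t^2` points, and `n` is at most
        -- `8 t^3`.
        sample-small : length sample ≤ t * 24
        sample-small = ℕₚ.*-cancelʳ-≤ (length sample) (t * 24) (t * t) {{ℕₚ.m*n≢0 t t}}
          (arith t (length sample) (amount U? D) n sample-bounded amount≤n n≤8t³)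
          where
          amount≤n : amount U? D ≤ n
          amount≤n = ℕₚ.≤-trans (#≤list (Of? U? D) {allFin n} (λ _ → ∈-allFin _)) (ℕₚ.≤-reflexive (Listₚ.length-tabulate id))
          arith : ∀ t s u n → s * (t * t) ≤ 3 * u → u ≤ n → n ≤ t * (t * t) * 8 → s * (t * t) ≤ t * 24 * (t * t)
          arith t s u n h₁ h₂ h₃ = linear (s * (t * t)) (t * 24 * (t * t)) 0
            (ℕₚ.+-mono-≤ h₁ (ℕₚ.*-monoʳ-≤ 3 (ℕₚ.+-mono-≤ h₂ h₃))) (eq t s u n)
            where
            eq : ∀ t s u n → t * 24 * (t * t) + (s * (t * t) + 3 * (u + n)) ≡
              s * (t * t) + (3 * u + 3 * (n + t * (t * t) * 8)) + 0
            eq = solve-∀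

        -- Of at least `100 τ t^2` initial red points, at most `24 τ t^2` have been lost and
        -- `24 τ t^2` banned, so `52 τ t^2` lie in `U`. Sample and hull take at most `26 t` of them,
        -- hence `gain` is at least `52 τ t - 26`. Balance bounds the blue points by `d (r + t)`, so
        -- at least `gain - t - 2` triangles are good.
        size-large : (∀ j → suc d * class j D ≤ card D + t) → length hull ≤ 2 * t → τ * t ≤ size
        size-large bal small = conclude (τ * t) t gain size (ℕₚ.*-cancelʳ-≤ (τ * t * 52) (gain + 26) t
            (gain-arith τ t R₀ (amount Red? D) (length used) (amount U? D) gain (length sample) (length hull) j
              R₀-large R₀≤ uncovered used-few j-bound gain-bound sample-small small))
            (ℕₚ.*-cancelˡ-≤ d (size-arith d (amount Red? D) gain size (amount Blue? D) (card D) t size-bound (≤card D)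
              (balanced-below D bal)))
            (ℕₚ.m≤n*m t τ {{ℕ.>-nonZero 1≤τ}}) (ℕₚ.≤-trans (ℕₚ.m≤m+n 28 72) 100≤t)
          where
          gain-arith : ∀ τ t R r v u g s h j → τ * (t * t) * 100 ≤ R → R ≤ r + t * j * 24 → r ≤ v + u → v ≤ t * j * 24 →
            t * j ≤ τ * (t * t) → u ≤ g * t + (s + h) → s ≤ t * 24 → h ≤ 2 * t → τ * t * 52 * t ≤ (g + 26) * t
          gain-arith τ t R r v u g s h j h₁ h₂ h₃ h₄ h₅ h₆ h₇ h₈ = linear (τ * t * 52 * t) ((g + 26) * t) 0
            (ℕₚ.+-mono-≤ h₁ (ℕₚ.+-mono-≤ h₂ (ℕₚ.+-mono-≤ h₃ (ℕₚ.+-mono-≤ h₄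
              (ℕₚ.+-mono-≤ (ℕₚ.*-monoˡ-≤ 48 h₅) (ℕₚ.+-mono-≤ h₆ (ℕₚ.+-mono-≤ h₇ h₈)))))))
            (eq τ t R r v u g s h j)
            where
            eq : ∀ τ t R r v u g s h j →
              (g + 26) * t + (τ * (t * t) * 100 + (R + (r + (v + (t * j * 48 + (u + (s + h))))))) ≡
              τ * t * 52 * t + (R + (r + t * j * 24 + (v + u + (t * j * 24 + (τ * (t * t) * 48 +
                (g * t + (s + h) + (t * 24 + 2 * t))))))) + 0
            eq = solve-∀
          size-arith : ∀ d r g k b N t → d * (r + g) ≤ d * (2 + k) + b → r + b ≤ N → N ≤ suc d * r + d * t →
            d * g ≤ d * (2 + k + t)
          size-arith d r g k b N t h₁ h₂ h₃ = linear (d * g) (d * (2 + k + t)) 0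
            (ℕₚ.+-mono-≤ h₁ (ℕₚ.+-mono-≤ h₂ h₃)) (eq d r g k b N t)
            where
            eq : ∀ d r g k b N t → d * (2 + k + t) + (d * (r + g) + (r + b + N)) ≡
              d * g + (d * (2 + k) + b + (N + (suc d * r + d * t))) + 0
            eq = solve-∀
          conclude : ∀ x t g k → x * 52 ≤ g + 26 → g ≤ 2 + k + t → t ≤ x → 28 ≤ t → x ≤ k
          conclude x t g k h₁ h₂ h₃ h₄ = linear x k (x * 49)
            (ℕₚ.+-mono-≤ h₁ (ℕₚ.+-mono-≤ h₂ (ℕₚ.+-mono-≤ (ℕₚ.*-monoʳ-≤ 2 h₃) h₄))) (eq x t g k)
            where
            eq : ∀ x t g k → k + (x * 52 + (g + (2 * t + 28))) ≡ x + (g + 26 + (2 + k + t + (2 * x + t))) + x * 49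
            eq = solve-∀

        -- No mark is reused within a role: marks in `peeled` lie outside the old region, which
        -- contains the hull, and samples are drawn outside `used`.
        next-state : length hull ≤ 2 * t → τ * t ≤ size → State R₀ (suc j)
        next-state small large =
          let l₁ , l₂ , F₁ , F₂ , size≡ = split family
          in record
          { region = D ∖ hull
          ; region-conv = ∖-convex hull D-conv (proj₂ ∘ proj₂ ∘ hull⊆)
          ; used = sample ++ used
          ; reds-left = reds-arith R₀ (amount Red? D) (length hull) (amount Red? (D ∖ hull)) t j R₀≤ (amount-cover Red? D hull) small
          ; used-few = ℕₚ.≤-trans (ℕₚ.≤-reflexive (Listₚ.length-++ sample))
              (ℕₚ.≤-trans (ℕₚ.+-mono-≤ sample-small used-few) (ℕₚ.≤-reflexive (used-eq t j)))
          ; peeled = Family-++ (λ a∉ a∈ → a∉ (D⊆ (proj₁ (∈-∖⁻ D hull a∈)))) (λ a∈H a∈ → proj₂ (∈-∖⁻ D hull a∈) a∈H) id id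
              (λ { (member _ a∉ _ _ _) (member _ a∈H _ _ _) → a∉ (D⊆ (proj₁ (proj₂ (hull⊆ a∈H)))) }) peeled F₁
          ; sampled = Family-++ (∈-++⁺ʳ sample) ∈-++⁺ˡ id id
              (λ { (member _ a∈ _ _ _) (member _ a∈S _ _ _) → proj₂ (proj₁ (sample⊆ a∈S)) a∈ }) sampled F₂
          ; progress = progress-arith (τ * t) j k₁ k₂ l₁ l₂ progress (subst (τ * t ≤_) size≡ large)
          }
          where
          reds-arith : ∀ R r h r′ t j → R ≤ r + t * j * 24 → r ≤ h + r′ → h ≤ 2 * t → R ≤ r′ + t * suc j * 24
          reds-arith R r h r′ t j h₁ h₂ h₃ = linear R (r′ + t * suc j * 24) (t * 22)
            (ℕₚ.+-mono-≤ h₁ (ℕₚ.+-mono-≤ h₂ h₃)) (eq R r h r′ t j)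
            where
            eq : ∀ R r h r′ t j → r′ + t * suc j * 24 + (R + (r + h)) ≡
              R + (r + t * j * 24 + (h + r′ + 2 * t)) + t * 22
            eq = solve-∀
          used-eq : ∀ t j → t * 24 + t * j * 24 ≡ t * suc j * 24
          used-eq = solve-∀
          progress-arith : ∀ x j k₁ k₂ l₁ l₂ → x * j ≤ k₁ + k₂ → x ≤ l₁ + l₂ → x * suc j ≤ k₁ + l₁ + (k₂ + l₂)
          progress-arith x j k₁ k₂ l₁ l₂ h₁ h₂ = linear (x * suc j) (k₁ + l₁ + (k₂ + l₂)) 0
            (ℕₚ.+-mono-≤ h₁ h₂) (eq x j k₁ k₂ l₁ l₂)
            where
            eq : ∀ x j k₁ k₂ l₁ l₂ → k₁ + l₁ + (k₂ + l₂) + (x * j + x) ≡ x * suc j + (k₁ + k₂ + (l₁ + l₂)) + 0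
            eq = solve-∀

        advance : Large ⊎ State R₀ (suc j)
        advance = [ inj₁ , (λ bal → cases bal (length hull ℕₚ.≤? 2 * t)) ]′ (large⊎balanced D-conv D-large)
          where
          cases : (∀ j → suc d * class j D ≤ card D + t) → Dec (length hull ≤ 2 * t) → Large ⊎ State R₀ (suc j)
          cases bal (yes small) = inj₂ (next-state small (size-large bal small))
          cases bal (no large)  = inj₁ (hull-small (Uniqueₚ.take⁺ (suc (2 * t)) hull-unique)
            (λ a∈ → hull⊆ (subst (_ ∈_) (Listₚ.take++drop≡id (suc (2 * t)) hull) (∈-++⁺ˡ a∈)))
            (trans (Listₚ.length-take (suc (2 * t)) hull) (ℕₚ.m≤n⇒m⊓n≡m (ℕₚ.≰⇒> large))) bal)

    iterate : ∀ {R₀} → τ * (t * t) * 100 ≤ R₀ → State R₀ 0 → ∀ j → j ≤ τ * t → Large ⊎ State R₀ j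
    iterate R₀-large S zero    _  = inj₂ S
    iterate {R₀} R₀-large S (suc j) j< = [ inj₁ , step ]′ (iterate R₀-large S j (ℕₚ.<⇒≤ j<))
      where
      step : State R₀ j → Large ⊎ State R₀ (suc j)
      step S =
        let D , D-conv , D⊆ , D-keeps , D-red = purify (card (State.region S)) ℕₚ.≤-refl (State.region-conv S)
            _ , _ , a∈ , b∈ , a≢b = Step.two-reds R₀-large j< S D-conv D⊆ D-keeps D-red
        in Step.Advance.advance R₀-large j< S D-conv D⊆ D-keeps D-red
             (stage D-conv (Step.U? R₀-large j< S D-conv D⊆ D-keeps D-red) t D-red proj₁ a∈ b∈ a≢b)

    -- The two families stay separate because a triangle may occur in both, once marked by a peeled
    -- vertex and once by a sampled one.
    many-triangles : n ≤ suc d * # Red? →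
      ∃ λ k₁ → ∃ λ k₂ → Family (λ _ → ⊤) (λ _ → ⊤) k₁ × Family (λ _ → ⊤) (λ _ → ⊤) k₂ × size₀ ≤ k₁ + k₂
    many-triangles n≤ = [ (λ (k , ts , h) → k , 0 , ts , Family-[] , subst (size₀ ≤_) (sym (ℕₚ.+-identityʳ k)) h) , finish ]′
      (iterate R₀-large start (τ * t) ℕₚ.≤-refl)
      where
      R₀-large : τ * (t * t) * 100 ≤ amount Red? (allFin n)
      R₀-large = ℕₚ.*-cancelˡ-≤ (suc d) (begin
        suc d * (τ * (t * t) * 100)   ≡⟨ eq (suc d) τ t ⟩
        suc d * τ * 100 * (t * t)     ≡⟨ cong (_* (t * t)) (sym t≡) ⟩
        t * (t * t)                   ≤⟨ t³≤n ⟩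
        n                             ≤⟨ n≤ ⟩
        suc d * # Red?                ≤⟨ ℕₚ.*-monoʳ-≤ (suc d) (#-mono Red? (Of? Red? (allFin n)) (λ r → r , ∈-allFin _)) ⟩
        suc d * amount Red? (allFin n)    ∎)
        where
        open ℕₚ.≤-Reasoning
        eq : ∀ c τ t → c * (τ * (t * t) * 100) ≡ c * τ * 100 * (t * t)
        eq = solve-∀
      start : State (amount Red? (allFin n)) 0
      start = record
        { region = allFin n ; region-conv = λ _ _ _ _ → ∈-allFin _ ; used = []
        ; reds-left = ℕₚ.m≤m+n (amount Red? (allFin n)) _ ; used-few = z≤n
        ; k₁ = 0 ; k₂ = 0 ; peeled = Family-[] ; sampled = Family-[]
        ; progress = ℕₚ.≤-reflexive (ℕₚ.*-zeroʳ (τ * t)) }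
      finish : State (amount Red? (allFin n)) (τ * t) →
        ∃ λ k₁ → ∃ λ k₂ → Family (λ _ → ⊤) (λ _ → ⊤) k₁ × Family (λ _ → ⊤) (λ _ → ⊤) k₂ × size₀ ≤ k₁ + k₂
      finish S = State.k₁ S , State.k₂ S , Family-mono (λ _ → tt) id (State.peeled S) ,
        Family-mono (λ _ → tt) id (State.sampled S) , ℕₚ.≤-trans (begin
          τ * (τ * τ * t)    ≡⟨ eq τ t ⟩
          τ * t * (τ * τ)    ≤⟨ ℕₚ.*-monoʳ-≤ (τ * t) (ℕₚ.*-monoʳ-≤ τ τ≤t) ⟩
          τ * t * (τ * t)    ∎) (State.progress S)
        where
        open ℕₚ.≤-Reasoning
        eq : ∀ τ t → τ * (τ * τ * t) ≡ τ * t * (τ * τ)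
        eq = solve-∀
        τ≤t : τ ≤ t
        τ≤t = subst (τ ≤_) (sym t≡) (ℕₚ.≤-trans (ℕₚ.m≤n*m τ (suc d)) (ℕₚ.m≤m*n (suc d * τ) 100))

  majority : ∀ {n d} (colour : Fin n → Fin (suc d)) → ∃ λ κ → n ≤ suc d * # (λ x → colour x Finₚ.≟ κ)
  majority {zero}      colour = Fin.zero , z≤n
  majority {n@(suc n′)} {d} colour with Finₚ.any? (λ κ → n ℕₚ.≤? suc d * # (λ x → colour x Finₚ.≟ κ))
  ... | yes found = found
  ... | no  none  = ⊥-elim (ℕₚ.<-irrefl refl (begin-strict
    suc d * n′         <⟨ ℕₚ.*-monoʳ-< (suc d) (ℕₚ.n<1+n n′) ⟩
    suc d * n          ≡⟨ cong (suc d *_) (sym all) ⟩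
    suc d * # {n} {λ _ → ⊤} (λ _ → yes tt)  ≤⟨ *#-cover (suc d) (λ _ → yes tt) (λ κ x → colour x Finₚ.≟ κ) (λ {x} _ → colour x , refl) ⟩
    sumᶠ (λ κ → suc d * # (λ x → colour x Finₚ.≟ κ)) ≤⟨ sumᶠ≤ _ (λ κ → ℕₚ.≤-pred (ℕₚ.≰⇒> (λ h → none (κ , h)))) ⟩
    suc d * n′         ∎))
    where
    open ℕₚ.≤-Reasoning
    all : # {n} {λ _ → ⊤} (λ _ → yes tt) ≡ n
    all = trans (cong length (Listₚ.filter-all (λ _ → yes tt) {allFin n} (All.tabulate (λ _ → tt)))) (Listₚ.length-tabulate id)

open Combinatorics

-- Order types of rational points.

open import Relation.Binary.Definitions using (tri<; tri≈; tri>)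
open import Data.Rational.Base as ℚ using (ℚ; 0ℚ; 1ℚ; ½; ∣_∣)
import Data.Rational.Properties as ℚₚ
import Data.Nat.Solver as ℕSolver
import Data.Rational.Solver as ℚSolver
open import Data.Integer.Base using (+_)
open import Function.Bundles using (mk⇔; Equivalence)
open import Relation.Nullary.Decidable using (¬¬-excluded-middle)
open import Defs

-- Twice the signed area of a triangle, in the form to which the terms of det below reduce.
Δ : ℚ → ℚ → ℚ → ℚ → ℚ → ℚ → ℚ
Δ x₁ y₁ x₂ y₂ x₃ y₃ =
  (x₃ ℚ.* (y₁ ℚ.+ ℚ.- 1ℚ ℚ.* y₂) ℚ.+ y₃ ℚ.* (x₂ ℚ.+ ℚ.- 1ℚ ℚ.* x₁)) ℚ.+ (x₁ ℚ.* y₂ ℚ.+ ℚ.- 1ℚ ℚ.* (x₂ ℚ.* y₁))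

module ΔIdentities where
  open ℚSolver.+-*-Solver

  Δ′ : ∀ {m} → (x₁ y₁ x₂ y₂ x₃ y₃ : Polynomial m) → Polynomial m
  Δ′ x₁ y₁ x₂ y₂ x₃ y₃ =
    (x₃ :* (y₁ :+ con (ℚ.- 1ℚ) :* y₂) :+ y₃ :* (x₂ :+ con (ℚ.- 1ℚ) :* x₁)) :+ (x₁ :* y₂ :+ con (ℚ.- 1ℚ) :* (x₂ :* y₁))

  Δ-rot : ∀ a a′ b b′ c c′ → Δ a a′ b b′ c c′ ≡ Δ b b′ c c′ a a′
  Δ-rot = solve 6 (λ a a′ b b′ c c′ → Δ′ a a′ b b′ c c′ := Δ′ b b′ c c′ a a′) refl

  Δ-swap : ∀ a a′ b b′ c c′ → Δ b b′ a a′ c c′ ≡ ℚ.- Δ a a′ b b′ c c′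
  Δ-swap = solve 6 (λ a a′ b b′ c c′ → Δ′ b b′ a a′ c c′ := :- Δ′ a a′ b b′ c c′) refl

  Δ-degenerate : ∀ a a′ b b′ → Δ a a′ a a′ b b′ ≡ 0ℚ
  Δ-degenerate = solve 4 (λ a a′ b b′ → Δ′ a a′ a a′ b b′ := con 0ℚ) refl

  Δ-sum : ∀ a a′ b b′ c c′ z z′ →
    Δ a a′ b b′ c c′ ≡ (Δ a a′ b b′ z z′ ℚ.+ Δ b b′ c c′ z z′) ℚ.+ Δ c c′ a a′ z z′
  Δ-sum = solve 8 (λ a a′ b b′ c c′ z z′ →
    Δ′ a a′ b b′ c c′ := (Δ′ a a′ b b′ z z′ :+ Δ′ b b′ c c′ z z′) :+ Δ′ c c′ a a′ z z′) refl

  -- Cramer's rule without denominators: the areas over the sides are the barycentric coordinates of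
  -- `z` in `a b c`, and the signed area over `u v` is affine in its last point. This yields the
  -- convexity axiom.
  Δ-cramer : ∀ u u′ v v′ a a′ b b′ c c′ z z′ →
    Δ u u′ v v′ z z′ ℚ.* Δ a a′ b b′ c c′ ≡
    (Δ u u′ v v′ a a′ ℚ.* Δ b b′ c c′ z z′ ℚ.+ Δ u u′ v v′ b b′ ℚ.* Δ c c′ a a′ z z′) ℚ.+
      Δ u u′ v v′ c c′ ℚ.* Δ a a′ b b′ z z′
  Δ-cramer = solve 12 (λ u u′ v v′ a a′ b b′ c c′ z z′ →
    Δ′ u u′ v v′ z z′ :* Δ′ a a′ b b′ c c′ :=
    (Δ′ u u′ v v′ a a′ :* Δ′ b b′ c c′ z z′ :+ Δ′ u u′ v v′ b b′ :* Δ′ c c′ a a′ z z′) :+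
      Δ′ u u′ v v′ c c′ :* Δ′ a a′ b b′ z z′) refl

  -- The constant term of the affine form carries the factor `α + β + γ`, which turns the statement
  -- about convex combinations into a polynomial identity.
  Δ-interior : ∀ α β γ a a′ b b′ c c′ →
    (((α ℚ.* a ℚ.+ β ℚ.* b) ℚ.+ γ ℚ.* c) ℚ.* (a′ ℚ.+ ℚ.- 1ℚ ℚ.* b′) ℚ.+
     ((α ℚ.* a′ ℚ.+ β ℚ.* b′) ℚ.+ γ ℚ.* c′) ℚ.* (b ℚ.+ ℚ.- 1ℚ ℚ.* a)) ℚ.+
     ((α ℚ.+ β) ℚ.+ γ) ℚ.* (a ℚ.* b′ ℚ.+ ℚ.- 1ℚ ℚ.* (b ℚ.* a′))
    ≡ γ ℚ.* Δ a a′ b b′ c c′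
  Δ-interior = solve 9 (λ α β γ a a′ b b′ c c′ →
    (((α :* a :+ β :* b) :+ γ :* c) :* (a′ :+ con (ℚ.- 1ℚ) :* b′) :+
     ((α :* a′ :+ β :* b′) :+ γ :* c′) :* (b :+ con (ℚ.- 1ℚ) :* a)) :+
     ((α :+ β) :+ γ) :* (a :* b′ :+ con (ℚ.- 1ℚ) :* (b :* a′))
    := γ :* Δ′ a a′ b b′ c c′) refl

open ΔIdentities

0<*⁻ : ∀ p q → 0ℚ ℚ.< q → 0ℚ ℚ.< p ℚ.* q → 0ℚ ℚ.< p
0<*⁻ p q 0<q 0<pq with 0ℚ ℚₚ.<? p
... | yes 0<p = 0<p
... | no  0≮p = contradiction (ℚₚ.<-≤-trans 0<pq (subst (p ℚ.* q ℚ.≤_) (ℚₚ.*-zeroˡ q)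
  (ℚₚ.*-monoʳ-≤-nonNeg q {{ℚ.nonNegative (ℚₚ.<⇒≤ 0<q)}} (ℚₚ.≮⇒≥ 0≮p)))) (ℚₚ.<-irrefl refl)

0<* : ∀ {p q} → 0ℚ ℚ.< p → 0ℚ ℚ.< q → 0ℚ ℚ.< p ℚ.* q
0<* {p} {q} 0<p 0<q = ℚₚ.positive⁻¹ (p ℚ.* q) {{ℚₚ.pos*pos⇒pos p {{ℚ.positive 0<p}} q {{ℚ.positive 0<q}}}}

0≤* : ∀ {p q} → 0ℚ ℚ.≤ p → 0ℚ ℚ.≤ q → 0ℚ ℚ.≤ p ℚ.* q
0≤* {p} {q} 0≤p 0≤q = subst (ℚ._≤ p ℚ.* q) (ℚₚ.*-zeroˡ q) (ℚₚ.*-monoʳ-≤-nonNeg q {{ℚ.nonNegative 0≤q}} 0≤p)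

module _ {n : ℕ} (x y : Fin n → ℚ) where

  δ : Fin n → Fin n → Fin n → ℚ
  δ i j k = Δ (x i) (y i) (x j) (y j) (x k) (y k)

  δ-rot : ∀ i j k → δ i j k ≡ δ j k i
  δ-rot i j k = Δ-rot (x i) (y i) (x j) (y j) (x k) (y k)

  δ-degenerate : ∀ i j → δ i i j ≡ 0ℚ
  δ-degenerate i j = Δ-degenerate (x i) (y i) (x j) (y j)

  planeOrderType : (∀ {i j k} → i ≢ j → j ≢ k → i ≢ k → δ i j k ≢ 0ℚ) → OrderType n
  planeOrderType generic = record
    { ccw = λ i j k → 0ℚ ℚ.< δ i j k
    ; ccw? = λ i j k → 0ℚ ℚₚ.<? δ i j k
    ; rot = λ {i} {j} {k} → subst (0ℚ ℚ.<_) (δ-rot i j k)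
    ; asym = asym
    ; total = total
    ; convex = convex
    }
    where
    Ccw : Fin n → Fin n → Fin n → Set
    Ccw i j k = 0ℚ ℚ.< δ i j k
    swap : ∀ i j k → δ j i k ≡ ℚ.- δ i j k
    swap i j k = Δ-swap (x i) (y i) (x j) (y j) (x k) (y k)
    asym : ∀ {i j k} → Ccw i j k → ¬ Ccw j i k
    asym {i} {j} {k} p q = ℚₚ.<-asym (ℚₚ.neg-antimono-< p) (subst (0ℚ ℚ.<_) (swap i j k) q)
    ≢₁₂ : ∀ {i j k} → Ccw i j k → i ≢ j
    ≢₁₂ {i} {_} {k} p refl = ℚₚ.<-irrefl (sym (δ-degenerate i k)) p
    total : ∀ {i j k} → i ≢ j → j ≢ k → i ≢ k → Ccw i j k ⊎ Ccw j i k
    total {i} {j} {k} i≢j j≢k i≢k with ℚₚ.<-cmp 0ℚ (δ i j k)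
    ... | tri< p _ _ = inj₁ p
    ... | tri≈ _ e _ = contradiction (sym e) (generic i≢j j≢k i≢k)
    ... | tri> _ _ p = inj₂ (subst (0ℚ ℚ.<_) (sym (swap i j k)) (ℚₚ.neg-antimono-< p))
    Side⇒0≤ : ∀ {u v a} → Side Ccw u v a → 0ℚ ℚ.≤ δ u v a
    Side⇒0≤ {u} {v} source   = ℚₚ.≤-reflexive (sym (trans (δ-rot u v u) (trans (δ-rot v u u) (δ-degenerate u v))))
    Side⇒0≤ {u} {v} target   = ℚₚ.≤-reflexive (sym (trans (δ-rot u v v) (δ-degenerate v u)))
    Side⇒0≤         (left p) = ℚₚ.<⇒≤ p
    strict : ∀ {u v a b c} → a ≢ b → b ≢ c → c ≢ a → Side Ccw u v a → Side Ccw u v b → Side Ccw u v c →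
      Ccw u v a ⊎ Ccw u v b ⊎ Ccw u v c
    strict a≢b b≢c c≢a (left p) _        _        = inj₁ p
    strict a≢b b≢c c≢a _        (left p) _        = inj₂ (inj₁ p)
    strict a≢b b≢c c≢a _        _        (left p) = inj₂ (inj₂ p)
    strict a≢b b≢c c≢a source   source   _        = contradiction refl a≢b
    strict a≢b b≢c c≢a target   target   _        = contradiction refl a≢b
    strict a≢b b≢c c≢a source   target   source   = contradiction refl c≢a
    strict a≢b b≢c c≢a target   source   target   = contradiction refl c≢a
    strict a≢b b≢c c≢a source   target   target   = contradiction refl b≢c
    strict a≢b b≢c c≢a target   source   source   = contradiction refl b≢c
    convex : ∀ {u v a b c z} → Side Ccw u v a → Side Ccw u v b → Side Ccw u v c →
      Ccw a b z × Ccw b c z × Ccw c a z → Ccw u v z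
    convex {u} {v} {a} {b} {c} {z} A B C (abz , bcz , caz) =
      0<*⁻ (δ u v z) (δ a b c)
        (subst (0ℚ ℚ.<_) (sym (Δ-sum (x a) (y a) (x b) (y b) (x c) (y c) (x z) (y z)))
          (ℚₚ.+-mono-< (ℚₚ.+-mono-< abz bcz) caz))
        (subst (0ℚ ℚ.<_)
          (sym (Δ-cramer (x u) (y u) (x v) (y v) (x a) (y a) (x b) (y b) (x c) (y c) (x z) (y z)))
          (positive (strict (≢₁₂ abz) (≢₁₂ bcz) (≢₁₂ caz) A B C)))
      where
      A′ : 0ℚ ℚ.≤ δ u v a ℚ.* δ b c z
      A′ = 0≤* (Side⇒0≤ A) (ℚₚ.<⇒≤ bcz)
      B′ : 0ℚ ℚ.≤ δ u v b ℚ.* δ c a z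
      B′ = 0≤* (Side⇒0≤ B) (ℚₚ.<⇒≤ caz)
      C′ : 0ℚ ℚ.≤ δ u v c ℚ.* δ a b z
      C′ = 0≤* (Side⇒0≤ C) (ℚₚ.<⇒≤ abz)
      positive : Ccw u v a ⊎ Ccw u v b ⊎ Ccw u v c →
        0ℚ ℚ.< (δ u v a ℚ.* δ b c z ℚ.+ δ u v b ℚ.* δ c a z) ℚ.+ δ u v c ℚ.* δ a b z
      positive (inj₁ p)        = ℚₚ.+-mono-<-≤ (ℚₚ.+-mono-<-≤ (0<* p bcz) B′) C′
      positive (inj₂ (inj₁ p)) = ℚₚ.+-mono-<-≤ (ℚₚ.+-mono-≤-< A′ (0<* p caz)) C′
      positive (inj₂ (inj₂ p)) = ℚₚ.+-mono-≤-< (ℚₚ.+-mono-≤ A′ B′) (0<* p abz)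

-- Finite quantifiers, limits and signs of real numbers.

¬¬-Π : ∀ {n} {P : Fin n → Set} → (∀ i → ¬ ¬ P i) → ¬ ¬ (∀ i → P i)
¬¬-Π {zero}  h k = k λ ()
¬¬-Π {suc n} h k = h Fin.zero λ p → ¬¬-Π (h ∘ Fin.suc) λ q →
  k λ { Fin.zero → p ; (Fin.suc i) → q i }

Eventually-Π : ∀ {n} {P : Fin n → ℕ → Set} → (∀ i → Eventually (P i)) → Eventually (λ N → ∀ i → P i N)
Eventually-Π {zero}  h = 0 , λ _ _ ()
Eventually-Π {suc n} h =
  let M , hM = h Fin.zero
      N , hN = Eventually-Π (h ∘ Fin.suc)
  in M ℕ.⊔ N , λ { k k≥ Fin.zero → hM k (ℕₚ.m⊔n≤o⇒m≤o M N k≥)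
                 ; k k≥ (Fin.suc i) → hN k (ℕₚ.m⊔n≤o⇒n≤o M N k≥) i }

Eventually-map₂ : ∀ {P Q R : ℕ → Set} → (∀ {k} → P k → Q k → R k) → Eventually P → Eventually Q → Eventually R
Eventually-map₂ f (M , p) (N , q) = M ℕ.⊔ N , λ k k≥ →
  f (p k (ℕₚ.m⊔n≤o⇒m≤o M N k≥)) (q k (ℕₚ.m⊔n≤o⇒n≤o M N k≥))

Eventually-map : ∀ {P Q : ℕ → Set} → (∀ {k} → P k → Q k) → Eventually P → Eventually Q
Eventually-map f (M , p) = M , λ k k≥ → f (p k k≥)

p≤∣p∣ : ∀ p → p ℚ.≤ ∣ p ∣
p≤∣p∣ p with ℚₚ.≤-total 0ℚ p
... | inj₁ 0≤p = ℚₚ.≤-reflexive (sym (ℚₚ.0≤p⇒∣p∣≡p 0≤p))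
... | inj₂ p≤0 = ℚₚ.≤-trans p≤0 (ℚₚ.0≤∣p∣ p)

halve-apart : ∀ {h a b} → h ℚ.+ h ℚ.≤ a → a ℚ.- b ℚ.< h → h ℚ.≤ b
halve-apart {h} {a} {b} p q = ℚₚ.<⇒≤ (subst₂ ℚ._<_ (cancel₁ a b h) (cancel₂ a b h)
  (ℚₚ.+-monoˡ-< ((b ℚ.- a) ℚ.- h) (ℚₚ.+-mono-≤-< p q)))
  where
  open ℚSolver.+-*-Solver
  cancel₁ : ∀ a b h → ((h ℚ.+ h) ℚ.+ (a ℚ.- b)) ℚ.+ ((b ℚ.- a) ℚ.- h) ≡ h
  cancel₁ = solve 3 (λ a b h → ((h :+ h) :+ (a :- b)) :+ ((b :- a) :- h) := h) refl
  cancel₂ : ∀ a b h → (a ℚ.+ h) ℚ.+ ((b ℚ.- a) ℚ.- h) ≡ b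
  cancel₂ = solve 3 (λ a b h → (a :+ h) :+ ((b :- a) :- h) := b) refl

half+half : ∀ ε → ½ ℚ.* ε ℚ.+ ½ ℚ.* ε ≡ ε
half+half ε = trans (sym (ℚₚ.*-distribʳ-+ ε ½ ½)) (ℚₚ.*-identityˡ ε)

0<½* : ∀ {ε} → 0ℚ ℚ.< ε → 0ℚ ℚ.< ½ ℚ.* ε
0<½* = 0<* (ℚₚ.positive⁻¹ ½)

∣-∣-≡0 : ∀ {p q} → p ≡ q → ∣ p ℚ.- q ∣ ≡ 0ℚ
∣-∣-≡0 {p} refl = cong ∣_∣ (ℚₚ.+-inverseʳ p)

-- _≃_ itself unfolds, so that its arguments could not be inferred.
record _≋_ (x y : ℝ) : Set where
  constructor wrap
  field
    unwrap : x ≃ y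
open _≋_

infix 4 _≋_

≋-pointwise : ∀ {x y} → (∀ k → seq x k ≡ seq y k) → x ≋ y
≋-pointwise eq .unwrap ε 0<ε = 0 , λ k _ → subst (ℚ._< ε) (sym (∣-∣-≡0 (eq k))) 0<ε

≋-sym : ∀ {x y} → x ≋ y → y ≋ x
≋-sym {x} {y} (wrap h) .unwrap ε 0<ε = Eventually-map (λ {k} → subst (ℚ._< ε) (flip (seq x k) (seq y k))) (h ε 0<ε)
  where
  flip : ∀ p q → ∣ p ℚ.- q ∣ ≡ ∣ q ℚ.- p ∣
  flip p q = trans (sym (ℚₚ.∣-p∣≡∣p∣ (p ℚ.- q))) (cong ∣_∣ (lemma p q))
    where
    open ℚSolver.+-*-Solver
    lemma : ∀ p q → ℚ.- (p ℚ.- q) ≡ q ℚ.- p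
    lemma = solve 2 (λ p q → :- (p :- q) := q :- p) refl

≋-trans : ∀ {x y z} → x ≋ y → y ≋ z → x ≋ z
≋-trans {x} {y} {z} (wrap h₁) (wrap h₂) .unwrap ε 0<ε = Eventually-map₂
  (λ {k} p q → subst (∣ seq x k ℚ.- seq z k ∣ ℚ.<_) (half+half ε)
    (ℚₚ.≤-<-trans (triangle (seq x k) (seq y k) (seq z k)) (ℚₚ.+-mono-< p q)))
  (h₁ (½ ℚ.* ε) (0<½* 0<ε)) (h₂ (½ ℚ.* ε) (0<½* 0<ε))
  where
  triangle : ∀ a b c → ∣ a ℚ.- c ∣ ℚ.≤ ∣ a ℚ.- b ∣ ℚ.+ ∣ b ℚ.- c ∣
  triangle a b c = subst (ℚ._≤ ∣ a ℚ.- b ∣ ℚ.+ ∣ b ℚ.- c ∣) (cong ∣_∣ (lemma a b c))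
    (ℚₚ.∣p+q∣≤∣p∣+∣q∣ (a ℚ.- b) (b ℚ.- c))
    where
    open ℚSolver.+-*-Solver
    lemma : ∀ a b c → (a ℚ.- b) ℚ.+ (b ℚ.- c) ≡ a ℚ.- c
    lemma = solve 3 (λ a b c → (a :- b) :+ (b :- c) := a :- c) refl

+-cong : ∀ {x x′ y y′} → x ≋ x′ → y ≋ y′ → x + y ≋ x′ + y′
+-cong {x} {x′} {y} {y′} (wrap h₁) (wrap h₂) .unwrap ε 0<ε = Eventually-map₂
  (λ {k} p q → subst₂ ℚ._<_ (cong ∣_∣ (sym (lemma (seq x k) (seq y k) (seq x′ k) (seq y′ k)))) (half+half ε)
    (ℚₚ.≤-<-trans (ℚₚ.∣p+q∣≤∣p∣+∣q∣ (seq x k ℚ.- seq x′ k) (seq y k ℚ.- seq y′ k)) (ℚₚ.+-mono-< p q)))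
  (h₁ (½ ℚ.* ε) (0<½* 0<ε)) (h₂ (½ ℚ.* ε) (0<½* 0<ε))
  where
  open ℚSolver.+-*-Solver
  lemma : ∀ a b c d → (a ℚ.+ b) ℚ.- (c ℚ.+ d) ≡ (a ℚ.- c) ℚ.+ (b ℚ.- d)
  lemma = solve 4 (λ a b c d → (a :+ b) :- (c :+ d) := (a :- c) :+ (b :- d)) refl

*-congʳ : ∀ {x x′} y → x ≋ x′ → x * y ≋ x′ * y
*-congʳ {x} {x′} y (wrap h) .unwrap ε 0<ε =
  let B , 0<B , bound = bounded y
      η , 0<η , Bη≡ε  = divide B ε 0<B 0<ε
  in Eventually-map₂ (λ {k} p q → subst₂ ℚ._<_ (cong ∣_∣ (sym (lemma (seq x k) (seq x′ k) (seq y k)))) Bη≡ε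
       (∣*∣< (seq y k) (seq x k ℚ.- seq x′ k) 0<B p q)) bound (h η 0<η)
  where
  open ℚSolver.+-*-Solver
  lemma : ∀ a b c → a ℚ.* c ℚ.- b ℚ.* c ≡ c ℚ.* (a ℚ.- b)
  lemma = solve 3 (λ a b c → a :* c :- b :* c := c :* (a :- b)) refl

eventually-consistent : ∀ {P : ℕ → Set} → Eventually P → ∃ P
eventually-consistent (N , p) = N , p N ℕₚ.≤-refl

eventually-positive : ∀ x → 0ℝ < x → Eventually λ k → 0ℚ ℚ.< seq x k
eventually-positive x (ε , 0<ε , h) =
  Eventually-map (λ p → ℚₚ.<-≤-trans (subst (0ℚ ℚ.<_) (sym (ℚₚ.+-identityˡ ε)) 0<ε) p) h

eventually-negative : ∀ x → x < 0ℝ → Eventually λ k → seq x k ℚ.< 0ℚ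
eventually-negative x (ε , 0<ε , h) = Eventually-map (λ {k} p → ℚₚ.<-≤-trans
  (subst (ℚ._< seq x k ℚ.+ ε) (ℚₚ.+-identityʳ (seq x k)) (ℚₚ.+-monoʳ-< (seq x k) 0<ε)) p) h

0<-resp : ∀ {x y} → x ≋ y → 0ℝ < x → 0ℝ < y
0<-resp {x} {y} (wrap x≃y) (ε , 0<ε , h) = ½ ℚ.* ε , 0<½* 0<ε , Eventually-map₂
  (λ {k} p q → combine (seq x k) (seq y k) p (ℚₚ.≤-<-trans (p≤∣p∣ (seq x k ℚ.- seq y k)) q)) h (x≃y (½ ℚ.* ε) (0<½* 0<ε))
  where
  combine : ∀ a b → 0ℚ ℚ.+ ε ℚ.≤ a → a ℚ.- b ℚ.< ½ ℚ.* ε → 0ℚ ℚ.+ ½ ℚ.* ε ℚ.≤ b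
  combine a b p q = subst (ℚ._≤ b) (sym (ℚₚ.+-identityˡ (½ ℚ.* ε)))
    (halve-apart (subst (ℚ._≤ a) (trans (ℚₚ.+-identityˡ ε) (sym (half+half ε))) p) q)

0<-* : ∀ x y → 0ℝ < x → 0ℝ < y → 0ℝ < x * y
0<-* x y (ε , 0<ε , h) (η , 0<η , g) = ε ℚ.* η , 0<* 0<ε 0<η , Eventually-map₂
  (λ {k} p q → subst (ℚ._≤ seq x k ℚ.* seq y k) (sym (ℚₚ.+-identityˡ (ε ℚ.* η)))
    (let p′ = subst (ℚ._≤ seq x k) (ℚₚ.+-identityˡ ε) p
         q′ = subst (ℚ._≤ seq y k) (ℚₚ.+-identityˡ η) q
     in *-mono-≤-nonNeg (ℚₚ.<⇒≤ 0<η) (ℚₚ.≤-trans (ℚₚ.<⇒≤ 0<ε) p′) p′ q′)) h g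

-- A term larger than `h` in absolute value, taken past the Cauchy modulus of `h / 2`, would keep
-- all later terms at distance at least `h / 2` from zero on the same side, and the number would
-- have a sign.
trichotomy : ∀ x → ¬ 0ℝ < x → ¬ x < 0ℝ → x ≃ 0ℝ
trichotomy x ≯0 ≮0 ε 0<ε = N , λ k N≤k → subst (ℚ._< ε) (cong ∣_∣ (minus0 (seq x k)))
  (subst (∣ seq x k ∣ ℚ.<_) (half+half ε) (ℚₚ.≤-<-trans
    (subst (ℚ._≤ ∣ seq x k ℚ.- seq x N ∣ ℚ.+ ∣ seq x N ∣) (cong ∣_∣ (back (seq x k) (seq x N)))
      (ℚₚ.∣p+q∣≤∣p∣+∣q∣ (seq x k ℚ.- seq x N) (seq x N)))
    (ℚₚ.+-mono-<-≤ (ℚₚ.<-trans (close k N N≤k ℕₚ.≤-refl) (quarter<half 0<h)) small)))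
  where
  open ℚSolver.+-*-Solver
  h = ½ ℚ.* ε
  e = ½ ℚ.* h
  0<h : 0ℚ ℚ.< h
  0<h = 0<½* 0<ε
  N = proj₁ (cauchy x e (0<½* 0<h))
  close = proj₂ (cauchy x e (0<½* 0<h))
  minus0 : ∀ p → p ≡ p ℚ.- 0ℚ
  minus0 = solve 1 (λ p → p := p :- con 0ℚ) refl
  back : ∀ p q → (p ℚ.- q) ℚ.+ q ≡ p
  back = solve 2 (λ p q → (p :- q) :+ q := p) refl
  quarter<half : ∀ {h} → 0ℚ ℚ.< h → ½ ℚ.* h ℚ.< h
  quarter<half {h} 0<h = subst₂ ℚ._<_ (ℚₚ.+-identityˡ (½ ℚ.* h)) (half+half h) (ℚₚ.+-monoˡ-< (½ ℚ.* h) (0<½* 0<h))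
  apart : ∀ a b c → c ℚ.< a → a ℚ.- b ℚ.< ½ ℚ.* c → ½ ℚ.* c ℚ.≤ b
  apart a b c p q = halve-apart (subst (ℚ._≤ a) (sym (half+half c)) (ℚₚ.<⇒≤ p)) q
  small : ∣ seq x N ∣ ℚ.≤ h
  small with ∣ seq x N ∣ ℚₚ.≤? h
  ... | yes ≤h = ≤h
  ... | no  ≰h with ℚₚ.∣p∣≡p∨∣p∣≡-p (seq x N)
  ... | inj₁ eq = contradiction (e , 0<½* 0<h , N , λ k N≤k →
    subst (ℚ._≤ seq x k) (sym (ℚₚ.+-identityˡ e)) (apart (seq x N) (seq x k) h (subst (h ℚ.<_) eq (ℚₚ.≰⇒> ≰h))
      (ℚₚ.≤-<-trans (p≤∣p∣ (seq x N ℚ.- seq x k)) (close N k ℕₚ.≤-refl N≤k)))) ≯0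
  ... | inj₂ eq = contradiction (e , 0<½* 0<h , N , λ k N≤k →
    subst₂ ℚ._≤_ refl (ℚₚ.+-inverseʳ (seq x k)) (ℚₚ.+-monoʳ-≤ (seq x k)
      (apart (ℚ.- seq x N) (ℚ.- seq x k) h (subst (h ℚ.<_) eq (ℚₚ.≰⇒> ≰h))
        (ℚₚ.≤-<-trans (p≤∣p∣ (ℚ.- seq x N ℚ.- ℚ.- seq x k))
          (subst (ℚ._< e) (cong ∣_∣ (negate (seq x N) (seq x k))) (close k N N≤k ℕₚ.≤-refl)))))) ≮0
    where
    negate : ∀ p q → q ℚ.- p ≡ ℚ.- p ℚ.- ℚ.- q
    negate = solve 2 (λ p q → q :- p := :- p :- (:- q)) refl

-- Determinants, collinearity and interiors over the reals.

neg : ℝ → ℝ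
neg x = fromℚ (ℚ.- 1ℚ) * x

-- Arranged as an affine function of the third point, with the coefficients of the line through the
-- first two.
det : Point → Point → Point → ℝ
det (x₁ , y₁) (x₂ , y₂) (x₃ , y₃) =
  (x₃ * (y₁ + neg y₂) + y₃ * (x₂ + neg x₁)) + (x₁ * y₂ + neg (x₂ * y₁))

det≃0⇒Collinear : ∀ {p q r} → ¬ p ≈ q → det p q r ≃ 0ℝ → Collinear p q r
det≃0⇒Collinear {x₁ , y₁} {x₂ , y₂} {x₃ , y₃} p≉q det≃0 = record
  { a = a ; b = b ; d = a * x₁ + b * y₁
  ; nondegenerate = λ (a≃0 , b≃0) → p≉q
      ( (λ ε 0<ε → Eventually-map (λ {k} → subst (ℚ._< ε)
          (trans (sym (ℚₚ.∣-p∣≡∣p∣ (seq b k ℚ.- 0ℚ))) (cong ∣_∣ (diff₁ (seq x₁ k) (seq x₂ k))))) (b≃0 ε 0<ε))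
      , (λ ε 0<ε → Eventually-map (λ {k} → subst (ℚ._< ε) (cong ∣_∣ (diff₂ (seq y₁ k) (seq y₂ k)))) (a≃0 ε 0<ε)))
  } ,
  unwrap (≋-pointwise {a * x₁ + b * y₁} {a * x₁ + b * y₁} (λ _ → refl)) ,
  unwrap (≋-pointwise {a * x₂ + b * y₂} {a * x₁ + b * y₁}
    (λ k → through (seq x₁ k) (seq y₁ k) (seq x₂ k) (seq y₂ k))) ,
  (λ ε 0<ε → Eventually-map (λ {k} → subst (ℚ._< ε)
    (cong ∣_∣ (offset (seq x₁ k) (seq y₁ k) (seq x₂ k) (seq y₂ k) (seq x₃ k) (seq y₃ k)))) (det≃0 ε 0<ε))
  where
  open ℚSolver.+-*-Solver
  a b : ℝ
  a = y₁ + neg y₂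
  b = x₂ + neg x₁
  m : ∀ {i} → Polynomial i → Polynomial i
  m p = con (ℚ.- 1ℚ) :* p
  diff₁ : ∀ a b → ℚ.- ((b ℚ.+ ℚ.- 1ℚ ℚ.* a) ℚ.- 0ℚ) ≡ a ℚ.- b
  diff₁ = solve 2 (λ a b → :- ((b :+ m a) :- con 0ℚ) := a :- b) refl
  diff₂ : ∀ a b → (a ℚ.+ ℚ.- 1ℚ ℚ.* b) ℚ.- 0ℚ ≡ a ℚ.- b
  diff₂ = solve 2 (λ a b → (a :+ m b) :- con 0ℚ := a :- b) refl
  through : ∀ a a′ b b′ → (a′ ℚ.+ ℚ.- 1ℚ ℚ.* b′) ℚ.* b ℚ.+ (b ℚ.+ ℚ.- 1ℚ ℚ.* a) ℚ.* b′
    ≡ (a′ ℚ.+ ℚ.- 1ℚ ℚ.* b′) ℚ.* a ℚ.+ (b ℚ.+ ℚ.- 1ℚ ℚ.* a) ℚ.* a′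
  through = solve 4 (λ a a′ b b′ → (a′ :+ m b′) :* b :+ (b :+ m a) :* b′
    := (a′ :+ m b′) :* a :+ (b :+ m a) :* a′) refl
  offset : ∀ a a′ b b′ c c′ → Δ a a′ b b′ c c′ ℚ.- 0ℚ ≡
    ((a′ ℚ.+ ℚ.- 1ℚ ℚ.* b′) ℚ.* c ℚ.+ (b ℚ.+ ℚ.- 1ℚ ℚ.* a) ℚ.* c′) ℚ.-
    ((a′ ℚ.+ ℚ.- 1ℚ ℚ.* b′) ℚ.* a ℚ.+ (b ℚ.+ ℚ.- 1ℚ ℚ.* a) ℚ.* a′)
  offset = solve 6 (λ a a′ b b′ c c′ → Δ′ a a′ b b′ c c′ :- con 0ℚ :=
    ((a′ :+ m b′) :* c :+ (b :+ m a) :* c′) :- ((a′ :+ m b′) :* a :+ (b :+ m a) :* a′)) refl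

-- The implicit arguments are given because inferring them would unfold the Cauchy moduli.
affine-cong : ∀ (x x′ y y′ s A B C : ℝ) → x ≋ x′ → y ≋ y′ → 1ℝ ≋ s →
  x * A + y * B + C ≋ x′ * A + y′ * B + s * C
affine-cong x x′ y y′ s A B C hx hy hs =
  +-cong {x * A + y * B} {x′ * A + y′ * B} {C} {s * C}
    (+-cong {x * A} {x′ * A} {y * B} {y′ * B} (*-congʳ {x} {x′} A hx) (*-congʳ {y} {y′} B hy))
    (≋-trans {C} {1ℝ * C} {s * C} (≋-pointwise {C} {1ℝ * C} (λ k → sym (ℚₚ.*-identityˡ (seq C k))))
      (*-congʳ {1ℝ} {s} C hs))

combination : (α β γ a b c : ℝ) → ℝ
combination α β γ a b c = α * a + β * b + γ * c

-- As a function of the third point `det` is affine and vanishes at `p` and `q`, so at `s` it is `γ`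
-- times its value at `r`.
det-interior : ∀ p q r s → s ∈Interior (p , q , r) → 0ℝ < det p q r → 0ℝ < det p q s
det-interior (x₁ , y₁) (x₂ , y₂) (x₃ , y₃) (x , y) (α , β , γ , _ , _ , 0<γ , sum , x≃ , y≃) pos =
  0<-resp {γ * Dr} {Ds} (≋-sym {Ds} {γ * Dr} (≋-trans {Ds} {E} {γ * Dr} folded
    (≋-trans {E} {E′} {γ * Dr} (affine-cong x X y Y (α + β + γ) A B C hx hy hs) expanded)))
    (0<-* γ Dr 0<γ pos)
  where
  A B C X Y Dr Ds E E′ : ℝ
  A = y₁ + neg y₂
  B = x₂ + neg x₁
  C = x₁ * y₂ + neg (x₂ * y₁)
  X = combination α β γ x₁ x₂ x₃
  Y = combination α β γ y₁ y₂ y₃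
  Dr = det (x₁ , y₁) (x₂ , y₂) (x₃ , y₃)
  Ds = det (x₁ , y₁) (x₂ , y₂) (x , y)
  E = x * A + y * B + C
  E′ = X * A + Y * B + (α + β + γ) * C
  hx : x ≋ X
  hx = wrap x≃
  hy : y ≋ Y
  hy = wrap y≃
  hs : 1ℝ ≋ α + β + γ
  hs = ≋-sym {α + β + γ} {1ℝ} (wrap sum)
  folded : Ds ≋ E
  folded = ≋-pointwise (λ _ → refl)
  expanded : E′ ≋ γ * Dr
  expanded = ≋-pointwise (λ k → Δ-interior (seq α k) (seq β k) (seq γ k)
    (seq x₁ k) (seq y₁ k) (seq x₂ k) (seq y₂ k) (seq x₃ k) (seq y₃ k))

Interior-rot : ∀ p q r s → s ∈Interior (p , q , r) → s ∈Interior (q , r , p)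
Interior-rot (x₁ , y₁) (x₂ , y₂) (x₃ , y₃) (x , y) (α , β , γ , 0<α , 0<β , 0<γ , sum , x≃ , y≃) =
  β , γ , α , 0<β , 0<γ , 0<α , unwrap h1 , unwrap hx , unwrap hy
  where
  rot : ∀ a b c → (a ℚ.+ b) ℚ.+ c ≡ (c ℚ.+ a) ℚ.+ b
  rot = solve 3 (λ a b c → (a :+ b) :+ c := (c :+ a) :+ b) refl
    where open ℚSolver.+-*-Solver
  h1 : β + γ + α ≋ 1ℝ
  h1 = ≋-trans (≋-pointwise {β + γ + α} {α + β + γ} (λ k → rot (seq β k) (seq γ k) (seq α k))) (wrap sum)
  hx : x ≋ combination β γ α x₂ x₃ x₁
  hx = ≋-trans {y = combination α β γ x₁ x₂ x₃} (wrap x≃) (≋-pointwise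
    (λ k → sym (rot (seq β k ℚ.* seq x₂ k) (seq γ k ℚ.* seq x₃ k) (seq α k ℚ.* seq x₁ k))))
  hy : y ≋ combination β γ α y₂ y₃ y₁
  hy = ≋-trans {y = combination α β γ y₁ y₂ y₃} (wrap y≃) (≋-pointwise
    (λ k → sym (rot (seq β k ℚ.* seq y₂ k) (seq γ k ℚ.* seq y₃ k) (seq α k ℚ.* seq y₁ k))))

Interior-swap : ∀ p q r s → s ∈Interior (p , q , r) → s ∈Interior (q , p , r)
Interior-swap (x₁ , y₁) (x₂ , y₂) (x₃ , y₃) (x , y) (α , β , γ , 0<α , 0<β , 0<γ , sum , x≃ , y≃) =
  β , α , γ , 0<β , 0<α , 0<γ , unwrap h1 , unwrap hx , unwrap hy
  where
  swap : ∀ a b c → (a ℚ.+ b) ℚ.+ c ≡ (b ℚ.+ a) ℚ.+ c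
  swap a b c = cong (ℚ._+ c) (ℚₚ.+-comm a b)
  h1 : β + α + γ ≋ 1ℝ
  h1 = ≋-trans (≋-pointwise {β + α + γ} {α + β + γ} (λ k → swap (seq β k) (seq α k) (seq γ k))) (wrap sum)
  hx : x ≋ combination β α γ x₂ x₁ x₃
  hx = ≋-trans {y = combination α β γ x₁ x₂ x₃} (wrap x≃) (≋-pointwise
    (λ k → swap (seq α k ℚ.* seq x₁ k) (seq β k ℚ.* seq x₂ k) (seq γ k ℚ.* seq x₃ k)))
  hy : y ≋ combination β α γ y₂ y₁ y₃
  hy = ≋-trans {y = combination α β γ y₁ y₂ y₃} (wrap y≃) (≋-pointwise
    (λ k → swap (seq α k ℚ.* seq y₁ k) (seq β k ℚ.* seq y₂ k) (seq γ k ℚ.* seq y₃ k)))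

-- From real points to an order type.

Degenerate : ∀ {n} → Fin n → Fin n → Fin n → Set
Degenerate i j k = i ≡ j ⊎ j ≡ k ⊎ i ≡ k

-- At index `N` the rational approximations have the orientation of the real points, so the
-- decidable order type can be read off from them.
Sound : ∀ {n} → (Fin n → Point) → Fin n → Fin n → Fin n → ℕ → Set
Sound p i j k N = Degenerate i j k ⊎
  (0ℝ < det (p i) (p j) (p k) × 0ℚ ℚ.< seq (det (p i) (p j) (p k)) N) ⊎
  (det (p i) (p j) (p k) < 0ℝ × seq (det (p i) (p j) (p k)) N ℚ.< 0ℚ)

-- A strict sign persists from some index on, and there are finitely many triples.
eventually-sound : ∀ {n} (p : Fin n → Point) →
  (∀ i j k → Degenerate i j k ⊎ 0ℝ < det (p i) (p j) (p k) ⊎ det (p i) (p j) (p k) < 0ℝ) →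
  Eventually (λ N → ∀ i j k → Sound p i j k N)
eventually-sound {n} p signs =
  Eventually-Π {n} {λ i N → ∀ j k → Sound p i j k N} λ i →
  Eventually-Π {n} {λ j N → ∀ k → Sound p i j k N} λ j →
  Eventually-Π {n} {λ k N → Sound p i j k N} λ k → sound i j k (signs i j k)
  where
  sound : ∀ i j k → Degenerate i j k ⊎ 0ℝ < det (p i) (p j) (p k) ⊎ det (p i) (p j) (p k) < 0ℝ →
    Eventually (Sound p i j k)
  sound i j k (inj₁ e)          = 0 , λ _ _ → inj₁ e
  sound i j k (inj₂ (inj₁ pos)) =
    Eventually-map (λ q → inj₂ (inj₁ (pos , q))) (eventually-positive (det (p i) (p j) (p k)) pos)
  sound i j k (inj₂ (inj₂ ne))  =
    Eventually-map (λ q → inj₂ (inj₂ (ne , q))) (eventually-negative (det (p i) (p j) (p k)) ne)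

module Approximation {n : ℕ} (p : Fin n → Point) (N : ℕ) (sound : ∀ i j k → Sound p i j k N) where

  D : Fin n → Fin n → Fin n → ℝ
  D i j k = det (p i) (p j) (p k)

  orderType : OrderType n
  orderType = planeOrderType (λ i → seq (proj₁ (p i)) N) (λ i → seq (proj₂ (p i)) N) generic
    where
    generic : ∀ {i j k} → i ≢ j → j ≢ k → i ≢ k → seq (D i j k) N ≢ 0ℚ
    generic {i} {j} {k} i≢j j≢k i≢k e with sound i j k
    ... | inj₁ (inj₁ i≡j)        = i≢j i≡j
    ... | inj₁ (inj₂ (inj₁ j≡k)) = j≢k j≡k
    ... | inj₁ (inj₂ (inj₂ i≡k)) = i≢k i≡k
    ... | inj₂ (inj₁ (_ , q))    = ℚₚ.<-irrefl (sym e) q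
    ... | inj₂ (inj₂ (_ , q))    = ℚₚ.<-irrefl e q

  open OrderTypeProperties orderType

  ccw⇒0<det : ∀ {i j k} → ccw i j k → 0ℝ < D i j k
  ccw⇒0<det {i} {j} {k} c with sound i j k
  ... | inj₁ (inj₁ i≡j)        = contradiction i≡j (≢₁₂ c)
  ... | inj₁ (inj₂ (inj₁ j≡k)) = contradiction j≡k (≢₂₃ c)
  ... | inj₁ (inj₂ (inj₂ i≡k)) = contradiction i≡k (≢₁₃ c)
  ... | inj₂ (inj₁ (pos , _))  = pos
  ... | inj₂ (inj₂ (_ , q))    = contradiction q (ℚₚ.<-asym c)

  0<det⇒ccw : ∀ {i j k} → 0ℝ < D i j k → ccw i j k
  0<det⇒ccw {i} {j} {k} pos with sound i j k | eventually-consistent (eventually-positive (D i j k) pos)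
  ... | inj₂ (inj₁ (_ , q)) | _ = q
  ... | inj₂ (inj₂ (ne , _)) | _ =
    let _ , a , b = eventually-consistent (Eventually-map₂ _,_ (eventually-positive (D i j k) pos) (eventually-negative (D i j k) ne))
    in contradiction b (ℚₚ.<-asym a)
  ... | inj₁ (inj₁ refl) | M , q =
    contradiction q (ℚₚ.<-irrefl (sym (δ-degenerate (λ i → seq (proj₁ (p i)) M) (λ i → seq (proj₂ (p i)) M) i k)))
  ... | inj₁ (inj₂ (inj₁ refl)) | M , q =
    contradiction q (ℚₚ.<-irrefl (sym (trans (δ-rot X Y i j j) (δ-degenerate X Y j i))))
    where
    X Y : Fin n → ℚ
    X i = seq (proj₁ (p i)) M
    Y i = seq (proj₂ (p i)) M
  ... | inj₁ (inj₂ (inj₂ refl)) | M , q =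
    contradiction q (ℚₚ.<-irrefl (sym (trans (δ-rot X Y i j i) (trans (δ-rot X Y j i i) (δ-degenerate X Y i j)))))
    where
    X Y : Fin n → ℚ
    X i = seq (proj₁ (p i)) M
    Y i = seq (proj₂ (p i)) M

  -- Makes the number of interior points in the order type an upper bound for the geometric one.
  Interior⇒In : ∀ {i j k l} → ccw i j k → p l ∈Interior (p i , p j , p k) → In i j k l
  Interior⇒In {i} {j} {k} {l} c int =
    0<det⇒ccw (det-interior (p i) (p j) (p k) (p l) int (ccw⇒0<det c)) ,
    0<det⇒ccw (det-interior (p j) (p k) (p i) (p l) int₂ (ccw⇒0<det (rot c))) ,
    0<det⇒ccw (det-interior (p k) (p i) (p j) (p l) int₃ (ccw⇒0<det (rot (rot c))))
    where
    int₂ : p l ∈Interior (p j , p k , p i)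
    int₂ = Interior-rot (p i) (p j) (p k) (p l) int
    int₃ : p l ∈Interior (p k , p i , p j)
    int₃ = Interior-rot (p j) (p k) (p i) (p l) int₂

-- From families to the number of triangles.

module Counting {s n : ℕ} (P : ColouredPointSet (suc (suc s)) n) (N : ℕ)
  (sound : ∀ i j k → Sound (point P) i j k N)
  (interior? : ∀ i j k l → Dec (point P l ∈Interior (point P i , point P j , point P k)))
  {ts : List (Fin n × Fin n × Fin n)} (complete : ∀ t → MonochromaticTriangle≤ s P t → t ∈ ts) where

  open Approximation (point P) N sound
  open Coloured orderType (colour P)

  few-interior : ∀ {i j k a b c} → (∀ {l} → point P l ∈Interior (point P i , point P j , point P k) → In a b c l) →
    # (In? a b c) ℕ.< suc s →
    ∃ λ t → (λ l → point P l ∈Interior (point P i , point P j , point P k)) HasSize t × t ℕ.≤ s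
  few-interior {i} {j} {k} {a} {b} {c} sub (s≤s few) =
    length ls ,
    (ls , Uniqueₚ.filter⁺ (interior? i j k) (Uniqueₚ.allFin⁺ n) ,
      (λ l → mk⇔ (λ l∈ → proj₂ (∈-filter⁻ (interior? i j k) {xs = allFin n} l∈)) (∈-filter⁺ (interior? i j k) (∈-allFin l))) , refl) ,
    ℕₚ.≤-trans (#-mono (interior? i j k) (In? a b c) sub) few
    where
    ls : List (Fin n)
    ls = filter (interior? i j k) (allFin n)

  Good-rot : ∀ {a b c} → Good a b c → Good b c a
  Good-rot {a} {b} {c} (abc , a≡b , b≡c , few) = rot abc , b≡c , sym (trans a≡b b≡c) ,
    ℕₚ.≤-<-trans (#-mono (In? b c a) (In? a b c) (λ i → In-rot (In-rot i))) few

  anticlockwise∈ : ∀ {i j k} → i Fin.< j → j Fin.< k → Good i j k → (i , j , k) ∈ ts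
  anticlockwise∈ {i} {j} {k} i<j j<k (ijk , i≡j , j≡k , few) =
    complete (i , j , k) (i<j , j<k , i≡j , j≡k , few-interior (Interior⇒In ijk) few)

  clockwise∈ : ∀ {i j k} → i Fin.< j → j Fin.< k → Good j i k → (i , j , k) ∈ ts
  clockwise∈ {i} {j} {k} i<j j<k (jik , j≡i , i≡k , few) =
    complete (i , j , k) (i<j , j<k , sym j≡i , trans j≡i i≡k , few-interior
      (λ {l} int → Interior⇒In jik (Interior-swap (point P i) (point P j) (point P k) (point P l) int)) few)

  images : List (Triple → Triple) → List Triple
  images []       = []
  images (f ∷ fs) = map f ts ++ images fs

  images-length : ∀ fs → length (images fs) ≡ length fs ℕ.* length ts
  images-length []       = refl
  images-length (f ∷ fs) = trans (Listₚ.length-++ (map f ts))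
    (cong₂ ℕ._+_ (Listₚ.length-map f ts) (images-length fs))

  ∈-images : ∀ {f fs t} → f ∈ fs → t ∈ ts → f t ∈ images fs
  ∈-images {f} (here refl)                 t∈ = ∈-++⁺ˡ (∈-map⁺ f t∈)
  ∈-images     {fs = g ∷ _} (there f∈)     t∈ = ∈-++⁺ʳ (map g ts) (∈-images f∈ t∈)

  -- Families list a triangle from its marked vertex, `ts` by increasing indices, so a listed triple
  -- is a rearrangement of an entry of `ts`. This costs a factor `6`.
  permutations : List (Triple → Triple)
  permutations = id ∷ (λ (i , j , k) → i , k , j) ∷ (λ (i , j , k) → j , k , i) ∷
    (λ (i , j , k) → j , i , k) ∷ (λ (i , j , k) → k , i , j) ∷ (λ (i , j , k) → k , j , i) ∷ []

  image∈ : ∀ {f t} → f ∈ permutations → t ∈ ts → f t ∈ images permutations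
  image∈ = ∈-images

  Good⇒image : ∀ {a b c} → Good a b c → (a , b , c) ∈ images permutations
  Good⇒image {a} {b} {c} g@(abc , _) with Finₚ.<-cmp a b | Finₚ.<-cmp b c | Finₚ.<-cmp a c
  ... | tri≈ _ a≡b _ | _ | _ = contradiction a≡b (≢₁₂ abc)
  ... | _ | tri≈ _ b≡c _ | _ = contradiction b≡c (≢₂₃ abc)
  ... | _ | _ | tri≈ _ a≡c _ = contradiction a≡c (≢₁₃ abc)
  ... | tri< a<b _ _ | tri< b<c _ _ | _ = image∈ (here refl) (anticlockwise∈ a<b b<c g)
  ... | tri< a<b _ _ | tri> _ _ c<b | tri< a<c _ _ =
    image∈ (there (here refl)) (clockwise∈ a<c c<b (Good-rot (Good-rot g)))
  ... | tri< a<b _ _ | tri> _ _ c<b | tri> _ _ c<a =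
    image∈ (there (there (here refl))) (anticlockwise∈ c<a a<b (Good-rot (Good-rot g)))
  ... | tri> _ _ b<a | tri< b<c _ _ | tri< a<c _ _ =
    image∈ (there (there (there (here refl)))) (clockwise∈ b<a a<c g)
  ... | tri> _ _ b<a | tri< b<c _ _ | tri> _ _ c<a =
    image∈ (there (there (there (there (here refl))))) (anticlockwise∈ b<c c<a (Good-rot g))
  ... | tri> _ _ b<a | tri> _ _ c<b | _ =
    image∈ (there (there (there (there (there (here refl)))))) (clockwise∈ c<b b<a (Good-rot g))

  Family≤ : ∀ {F R k} → Family F R k → k ℕ.≤ 6 ℕ.* length ts
  Family≤ {F} {R} (us , us! , mem , refl) = ℕₚ.≤-trans (length-⊆ us! sub) (ℕₚ.≤-reflexive (images-length permutations))
    where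
    sub : ∀ {t} → t ∈ us → t ∈ images permutations
    sub t∈ with mem t∈
    ... | member g _ _ _ _ = Good⇒image g

  -- The `12` is `6` rearrangements for each of the two families.
  triangles-large : ∀ {τ t} → 1 ℕ.≤ τ → t ≡ suc (suc s) ℕ.* τ ℕ.* 100 → t ℕ.* (t ℕ.* t) ℕ.≤ n →
    n ℕ.≤ t ℕ.* (t ℕ.* t) ℕ.* 8 → τ ℕ.* (τ ℕ.* τ ℕ.* t) ℕ.≤ length ts ℕ.* 12
  triangles-large {τ} {t} 1≤τ t≡ t³≤n n≤8t³ =
    let κ , n≤ = majority (colour P)
        k₁ , k₂ , T₁ , T₂ , bound = Iteration.many-triangles orderType (colour P) κ τ t 1≤τ t≡ t³≤n n≤8t³ n≤
    in ℕₚ.≤-trans bound (ℕₚ.≤-trans (ℕₚ.+-mono-≤ (Family≤ T₁) (Family≤ T₂)) (ℕₚ.≤-reflexive (eq (length ts))))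
    where
    eq : ∀ m → 6 ℕ.* m ℕ.+ 6 ℕ.* m ≡ m ℕ.* 12
    eq = solve-∀

-- Constants and the passage to real powers.

fourth-power-bound : ∀ K {n m τ} → n ℕ.≤ (K ℕ.* τ) ℕ.^ 3 ℕ.* 8 → τ ℕ.* (τ ℕ.* τ ℕ.* (K ℕ.* τ)) ℕ.≤ m ℕ.* 12 →
  n ℕ.^ 4 ℕ.≤ (suc (K ℕ.^ 3 ℕ.* 192) ℕ.* m) ℕ.^ 3
fourth-power-bound K {n} {m} {τ} n≤8t³ h = begin
  n ℕ.^ 4                                                      ≤⟨ ℕₚ.^-monoˡ-≤ 4 n≤8t³ ⟩
  -- A perfect cube because `8^4 = 16^3`; together with the `12` above this produces `192`.
  ((K ℕ.* τ) ℕ.^ 3 ℕ.* 8) ℕ.^ 4                                ≡⟨ regroup K τ ⟩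
  (K ℕ.^ 3 ℕ.* (τ ℕ.* (τ ℕ.* τ ℕ.* (K ℕ.* τ))) ℕ.* 16) ℕ.^ 3   ≤⟨ ℕₚ.^-monoˡ-≤ 3 (begin
      K ℕ.^ 3 ℕ.* (τ ℕ.* (τ ℕ.* τ ℕ.* (K ℕ.* τ))) ℕ.* 16         ≤⟨ ℕₚ.*-monoˡ-≤ 16 (ℕₚ.*-monoʳ-≤ (K ℕ.^ 3) h) ⟩
      K ℕ.^ 3 ℕ.* (m ℕ.* 12) ℕ.* 16                              ≡⟨ collect (K ℕ.^ 3) m ⟩
      K ℕ.^ 3 ℕ.* 192 ℕ.* m                                      ≤⟨ ℕₚ.*-monoˡ-≤ m (ℕₚ.n≤1+n (K ℕ.^ 3 ℕ.* 192)) ⟩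
      suc (K ℕ.^ 3 ℕ.* 192) ℕ.* m                                ∎) ⟩
  (suc (K ℕ.^ 3 ℕ.* 192) ℕ.* m) ℕ.^ 3                          ∎
  where
  open ℕₚ.≤-Reasoning
  regroup : ∀ K τ → ((K ℕ.* τ) ℕ.^ 3 ℕ.* 8) ℕ.^ 4 ≡ (K ℕ.^ 3 ℕ.* (τ ℕ.* (τ ℕ.* τ ℕ.* (K ℕ.* τ))) ℕ.* 16) ℕ.^ 3
  regroup = solve 2 (λ K τ → ((K :* τ) :^ 3 :* con 8) :^ 4 := (K :^ 3 :* (τ :* (τ :* τ :* (K :* τ))) :* con 16) :^ 3) refl
    where open ℕSolver.+-*-Solver
  collect : ∀ K m → K ℕ.* (m ℕ.* 12) ℕ.* 16 ≡ K ℕ.* 192 ℕ.* m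
  collect = solve-∀

-- `τ` is the quotient by `K` of the integer cube root `f`. It is positive since `K^3` is at most
-- `n`, and then `f + 1` is at most `2 K τ`, whence the factor `2^3`.
cube-scale : ∀ K n → K ℕ.^ 3 ℕ.≤ n → .{{_ : NonZero K}} →
  ∃ λ τ → 1 ℕ.≤ τ × (K ℕ.* τ) ℕ.^ 3 ℕ.≤ n × n ℕ.≤ (K ℕ.* τ) ℕ.^ 3 ℕ.* 8
cube-scale K n K³≤n = τ , 1≤τ ,
  ℕₚ.≤-trans (ℕₚ.^-monoˡ-≤ 3 Kτ≤f) (floor∛-lower n) , (begin
    n                          ≤⟨ ℕₚ.<⇒≤ (floor∛-upper n) ⟩
    suc f ℕ.^ 3                ≤⟨ ℕₚ.^-monoˡ-≤ 3 f<2Kτ ⟩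
    (K ℕ.* τ ℕ.* 2) ℕ.^ 3      ≡⟨ cube-* (K ℕ.* τ) 2 ⟩
    (K ℕ.* τ) ℕ.^ 3 ℕ.* 8      ∎)
  where
  open ℕₚ.≤-Reasoning
  f τ : ℕ
  f = floor∛ n
  τ = f ℕ./ K
  K≤f : K ℕ.≤ f
  K≤f = ℕₚ.≤-pred (cube-cancel-< (ℕₚ.≤-<-trans K³≤n (floor∛-upper n)))
  1≤τ : 1 ℕ.≤ τ
  1≤τ = DivMod.m≥n⇒m/n>0 K≤f
  Kτ≤f : K ℕ.* τ ℕ.≤ f
  Kτ≤f = ℕₚ.≤-trans (ℕₚ.≤-reflexive (ℕₚ.*-comm K τ)) (DivMod.m/n*n≤m f K)
  f<2Kτ : suc f ℕ.≤ K ℕ.* τ ℕ.* 2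
  f<2Kτ = begin-strict
    f                            ≡⟨ DivMod.m≡m%n+[m/n]*n f K ⟩
    f ℕ.% K ℕ.+ τ ℕ.* K          <⟨ ℕₚ.+-monoˡ-< (τ ℕ.* K) (DivMod.m%n<n f K) ⟩
    K ℕ.+ τ ℕ.* K                ≤⟨ ℕₚ.+-monoˡ-≤ (τ ℕ.* K) (ℕₚ.m≤m*n K τ {{ℕ.>-nonZero 1≤τ}}) ⟩
    K ℕ.* τ ℕ.+ τ ℕ.* K          ≡⟨ double K τ ⟩
    K ℕ.* τ ℕ.* 2                ∎
    where
    double : ∀ K τ → K ℕ.* τ ℕ.+ τ ℕ.* K ≡ K ℕ.* τ ℕ.* 2
    double = solve-∀

-- The inequality holds for every term of the sequence: `(r k)^3` is at most `n^4 (k + 1)^3`, to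
-- which the hypothesis applies.
4/3-power-bound : ∀ l n m → n ℕ.^ 4 ℕ.≤ (suc l ℕ.* m) ℕ.^ 3 → fromℚ (+ 1 ℚ./ suc l) * (n ^4/3) ≤ fromℕ m
4/3-power-bound l n m h ε 0<ε = 0 , λ k _ → ℚₚ.≤-trans
  (subst (ℚ._≤ + m ℚ./ 1) (sym (frac-* 1 (r k) l k)) (frac-≤ (1 ℕ.* r k) m (k ℕ.+ l ℕ.* suc k) 0 (root k)))
  (ℚₚ.≤-trans (ℚₚ.≤-reflexive (sym (ℚₚ.+-identityʳ (+ m ℚ./ 1)))) (ℚₚ.+-monoʳ-≤ (+ m ℚ./ 1) (ℚₚ.<⇒≤ 0<ε)))
  where
  r : ℕ → ℕ
  r = numer (n ℕ.^ 4)
  root : ∀ k → 1 ℕ.* r k ℕ.* 1 ℕ.≤ m ℕ.* (suc l ℕ.* suc k)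
  root k = ℕₚ.≮⇒≥ λ lt → ℕₚ.<-irrefl refl (begin-strict
    (m ℕ.* (suc l ℕ.* suc k)) ℕ.^ 3         <⟨ ℕₚ.^-monoˡ-< 3 lt ⟩
    (1 ℕ.* r k ℕ.* 1) ℕ.^ 3                 ≡⟨ cong (ℕ._^ 3) (trans (ℕₚ.*-identityʳ (1 ℕ.* r k)) (ℕₚ.*-identityˡ (r k))) ⟩
    r k ℕ.^ 3                               ≤⟨ floor∛-lower (n ℕ.^ 4 ℕ.* suc k ℕ.^ 3) ⟩
    n ℕ.^ 4 ℕ.* suc k ℕ.^ 3                 ≤⟨ ℕₚ.*-monoˡ-≤ (suc k ℕ.^ 3) h ⟩
    (suc l ℕ.* m) ℕ.^ 3 ℕ.* suc k ℕ.^ 3     ≡⟨ sym (cube-* (suc l ℕ.* m) (suc k)) ⟩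
    (suc l ℕ.* m ℕ.* suc k) ℕ.^ 3           ≡⟨ cong (ℕ._^ 3) (eq (suc l) m (suc k)) ⟩
    (m ℕ.* (suc l ℕ.* suc k)) ℕ.^ 3         ∎)
    where
    open ℕₚ.≤-Reasoning
    eq : ∀ l m k → l ℕ.* m ℕ.* k ≡ m ℕ.* (l ℕ.* k)
    eq = solve-∀

-- A determinant of distinct points without a sign vanishes, which would make them collinear.
¬¬-signs : ∀ {c n} (P : ColouredPointSet c n) → GeneralPosition P → ∀ i j k →
  ¬ ¬ (Degenerate i j k ⊎ 0ℝ < det (point P i) (point P j) (point P k) ⊎ det (point P i) (point P j) (point P k) < 0ℝ)
¬¬-signs P gp i j k undecided with i Finₚ.≟ j | j Finₚ.≟ k | i Finₚ.≟ k
... | yes i≡j | _       | _       = undecided (inj₁ (inj₁ i≡j))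
... | _       | yes j≡k | _       = undecided (inj₁ (inj₂ (inj₁ j≡k)))
... | _       | _       | yes i≡k = undecided (inj₁ (inj₂ (inj₂ i≡k)))
... | no i≢j  | no j≢k  | no i≢k  = gp i j k i≢j j≢k i≢k
  (det≃0⇒Collinear {point P i} {point P j} {point P k} (λ eq → i≢j (distinct P eq))
    (trichotomy (det (point P i) (point P j) (point P k)) (undecided ∘ inj₂ ∘ inj₁) (undecided ∘ inj₂ ∘ inj₂)))

-- K is kept as a variable because its value is too large to be normalised.
triangle-bound : ∀ s K → suc (suc s) ℕ.* 100 ≡ K → ∀ n → K ℕ.^ 3 ℕ.≤ n → ∀ m → minX≤ (suc (suc s)) s n m →
  fromℚ (+ 1 ℚ./ suc (K ℕ.^ 3 ℕ.* 192)) * (n ^4/3) ≤ fromℕ m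
triangle-bound s K K≡ n n₀≤n m ((P , gp , ts , _ , ts⇔ , len) , _) =
  4/3-power-bound (K ℕ.^ 3 ℕ.* 192) n m (decidable-stable (n ℕ.^ 4 ℕₚ.≤? (suc (K ℕ.^ 3 ℕ.* 192) ℕ.* m) ℕ.^ 3) λ ¬goal →
    ¬¬-Π (λ i → ¬¬-Π λ j → ¬¬-Π λ k → ¬¬-signs P gp i j k) λ signs →
    -- Deciding membership in interiors allows the interior points to be listed, as `HasSize`
    -- demands.
    ¬¬-Π (λ i → ¬¬-Π λ j → ¬¬-Π λ k → ¬¬-Π λ l → ¬¬-excluded-middle) λ interior? →
    ¬goal (count-bound (cube-scale K n n₀≤n {{K≢0}}) signs interior?
      (eventually-consistent (eventually-sound (point P) signs))))
  where
  K≢0 : NonZero K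
  K≢0 = subst NonZero K≡ (ℕₚ.m*n≢0 (suc (suc s)) 100)
  count-bound : (∃ λ τ → 1 ℕ.≤ τ × (K ℕ.* τ) ℕ.^ 3 ℕ.≤ n × n ℕ.≤ (K ℕ.* τ) ℕ.^ 3 ℕ.* 8) →
    (∀ i j k → Degenerate i j k ⊎ 0ℝ < det (point P i) (point P j) (point P k) ⊎
                   det (point P i) (point P j) (point P k) < 0ℝ) →
    (∀ i j k l → Dec (point P l ∈Interior (point P i , point P j , point P k))) →
    (∃ λ N → ∀ i j k → Sound (point P) i j k N) →
    n ℕ.^ 4 ℕ.≤ (suc (K ℕ.^ 3 ℕ.* 192) ℕ.* m) ℕ.^ 3
  count-bound (τ , 1≤τ , t³≤n , n≤8t³) signs interior? (N , sound) =
    fourth-power-bound K {m = m} n≤8t³ (subst (λ m → τ ℕ.* (τ ℕ.* τ ℕ.* (K ℕ.* τ)) ℕ.≤ m ℕ.* 12) len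
      (Counting.triangles-large P N sound interior? (λ t → Equivalence.from (ts⇔ t)) 1≤τ t≡
        (subst (ℕ._≤ n) (cube≡ (K ℕ.* τ)) t³≤n) (subst (λ u → n ℕ.≤ u ℕ.* 8) (cube≡ (K ℕ.* τ)) n≤8t³)))
    where
    t≡ : K ℕ.* τ ≡ suc (suc s) ℕ.* τ ℕ.* 100
    t≡ = trans (cong (ℕ._* τ) (sym K≡)) (eq (suc (suc s)) 100 τ)
      where
      eq : ∀ c h τ → c ℕ.* h ℕ.* τ ≡ c ℕ.* τ ℕ.* h
      eq = solve-∀

theorem2 : (c : ℕ) → 2 ℕ.≤ c →
    ∃ λ (L : ℝ) → 0ℝ < L × ∃ λ (n₀ : ℕ) →
    (n : ℕ) → n₀ ℕ.≤ n →
    (m : ℕ) → minX≤ c (c ∸ 2) n m → L * (n ^4/3) ≤ fromℕ m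
theorem2 (suc zero)    (s≤s ())
theorem2 (suc (suc s)) _ = assemble (suc (suc s) ℕ.* 100) refl
  where
  positive : ∀ l → 0ℝ < fromℚ (+ 1 ℚ./ suc l)
  positive l = + 1 ℚ./ suc l , frac-< 0 1 0 l (s≤s z≤n) , 0 , λ _ _ → ℚₚ.≤-reflexive (ℚₚ.+-identityˡ (+ 1 ℚ./ suc l))
  assemble : ∀ K → suc (suc s) ℕ.* 100 ≡ K →
    ∃ λ (L : ℝ) → 0ℝ < L × ∃ λ (n₀ : ℕ) →
      ∀ n → n₀ ℕ.≤ n → ∀ m → minX≤ (suc (suc s)) s n m → L * (n ^4/3) ≤ fromℕ m
  assemble K K≡ = fromℚ (+ 1 ℚ./ suc (K ℕ.^ 3 ℕ.* 192)) , positive (K ℕ.^ 3 ℕ.* 192) , K ℕ.^ 3 ,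
    triangle-bound s K K≡
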